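{- For $\sigma\in\{2431,4213,3241,4132,2413,3142\}$, $$I^{\sigma}(x)=\frac{ -1+12x+8x^2+(1-8x)^{3/2}}{32x}.$$
   Context: For a permutation $\pi=\pi_1\cdots\pi_n$ of $[n]$, let $i_\pi$ be the smallest index $i$ with $\{\pi_1,\dots,\pi_i\}=\{1,\dots,i\}$; $\pi$ is indecomposable if $i_\pi=n$. A permutation $\pi$ avoids a pattern $\tau\in\mathfrak S_k$ if no subsequence $\pi_{j_1}\cdots\pi_{j_k}$ ($j_1<\cdots<j_k$) is order-isomorphic to $\tau$. $I^\sigma_n$ denotes the number of $\sigma$-avoiding indecomposable permutations of $[n]$, and $I^\sigma(x)=\sum_{n\ge1}I^\sigma_nx^n$. -}

module Defs where

open import Data.Nat using (ℕ; zero; suc; _<ᵇ_; _≤ᵇ_; _≡ᵇ_)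
open import Data.Bool using (Bool; true; false; _∧_; _∨_; not; if_then_else_)
open import Data.List using (List; []; _∷_; length; filter; map; concatMap; upTo; take; foldr; zip)
open import Data.Bool.ListAction using (all; any)
open import Data.Integer using (ℤ; +_; _+_; _*_; -_)
import Data.Integer as ℤ
open import Relation.Nullary using (Dec)
open import Relation.Binary.PropositionalEquality using (_≡_)
open import Data.Bool.Properties using (T?)
open import Data.Bool using (T)

-- Permutations of [n] are represented as lists π₁ ⋯ πₙ of naturals.

oneTo : ℕ → List ℕ
oneTo n = map suc (upTo n)

_∈ᵇ_ : ℕ → List ℕ → Bool
x ∈ᵇ xs = any (λ y → x ≡ᵇ y) xs

words : ℕ → ℕ → List (List ℕ)
words a zero    = [] ∷ []
words a (suc k) = concatMap (λ w → map (λ x → x ∷ w) (oneTo a)) (words a k)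

-- a word of length n is a permutation of [n] iff it contains every 1..n
isPermᵇ : ℕ → List ℕ → Bool
isPermᵇ n w = all (λ i → i ∈ᵇ w) (oneTo n)

Perms : ℕ → List (List ℕ)
Perms n = filter (λ w → T? (isPermᵇ n w)) (words n n)

prefixIsInitialᵇ : List ℕ → ℕ → Bool
prefixIsInitialᵇ π i =
  all (λ x → x ≤ᵇ i) (take i π) ∧ all (λ j → j ∈ᵇ take i π) (oneTo i)

indecomposableᵇ : ℕ → List ℕ → Bool
indecomposableᵇ n π = not (any (λ i → prefixIsInitialᵇ π i) (oneTo (n Data.Nat.∸ 1)))

subseqs : {A : Set} → ℕ → List A → List (List A)
subseqs zero    _        = [] ∷ []
subseqs (suc k) []       = []
subseqs (suc k) (x ∷ xs) = map (x ∷_) (subseqs k xs) Data.List.++ subseqs (suc k) xs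

_⇔ᵇ_ : Bool → Bool → Bool
true  ⇔ᵇ b = b
false ⇔ᵇ b = not b

orderIsoᵇ : List ℕ → List ℕ → Bool
orderIsoᵇ []       []       = true
orderIsoᵇ (a ∷ as) (b ∷ bs) =
  all (λ p → (a <ᵇ Data.Product.proj₁ p) ⇔ᵇ (b <ᵇ Data.Product.proj₂ p)) (zip as bs)
  ∧ orderIsoᵇ as bs
  where import Data.Product
orderIsoᵇ _        _        = false

containsᵇ : List ℕ → List ℕ → Bool
containsᵇ π τ = any (λ s → orderIsoᵇ s τ) (subseqs (length τ) π)

avoidsᵇ : List ℕ → List ℕ → Bool
avoidsᵇ π τ = not (containsᵇ π τ)

I : List ℕ → ℕ → ℕ
I σ n = length (filter (λ π → T? (indecomposableᵇ n π ∧ avoidsᵇ π σ)) (Perms n))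

-- Formal power series over ℤ as coefficient sequences.

PS : Set
PS = ℕ → ℤ

_⊕_ : PS → PS → PS
(f ⊕ g) n = f n + g n

sumℤ : List ℤ → ℤ
sumℤ = foldr _+_ (+ 0)

_⊛_ : PS → PS → PS
(f ⊛ g) n = sumℤ (map (λ k → f k * g (n Data.Nat.∸ k)) (upTo (suc n)))

poly : List ℤ → PS
poly []       _       = + 0
poly (c ∷ cs) zero    = c
poly (c ∷ cs) (suc n) = poly cs n

infixr 7 _·_
infixl 6 _⊕_
_·_ : ℤ → PS → PS
(c · f) n = c * f n

xTimes : PS → PS
xTimes f zero    = + 0
xTimes f (suc n) = f n

Igf : List ℕ → PS
Igf σ zero    = + 0
Igf σ (suc n) = + I σ (suc n)

-- (1-8x)^{3/2} is, as a formal power series, the unique series S with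
-- constant term 1 and S² = (1-8x)³ = 1 - 24x + 192x² - 512x³.
IsSqrtOneMinus8xCubed : PS → Set
IsSqrtOneMinus8xCubed S =
  (S 0 ≡ + 1) × ((n : ℕ) → (S ⊛ S) n ≡ poly (+ 1 ∷ - (+ 24) ∷ + 192 ∷ - (+ 512) ∷ []) n)
  where open import Data.Product using (_×_)

{-# OPTIONS --safe #-}

-- Let F(u) count σ-avoiding permutations, u marking the active sites: the places at which a new
-- minimum can be inserted without creating σ.  For σ = 3241 the entries after the leading entry k, and
-- for σ = 2413 the entries before the final entry k, form a σ-avoider on the letters above k into whose
-- active sites arbitrary σ-avoiders (blocks) have been inserted; the blocks use the letters below k and
-- increase from left to right.  In both cases the active sites of the result are determined by the
-- first nonempty block, so with S = F(1) the recursive description gives, for every power series w,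
--   (S − w) F(w) = w (S − w) + x w (S − w) F(w) + w (F(w) − w) (S − 1 − x F(w)).
-- The other four patterns reduce to these two by inverses and reverse-complements, and S = 1 + I S
-- because every permutation is uniquely a direct sum of an indecomposable one and a permutation.
--
-- The functional equation says Q(w)² = S B(w), with Q linear in F(w) and B an explicit cubic in w.  Choosing a
-- power series U with Q(U) = 0 makes U a double root of B, whence (1 + x) U² − 3 U + 2 = 0 and
-- S (U − 1) = x U⁴.  Thus 3 − 2 (1 + x) U is the square root of 1 − 8x, and its product with 1 − 8x is
-- the claimed series.
module Submission where

-- The removed letter k can only play the 3 of 3241 or of 2413, and the other letters of the pattern
-- then read 2 4 1: one below k, one above k, a smaller one below k. Forbidding such triples makes
-- the blocks increase from left to right. An occurrence that avoids k and is neither all high nor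
-- all low has its 1 low and its 4 high; if its 2 is low it contains such a triple, and if its 2 is
-- high its 1 is the only low letter. The latter case, with the low letter lowered to 0, is what the
-- activity of the sites excludes. A new minimum behind a nonempty block would complete a triple 2 4
-- 1, whence the role of the first nonempty block. F is a function from power series to power
-- series, because the recursion produces the value F(S) and the argument evaluates F at U and at U
-- + x^N. A derivative of F in w is avoided: all that is used is that F respects congruence modulo
-- x^N for every N.

-- Formal power series over the integers: ring structure, congruence modulo powers of `X`, fixed
-- points.

module PowerSeries where

  open import Defs using (PS; _⊛_; sumℤ; xTimes)
  open import Data.Nat as ℕ using (ℕ; zero; suc; _<_; _≤_; z≤n; s≤s)
  import Data.Nat.Properties as ℕₚ
  open import Data.Integer using (ℤ; +_; -_)
  import Data.Integer as ℤ
  import Data.Integer.Properties as ℤₚ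
  open import Data.Integer.Solver using (module +-*-Solver)
  open import Data.List using (applyUpTo)
  open import Data.List.Properties using (map-applyUpTo)
  open import Data.Product using (_,_)
  open import Data.Sum using (inj₁; inj₂)
  open import Data.Maybe using (Maybe; just; nothing)
  open import Relation.Nullary using (yes; no)
  open import Relation.Binary.PropositionalEquality
  open import Function using (id)
  open import Algebra.Bundles using (CommutativeRing; RawRing)
  import Algebra.Solver.Ring as RingSolver
  import Algebra.Solver.Ring.AlmostCommutativeRing as ACR

  infix 4 _≈_
  infixl 6 _+_ _-_
  infixl 7 _*_

  _≈_ : PS → PS → Set
  f ≈ g = ∀ n → f n ≡ g n

  const : ℤ → PS
  const c zero = c
  const c (suc _) = + 0

  tl : PS → PS
  tl f n = f (suc n)

  _+_ : PS → PS → PS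
  (f + g) n = f n ℤ.+ g n

  neg : PS → PS
  neg f n = - f n

  _-_ : PS → PS → PS
  f - g = f + neg g

  -- The Cauchy product by recursion on the tail of the left factor, so that the ring laws follow by
  -- induction on the index; `⊛≈*` identifies it with `_⊛_`.
  _*_ : PS → PS → PS
  (f * g) zero = f 0 ℤ.* g 0
  (f * g) (suc n) = f 0 ℤ.* g (suc n) ℤ.+ (tl f * g) n

  scale : ℤ → PS → PS
  scale c f n = c ℤ.* f n

  *-cong : ∀ {f f' g g'} → f ≈ f' → g ≈ g' → f * g ≈ f' * g'
  *-cong p q zero = cong₂ ℤ._*_ (p 0) (q 0)
  *-cong {f} {f'} p q (suc n) =
    cong₂ ℤ._+_ (cong₂ ℤ._*_ (p 0) (q (suc n))) (*-cong {tl f} {tl f'} (λ i → p (suc i)) q n)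

  scale-* : ∀ c f g n → (scale c f * g) n ≡ c ℤ.* (f * g) n
  scale-* c f g zero = ℤₚ.*-assoc c (f 0) (g 0)
  scale-* c f g (suc n) = trans (cong (λ z → c ℤ.* f 0 ℤ.* g (suc n) ℤ.+ z) (scale-* c (tl f) g n))
    (solve 4 (λ c a b d → c :* a :* b :+ c :* d := c :* (a :* b :+ d)) refl c (f 0) (g (suc n)) ((tl f * g) n))
    where open +-*-Solver

  *-distribʳ : ∀ f g h n → ((g + h) * f) n ≡ (g * f + h * f) n
  *-distribʳ f g h zero = ℤₚ.*-distribʳ-+ (f 0) (g 0) (h 0)
  *-distribʳ f g h (suc n) = trans (cong (λ z → (g 0 ℤ.+ h 0) ℤ.* f (suc n) ℤ.+ z) (*-distribʳ f (tl g) (tl h) n))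
    (solve 5 (λ a b c d e → (a :+ b) :* c :+ (d :+ e) := a :* c :+ d :+ (b :* c :+ e)) refl
      (g 0) (h 0) (f (suc n)) ((tl g * f) n) ((tl h * f) n))
    where open +-*-Solver

  *-sucʳ : ∀ f g n → (f * g) (suc n) ≡ f (suc n) ℤ.* g 0 ℤ.+ (f * tl g) n
  *-sucʳ f g zero = ℤₚ.+-comm (f 0 ℤ.* g 1) (f 1 ℤ.* g 0)
  *-sucʳ f g (suc n) = trans (cong (λ z → f 0 ℤ.* g (suc (suc n)) ℤ.+ z) (*-sucʳ (tl f) g n))
    (solve 3 (λ a b c → a :+ (b :+ c) := b :+ (a :+ c)) refl
      (f 0 ℤ.* g (suc (suc n))) (f (suc (suc n)) ℤ.* g 0) ((tl f * tl g) n))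
    where open +-*-Solver

  *-comm : ∀ f g → f * g ≈ g * f
  *-comm f g zero = ℤₚ.*-comm (f 0) (g 0)
  *-comm f g (suc n) = trans (cong₂ ℤ._+_ (ℤₚ.*-comm (f 0) (g (suc n))) (*-comm (tl f) g n)) (sym (*-sucʳ g f n))

  *-assoc : ∀ f g h → (f * g) * h ≈ f * (g * h)
  *-assoc f g h zero = ℤₚ.*-assoc (f 0) (g 0) (h 0)
  *-assoc f g h (suc n) = trans
    (cong (λ z → f 0 ℤ.* g 0 ℤ.* h (suc n) ℤ.+ z)
      (trans (*-distribʳ h (scale (f 0) (tl g)) (tl f * g) n)
        (cong₂ ℤ._+_ (scale-* (f 0) (tl g) h n) (*-assoc (tl f) g h n))))
    (solve 5 (λ a b c d e → a :* b :* c :+ (a :* d :+ e) := a :* (b :* c :+ d) :+ e) refl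
      (f 0) (g 0) (h (suc n)) ((tl g * h) n) ((tl f * (g * h)) n))
    where open +-*-Solver

  zero-* : ∀ {z} f → (∀ n → z n ≡ + 0) → ∀ n → (z * f) n ≡ + 0
  zero-* f p zero = cong (ℤ._* f 0) (p 0)
  zero-* f p (suc n) = cong₂ ℤ._+_ (cong (ℤ._* f (suc n)) (p 0)) (zero-* f (λ i → p (suc i)) n)

  const-* : ∀ c f n → (const c * f) n ≡ c ℤ.* f n
  const-* c f zero = refl
  const-* c f (suc n) = trans (cong (λ z → c ℤ.* f (suc n) ℤ.+ z) (zero-* f (λ _ → refl) n)) (ℤₚ.+-identityʳ _)

  *-identityˡ : ∀ f → const (+ 1) * f ≈ f
  *-identityˡ f n = trans (const-* (+ 1) f n) (ℤₚ.*-identityˡ (f n))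

  ring : CommutativeRing _ _
  ring = record
    { Carrier = PS ; _≈_ = _≈_ ; _+_ = _+_ ; _*_ = _*_ ; -_ = neg ; 0# = const (+ 0) ; 1# = const (+ 1)
    ; isCommutativeRing = record
      { isRing = record
        { +-isAbelianGroup = record
          { isGroup = record
            { isMonoid = record
              { isSemigroup = record
                { isMagma = record
                  { isEquivalence = record
                    { refl = λ _ → refl ; sym = λ p n → sym (p n) ; trans = λ p q n → trans (p n) (q n) }
                  ; ∙-cong = λ p q n → cong₂ ℤ._+_ (p n) (q n) }
                ; assoc = λ f g h n → ℤₚ.+-assoc (f n) (g n) (h n) }
              ; identity = (λ f → λ { zero → ℤₚ.+-identityˡ _ ; (suc n) → ℤₚ.+-identityˡ _ })
                         , (λ f → λ { zero → ℤₚ.+-identityʳ _ ; (suc n) → ℤₚ.+-identityʳ _ }) }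
            ; inverse = (λ f → λ { zero → ℤₚ.+-inverseˡ (f 0) ; (suc n) → ℤₚ.+-inverseˡ (f (suc n)) })
                      , (λ f → λ { zero → ℤₚ.+-inverseʳ (f 0) ; (suc n) → ℤₚ.+-inverseʳ (f (suc n)) })
            ; ⁻¹-cong = λ p n → cong -_ (p n) }
          ; comm = λ f g n → ℤₚ.+-comm (f n) (g n) }
        ; *-cong = *-cong
        ; *-assoc = *-assoc
        ; *-identity = *-identityˡ , (λ f n → trans (*-comm f _ n) (*-identityˡ f n))
        ; distrib = (λ f g h n → trans (*-comm f (g + h) n) (trans (*-distribʳ f g h n)
                        (cong₂ ℤ._+_ (*-comm g f n) (*-comm h f n))))
                  , *-distribʳ
        }
      ; *-comm = *-comm } }

  open CommutativeRing ring public using ()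
    renaming (refl to ≈-refl; sym to ≈-sym; trans to ≈-trans; +-cong to +-cong; -‿cong to neg-cong)

  coeff≟ : ∀ a b → Maybe (const a ≈ const b)
  coeff≟ a b with a ℤ.≟ b
  ... | yes eq = just (λ n → cong (λ c → const c n) eq)
  ... | no _ = nothing

  almostCommutativeRing : ACR.AlmostCommutativeRing _ _
  almostCommutativeRing = ACR.fromCommutativeRing ring

  ℤ-rawRing : RawRing _ _
  ℤ-rawRing = CommutativeRing.rawRing ℤₚ.+-*-commutativeRing

  const-morphism : ℤ-rawRing ACR.-Raw-AlmostCommutative⟶ almostCommutativeRing
  const-morphism = record
    { ⟦_⟧ = const
    ; +-homo = λ a b → λ { zero → refl ; (suc n) → refl }
    ; *-homo = λ a b → λ { zero → refl
                          ; (suc n) → sym (trans (const-* a (const b) (suc n)) (ℤₚ.*-zeroʳ a)) }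
    ; -‿homo = λ a → λ { zero → refl ; (suc n) → refl }
    ; 0-homo = λ _ → refl
    ; 1-homo = λ _ → refl }

  -- Integer coefficients have decidable equality, so the solver can cancel terms; the long
  -- polynomial identities below depend on this.
  module Solver = RingSolver ℤ-rawRing almostCommutativeRing const-morphism coeff≟

  𝟘 : PS
  𝟘 = const (+ 0)

  𝟘-coeff : ∀ n → 𝟘 n ≡ + 0
  𝟘-coeff zero = refl
  𝟘-coeff (suc _) = refl

  𝟙 X : PS
  𝟙 = const (+ 1)
  X zero = + 0
  X (suc zero) = + 1
  X (suc (suc _)) = + 0

  X*-zero : ∀ f → (X * f) 0 ≡ + 0
  X*-zero f = ℤₚ.*-zeroˡ (f 0)

  X*-suc : ∀ f n → (X * f) (suc n) ≡ f n
  X*-suc f n = trans (ℤₚ.+-identityˡ _) (trans (*-cong {tl X} {𝟙} {f} {f} (λ { zero → refl ; (suc _) → refl }) (λ _ → refl) n)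
    (*-identityˡ f n))

  X*≈xTimes : ∀ f → X * f ≈ xTimes f
  X*≈xTimes f zero = X*-zero f
  X*≈xTimes f (suc n) = X*-suc f n

  sum-applyUpTo-⊛ : ∀ f g n → sumℤ (applyUpTo (λ k → f k ℤ.* g (n ℕ.∸ k)) (suc n)) ≡ (f * g) n
  sum-applyUpTo-⊛ f g zero = ℤₚ.+-identityʳ _
  sum-applyUpTo-⊛ f g (suc n) = cong (λ z → f 0 ℤ.* g (suc n) ℤ.+ z) (sum-applyUpTo-⊛ (tl f) g n)

  ⊛≈* : ∀ f g → f ⊛ g ≈ f * g
  ⊛≈* f g n = trans (cong sumℤ (map-applyUpTo id (λ k → f k ℤ.* g (n ℕ.∸ k)) (suc n)))
                   (sum-applyUpTo-⊛ f g n)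

  infix 4 _≈[_]_
  _≈[_]_ : PS → ℕ → PS → Set
  f ≈[ N ] g = ∀ {i} → i < N → f i ≡ g i

  ≈⇒≈[] : ∀ {f g N} → f ≈ g → f ≈[ N ] g
  ≈⇒≈[] p {i} _ = p i

  ≈[]-sym : ∀ {f g N} → f ≈[ N ] g → g ≈[ N ] f
  ≈[]-sym p i<N = sym (p i<N)

  ≈[]-trans : ∀ {f g h N} → f ≈[ N ] g → g ≈[ N ] h → f ≈[ N ] h
  ≈[]-trans p q i<N = trans (p i<N) (q i<N)

  ≈[]-weaken : ∀ {f g M N} → M ≤ N → f ≈[ N ] g → f ≈[ M ] g
  ≈[]-weaken M≤N p i<M = p (ℕₚ.≤-trans i<M M≤N)

  +-cong[] : ∀ {f f' g g' N} → f ≈[ N ] f' → g ≈[ N ] g' → f + g ≈[ N ] f' + g'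
  +-cong[] p q i<N = cong₂ ℤ._+_ (p i<N) (q i<N)

  neg-cong[] : ∀ {f f' N} → f ≈[ N ] f' → neg f ≈[ N ] neg f'
  neg-cong[] p i<N = cong -_ (p i<N)

  *-cong[] : ∀ {f f' g g' N} → f ≈[ N ] f' → g ≈[ N ] g' → f * g ≈[ N ] f' * g'
  *-cong[] p q {zero} i<N = cong₂ ℤ._*_ (p i<N) (q i<N)
  *-cong[] {f} {f'} {N = suc N} p q {suc i} (s≤s i<N) = cong₂ ℤ._+_ (cong₂ ℤ._*_ (p (s≤s z≤n)) (q (s≤s i<N)))
    (*-cong[] {tl f} {tl f'} {N = N} (λ j<N → p (s≤s j<N)) (λ j<N → q (ℕₚ.m≤n⇒m≤1+n j<N)) i<N)

  -- A factor `X` gains one coefficient of agreement; every contraction below comes from here.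
  X*-cong[] : ∀ {f g N} → f ≈[ N ] g → X * f ≈[ suc N ] X * g
  X*-cong[] {f} {g} p {zero} _ = trans (X*-zero f) (sym (X*-zero g))
  X*-cong[] {f} {g} p {suc i} (s≤s i<N) = trans (X*-suc f i) (trans (p i<N) (sym (X*-suc g i)))

  ≈[]-all : ∀ {f g} → (∀ N → f ≈[ N ] g) → f ≈ g
  ≈[]-all p n = p (suc n) ℕₚ.≤-refl

  pow : PS → ℕ → PS
  pow w zero = 𝟙
  pow w (suc m) = w * pow w m

  pow-cong[] : ∀ {w w' N} m → w ≈[ N ] w' → pow w m ≈[ N ] pow w' m
  pow-cong[] zero p _ = refl
  pow-cong[] (suc m) p = *-cong[] p (pow-cong[] m p)

  pow-𝟙 : ∀ m → pow 𝟙 m ≈ 𝟙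
  pow-𝟙 zero _ = refl
  pow-𝟙 (suc m) = ≈-trans (*-identityˡ (pow 𝟙 m)) (pow-𝟙 m)

  X^ : ℕ → PS
  X^ = pow X

  X^-assoc-suc : ∀ N f → X^ (suc N) * f ≈ X * (X^ N * f)
  X^-assoc-suc N f = *-assoc X (X^ N) f

  X^*-low : ∀ N f → X^ N * f ≈[ N ] 𝟘
  X^*-low (suc N) f {zero} _ = trans (X^-assoc-suc N f 0) (X*-zero (X^ N * f))
  X^*-low (suc N) f {suc i} (s≤s i<N) = trans (X^-assoc-suc N f (suc i)) (trans (X*-suc (X^ N * f) i)
    (trans (X^*-low N f i<N) (𝟘-coeff i)))

  X^*-shift : ∀ N f i → (X^ N * f) (N ℕ.+ i) ≡ f i
  X^*-shift zero f i = *-identityˡ f i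
  X^*-shift (suc N) f i = trans (X^-assoc-suc N f (suc (N ℕ.+ i))) (trans (X*-suc (X^ N * f) (N ℕ.+ i)) (X^*-shift N f i))

  X^*-cancel : ∀ N {f g} → X^ N * f ≈ X^ N * g → f ≈ g
  X^*-cancel N {f} {g} p i = trans (sym (X^*-shift N f i)) (trans (p (N ℕ.+ i)) (X^*-shift N g i))

  ≈[]0⇒X^* : ∀ N f → f ≈[ N ] 𝟘 → f ≈ X^ N * (λ i → f (N ℕ.+ i))
  ≈[]0⇒X^* zero f p i = sym (*-identityˡ f i)
  ≈[]0⇒X^* (suc N) f p zero =
    trans (p (s≤s z≤n)) (sym (trans (X^-assoc-suc N f' 0) (X*-zero (X^ N * f'))))
    where
    f' : PS
    f' i = f (suc N ℕ.+ i)
  ≈[]0⇒X^* (suc N) f p (suc i) =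
    trans (≈[]0⇒X^* N (tl f) (λ {j} j<N → trans (p (s≤s j<N)) (sym (𝟘-coeff j))) i)
          (sym (trans (X^-assoc-suc N f' (suc i)) (X*-suc (X^ N * f') i)))
    where
    f' : PS
    f' i = f (suc N ℕ.+ i)

  -- The first nonzero coefficient of `f` would survive in the product: if `f` vanishes below `i`,
  -- then `X^ i` factors out and coefficient `i` of `u * f` is `u 0` times that of `f`.
  *-cancel-unit : ∀ u {f} → u 0 ≡ + 1 → u * f ≈ 𝟘 → f ≈ 𝟘
  *-cancel-unit u {f} u₀ p n = below (suc n) ℕₚ.≤-refl
    where
    below : ∀ n → f ≈[ n ] 𝟘
    below zero ()
    below (suc n) {i} (s≤s i≤n) with ℕₚ.m≤n⇒m<n∨m≡n i≤n
    ... | inj₁ i<n = below n i<n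
    ... | inj₂ refl = trans (sym eq) (p i)
      where
      f₀ : PS
      f₀ j = f (i ℕ.+ j)
      eq : (u * f) i ≡ f i
      eq = trans (*-cong {u} {u} (λ _ → refl) (≈[]0⇒X^* i f (below i)) i)
        (trans (mid i) (trans (cong (X^ i * (u * f₀)) (sym (ℕₚ.+-identityʳ i)))
          (trans (X^*-shift i (u * f₀) 0) (trans (cong (ℤ._* f₀ 0) u₀)
            (trans (ℤₚ.*-identityˡ _) (cong f (ℕₚ.+-identityʳ i)))))))
        where
        mid : u * (X^ i * f₀) ≈ X^ i * (u * f₀)
        mid = Solver.solve 3 (λ a b c → a Solver.:* (b Solver.:* c) Solver.:= b Solver.:* (a Solver.:* c))
                (λ _ → refl) u (X^ i) f₀

  iter : (PS → PS) → ℕ → PS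
  iter Φ zero = 𝟘
  iter Φ (suc k) = Φ (iter Φ k)

  -- For a contraction each application settles one more coefficient, so coefficient `n` is final
  -- after `suc n` iterations.
  fix : (PS → PS) → PS
  fix Φ n = iter Φ (suc n) n

  fix-spec : ∀ Φ → (∀ {f g} N → f ≈[ N ] g → Φ f ≈[ suc N ] Φ g) → fix Φ ≈ Φ (fix Φ)
  fix-spec Φ contract n = sym (contract n (λ {i} → stable i n) ℕₚ.≤-refl)
    where
    step : ∀ k → iter Φ k ≈[ k ] iter Φ (suc k)
    step zero ()
    step (suc k) = contract k (step k)
    stable : ∀ i n → i < n → fix Φ i ≡ iter Φ n i
    stable i (suc n) (s≤s i≤n) with ℕₚ.m≤n⇒m<n∨m≡n i≤n
    ... | inj₁ i<n = trans (stable i n i<n) (step n i<n)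
    ... | inj₂ refl = refl

-- The quadratic method for the functional equation.

module QuadraticMethod where

  open PowerSeries
  open import Defs using (PS)
  open import Data.Nat as ℕ using (ℕ; suc)
  open import Data.Integer using (ℤ; +_; -_)
  import Data.Integer as ℤ
  import Data.Integer.Properties as ℤₚ
  open import Relation.Binary.PropositionalEquality using (_≡_; refl; sym; trans; cong; cong₂)

  open Solver using (solve; _:+_; _:*_; _:-_; con; _:=_)

  -- With `*𝟘`, `+𝟘` and `undiff` this gives proofs by ideal membership: the difference of two sides
  -- is written as a combination of series known to vanish, and the solver checks the combination.
  diff : ∀ {f g} → f ≈ g → f - g ≈ 𝟘
  diff {f} {g} p n = trans (cong (ℤ._- g n) (p n)) (trans (ℤₚ.+-inverseʳ (g n)) (sym (𝟘-coeff n)))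

  *𝟘 : ∀ c {f} → f ≈ 𝟘 → c * f ≈ 𝟘
  *𝟘 c {f} p n = trans (*-cong {c} {c} (λ _ → refl) p n) (trans (*-comm c 𝟘 n)
    (trans (zero-* c 𝟘-coeff n) (sym (𝟘-coeff n))))

  +𝟘 : ∀ {f g} → f ≈ 𝟘 → g ≈ 𝟘 → f + g ≈ 𝟘
  +𝟘 p q n = trans (cong₂ ℤ._+_ (trans (p n) (𝟘-coeff n)) (trans (q n) (𝟘-coeff n))) (sym (𝟘-coeff n))

  undiff : ∀ {f g} → f - g ≈ 𝟘 → f ≈ g
  undiff {f} {g} p n = ℤₚ.i-j≡0⇒i≡j (f n) (g n) (trans (p n) (𝟘-coeff n))

  const-cancel : ∀ k {f} → const (+ suc k) * f ≈ 𝟘 → f ≈ 𝟘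
  const-cancel k {f} p n = trans
    (ℤₚ.*-cancelˡ-≡ (+ suc k) (f n) (+ 0)
      (trans (sym (const-* (+ suc k) f n)) (trans (p n) (trans (𝟘-coeff n) (sym (ℤₚ.*-zeroʳ (+ suc k)))))))
    (sym (𝟘-coeff n))

  X*-cancel : ∀ {f} → X * f ≈ 𝟘 → f ≈ 𝟘
  X*-cancel {f} p n = trans (sym (X*-suc f n)) (trans (p (suc n)) (sym (𝟘-coeff n)))

  c2 c3 c4 c8 : PS
  c2 = const (+ 2)
  c3 = const (+ 3)
  c4 = const (+ 4)
  c8 = const (+ 8)

  module Quadratic
    (G : PS → PS) (S I : PS)
    (G-cong[] : ∀ {w w' N} → w ≈[ N ] w' → G w ≈[ N ] G w')
    (S-inverse : S * (𝟙 - I) ≈ 𝟙)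
    (G-eq : ∀ w → (S - w) * G w ≈ w * (S - w) + X * w * ((S - w) * G w) + w * ((G w - w) * (S - 𝟙 - X * G w)))
    where

    V : PS
    V = 𝟙 - I

    -- By `S-inverse`, `V` is 1/S. Dividing Q(u) = 0 by `S` gives (1 + X) u - 1 = 2 X u G(u) V,
    -- which is u = Φ(u); the factor `X` makes `Φ` a contraction.
    Φ : PS → PS
    Φ u = 𝟙 + X * (c2 * (u * G u * V) - u)

    U : PS
    U = fix Φ

    U-eq : U ≈ Φ U
    U-eq = fix-spec Φ λ N p → +-cong[] {𝟙} {𝟙} (λ _ → refl)
      (X*-cong[] (+-cong[] (*-cong[] {c2} {c2} (λ _ → refl) (*-cong[] {g = V} {V} (*-cong[] p (G-cong[] p)) (λ _ → refl))) (neg-cong[] p)))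

    U₀ : U 0 ≡ + 1
    U₀ = trans (U-eq 0) (cong (λ z → + 1 ℤ.+ z) (X*-zero (c2 * (U * G U * V) - U)))

    P : PS → PS
    P w = w - 𝟙 + X * w

    -- `G-eq w` rearranges to X w g² - S P(w) g + S w (w - 1) = 0 for g = `G w`. `Q w` is the
    -- derivative of the left side in g and `S * B w` is its discriminant, so multiplying by 4 X w
    -- completes the square.
    Q : PS → PS
    Q w = c2 * X * w * G w - S * P w

    B : PS → PS
    B w = S * P w * P w + c4 * X * w * w * (𝟙 - w)

    Q-square : ∀ w → Q w * Q w ≈ S * B w
    Q-square w = undiff (≈-trans
      (solve 4 (λ x w g s →
         let p = w :- con (+ 1) :+ x :* w
             q = con (+ 2) :* x :* w :* g :- s :* p
             b = s :* p :* p :+ con (+ 4) :* x :* w :* w :* (con (+ 1) :- w)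
             l = (s :- w) :* g
             r = w :* (s :- w) :+ x :* w :* ((s :- w) :* g) :+ w :* ((g :- w) :* (s :- con (+ 1) :- x :* g))
         in q :* q :- s :* b := con (+ 4) :* x :* w :* (l :- r))
         (λ _ → refl) X w (G w) S)
      (*𝟘 (c4 * X * w) (diff (G-eq w))))

    QU : Q U ≈ 𝟘
    QU = ≈-trans
      (solve 5 (λ x u g s i →
         let v = con (+ 1) :- i
             p = u :- con (+ 1) :+ x :* u
             q = con (+ 2) :* x :* u :* g :- s :* p
             φ = con (+ 1) :+ x :* (con (+ 2) :* (u :* g :* v) :- u)
         in q := (con (+ 0) :- s) :* (u :- φ) :+ (con (+ 0) :- con (+ 2) :* x :* u :* g) :* (s :* v :- con (+ 1)))
         (λ _ → refl) X U (G U) S I)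
      (+𝟘 (*𝟘 (𝟘 - S) (diff U-eq)) (*𝟘 (𝟘 - c2 * X * U * G U) (diff S-inverse)))

    B-of : ∀ w → B w ≈ V * (Q w * Q w)
    B-of w = undiff (≈-trans
      (solve 4 (λ b q s v → b :- v :* q := v :* (s :* b :- q) :+ (con (+ 0) :- b) :* (s :* v :- con (+ 1)))
        (λ _ → refl) (B w) (Q w * Q w) S V)
      (+𝟘 (*𝟘 V (diff (≈-sym (Q-square w)))) (*𝟘 (𝟘 - B w) (diff S-inverse))))

    BU : B U ≈ 𝟘
    BU = ≈-trans (B-of U) (*𝟘 V (*𝟘 (Q U) QU))

    -- The derivative of `B` in w, taken at `U`; beside `BU`, its vanishing makes `U` a double root.
    B' : PS
    B' = c2 * S * P U * (𝟙 + X) + c4 * X * (c2 * U - c3 * U * U)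

    -- Q vanishes to order N at U + X^N, so S B = Q² vanishes there to order 2N,
    -- while B (U + X^N) ≡ X^N B' modulo X^{2N}.
    B'≈[]0 : ∀ N → B' ≈[ N ] 𝟘
    B'≈[]0 N = ≈[]-trans (≈⇒≈[] eq) (X^*-low N (V * q * q - C))
      where
      e : PS
      e = X^ N
      -- The Taylor remainder: `B (U + e)` equals `B U + e * B' + e * e * C`.
      C : PS
      C = S * (𝟙 + X) * (𝟙 + X) + c4 * X * (𝟙 - c3 * U - e)
      e≈0 : e ≈[ N ] 𝟘
      e≈0 = ≈[]-trans (≈⇒≈[] (≈-trans (≈-sym (*-identityˡ e)) (*-comm 𝟙 e))) (X^*-low N 𝟙)
      w : PS
      w = U + e
      w≈U : w ≈[ N ] U
      w≈U {i} i<N = trans (cong (λ z → U i ℤ.+ z) (trans (e≈0 i<N) (𝟘-coeff i))) (ℤₚ.+-identityʳ (U i))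
      Qw≈0 : Q w ≈[ N ] 𝟘
      Qw≈0 = ≈[]-trans
        (+-cong[] (*-cong[] (*-cong[] {c2 * X} {c2 * X} (λ _ → refl) w≈U) (G-cong[] w≈U))
          (neg-cong[] (*-cong[] {S} {S} (λ _ → refl)
            (+-cong[] (+-cong[] {g = neg 𝟙} {neg 𝟙} w≈U (λ _ → refl)) (*-cong[] {X} {X} (λ _ → refl) w≈U)))))
        (≈⇒≈[] QU)
      q : PS
      q i = Q w (N ℕ.+ i)
      Qw : Q w ≈ e * q
      Qw = ≈[]0⇒X^* N (Q w) Qw≈0
      eq : B' ≈ X^ N * (V * q * q - C)
      eq = X^*-cancel N (undiff (≈-trans
        (solve 7 (λ x u s e q v qw →
          let p = u :- con (+ 1) :+ x :* u
              b = s :* p :* p :+ con (+ 4) :* x :* u :* u :* (con (+ 1) :- u)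
              w = u :+ e
              pw = w :- con (+ 1) :+ x :* w
              bw = s :* pw :* pw :+ con (+ 4) :* x :* w :* w :* (con (+ 1) :- w)
              b' = con (+ 2) :* s :* p :* (con (+ 1) :+ x) :+ con (+ 4) :* x :* (con (+ 2) :* u :- con (+ 3) :* u :* u)
              c = s :* (con (+ 1) :+ x) :* (con (+ 1) :+ x) :+ con (+ 4) :* x :* (con (+ 1) :- con (+ 3) :* u :- e)
          in e :* b' :- e :* (e :* (v :* q :* q :- c))
             := (bw :- v :* (qw :* qw)) :+ (con (+ 0) :- con (+ 1)) :* b :+ (v :* (qw :+ e :* q)) :* (qw :- e :* q))
          (λ _ → refl) X U S e q V (Q w))
        (+𝟘 (+𝟘 (diff (B-of w)) (*𝟘 (𝟘 - 𝟙) BU)) (*𝟘 (V * (Q w + e * q)) (diff Qw)))))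

    B'≈0 : B' ≈ 𝟘
    B'≈0 = ≈[]-all B'≈[]0

    ρ : PS
    ρ = (𝟙 + X) * U * U - c3 * U + c2

    -- `S` is eliminated between `BU` and `B'≈0`: in 2 (1 + X) B(U) - P(U) B' the terms with `S`
    -- cancel, and what remains is 4 X U ρ.
    ρ≈0 : ρ ≈ 𝟘
    ρ≈0 = *-cancel-unit U U₀ (const-cancel 3 (X*-cancel (≈-trans
      (solve 3 (λ x u s →
        let p = u :- con (+ 1) :+ x :* u
            b = s :* p :* p :+ con (+ 4) :* x :* u :* u :* (con (+ 1) :- u)
            b' = con (+ 2) :* s :* p :* (con (+ 1) :+ x) :+ con (+ 4) :* x :* (con (+ 2) :* u :- con (+ 3) :* u :* u)
            r = (con (+ 1) :+ x) :* u :* u :- con (+ 3) :* u :+ con (+ 2)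
        in x :* (con (+ 4) :* (u :* r)) := (con (+ 0) :- p) :* b' :+ (con (+ 2) :* (con (+ 1) :+ x)) :* b)
        (λ _ → refl) X U S)
      (+𝟘 (*𝟘 (𝟘 - P U) B'≈0) (*𝟘 (c2 * (𝟙 + X)) BU)))))

    -- `B'` minus 4 X U ρ is 2 (1 + X) times the left side. Since U P(U) = 2 (U - 1) + ρ,
    -- multiplying by `U` turns the equation into S (U - 1) = X U⁴.
    SP : S * P U - c2 * X * U * U * U ≈ 𝟘
    SP = *-cancel-unit (𝟙 + X) refl (const-cancel 1 (≈-trans
      (solve 3 (λ x u s →
        let p = u :- con (+ 1) :+ x :* u
            b' = con (+ 2) :* s :* p :* (con (+ 1) :+ x) :+ con (+ 4) :* x :* (con (+ 2) :* u :- con (+ 3) :* u :* u)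
            r = (con (+ 1) :+ x) :* u :* u :- con (+ 3) :* u :+ con (+ 2)
        in con (+ 2) :* ((con (+ 1) :+ x) :* (s :* p :- con (+ 2) :* x :* u :* u :* u))
           := b' :+ (con (+ 0) :- con (+ 4) :* x :* u) :* r)
        (λ _ → refl) X U S)
      (+𝟘 B'≈0 (*𝟘 (𝟘 - c4 * X * U) ρ≈0))))

    -- The formula of the theorem solved for its radical.
    Y : PS
    Y = const (+ 32) * X * I + 𝟙 - const (+ 12) * X - c8 * X * X

    -- Modulo 4 (1 + X) ρ, the square of this series is 1 - 8 X.
    r : PS
    r = c3 - c2 * (𝟙 + X) * U

    -- `Y` contains `I`, that is 1 - V with V = 1/S. Multiplying by U⁴ clears the denominator,
    -- because U⁴ X V = U - 1; the claim becomes a polynomial identity in `X` and `U` modulo ρ.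
    Y-eq : Y ≈ r * (𝟙 - c8 * X)
    Y-eq = undiff (*-cancel-unit (U * U * U * U) U⁴₀ (≈-trans
      (solve 4 (λ x u s i →
        let p = u :- con (+ 1) :+ x :* u
            sp = s :* p :- con (+ 2) :* x :* u :* u :* u
            ρ = (con (+ 1) :+ x) :* u :* u :- con (+ 3) :* u :+ con (+ 2)
            y = con (+ 32) :* x :* i :+ con (+ 1) :- con (+ 12) :* x :- con (+ 8) :* x :* x
            r = con (+ 3) :- con (+ 2) :* (con (+ 1) :+ x) :* u
            v = con (+ 1) :- i
        in u :* u :* u :* u :* (y :- r :* (con (+ 1) :- con (+ 8) :* x))
           -- The part - 16 s v of the cofactor of ρ, together with the last two summands, replaces
           -- 32 x v u⁴ by 32 (u - 1). The rest of the cofactor is the quotient of the remaining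
           -- polynomial by ρ.
           := (con (+ 60) :* u :* u :+ con (+ 18) :* u :* u :* u
                :- (con (+ 8) :+ con (+ 16) :* u) :* ((con (+ 1) :+ x) :* u :* u :+ con (+ 3) :* u :- con (+ 2))
                :- con (+ 16) :* s :* v) :* ρ
              :+ (con (+ 16) :* u :* v) :* sp
              :+ (con (+ 0) :- con (+ 32) :* (u :- con (+ 1))) :* (s :* v :- con (+ 1)))
        (λ _ → refl) X U S I)
      (+𝟘 (+𝟘 (*𝟘 _ ρ≈0) (*𝟘 (const (+ 16) * U * V) SP)) (*𝟘 (𝟘 - const (+ 32) * (U - 𝟙)) (diff S-inverse)))))
      where
      U⁴₀ : (U * U * U * U) 0 ≡ + 1
      U⁴₀ rewrite U₀ = refl

    Y-square : Y * Y ≈ (𝟙 - c8 * X) * (𝟙 - c8 * X) * (𝟙 - c8 * X)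
    Y-square = undiff (≈-trans
      (solve 3 (λ x u y →
        let ρ = (con (+ 1) :+ x) :* u :* u :- con (+ 3) :* u :+ con (+ 2)
            r = con (+ 3) :- con (+ 2) :* (con (+ 1) :+ x) :* u
            k = con (+ 1) :- con (+ 8) :* x
        in y :* y :- k :* k :* k := (y :+ r :* k) :* (y :- r :* k) :+ (con (+ 4) :* (con (+ 1) :+ x) :* k :* k) :* ρ)
        (λ _ → refl) X U Y)
      (+𝟘 (*𝟘 (Y + r * (𝟙 - c8 * X)) (diff Y-eq)) (*𝟘 (c4 * (𝟙 + X) * (𝟙 - c8 * X) * (𝟙 - c8 * X)) ρ≈0)))

-- Trees that code avoiders, and the functional equation of their generating function.

module Trees where

  open PowerSeries
  open QuadraticMethod
  open Solver using (solve; _:+_; _:*_; _:-_; con; _:=_)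
  open import Defs using (PS)
  open import Data.Nat as ℕ using (ℕ; zero; suc; s≤s)
  import Data.Nat.Properties as ℕₚ
  open import Data.Integer using (ℤ; +_; -_)
  import Data.Integer as ℤ
  import Data.Integer.Properties as ℤₚ
  open import Data.List using (List; []; _∷_; _++_; map; concatMap; length; filter)
  open import Data.List.Relation.Unary.All as All using (All; []; _∷_)
  import Data.List.Relation.Unary.All.Properties as Allₚ
  open import Data.List.Properties using (filter-accept; filter-reject)
  open import Data.Unit using (⊤; tt)
  open import Data.Empty using (⊥; ⊥-elim)
  open import Relation.Binary.Definitions using (tri<; tri≈; tri>)
  open import Data.Product using (_,_)
  open import Relation.Nullary using (yes; no)
  open import Function using (_∘_)
  open import Relation.Binary.PropositionalEquality using (_≡_; refl; sym; trans; cong; cong₂; subst; _≢_)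

  -- `leaf` codes the empty permutation. In `node L Bs` the tree `L` codes the letters above the
  -- removed letter k, and `Bs` lists the blocks, one for each active site of `L`.
  data Tree : Set where
    leaf : Tree
    node : Tree → List Tree → Tree

  size : Tree → ℕ
  sizes : List Tree → ℕ
  size leaf = 0
  size (node L Bs) = suc (size L ℕ.+ sizes Bs)
  sizes [] = 0
  sizes (B ∷ Bs) = size B ℕ.+ sizes Bs

  -- act T is the number of active sites of the permutation coded by T; it is read off from the first nonempty block.
  act : Tree → ℕ
  label : List Tree → ℕ
  act leaf = 1
  act (node L Bs) = suc (label Bs)
  label [] = 0
  label (leaf ∷ Bs) = suc (label Bs)
  label (node L Cs ∷ Bs) = suc (label Cs)

  tuples : ℕ → List Tree → List (List Tree)
  tuples zero ts = [] ∷ []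
  tuples (suc m) ts = concatMap (λ B → map (B ∷_) (tuples m ts)) ts

  -- `f` bounds the height and keeps the enumeration finite. Height is at most size, so `trees n`
  -- already has every tree of size n whose nodes carry the right number of blocks.
  trees nodes : ℕ → List Tree
  trees f = leaf ∷ nodes f
  nodes zero = []
  nodes (suc f) = concatMap (λ L → map (node L) (tuples (act L) (trees f))) (trees f)

  module _ {A : Set} where

    psum : List A → (A → PS) → PS
    psum [] g = 𝟘
    psum (x ∷ xs) g = g x + psum xs g

    psum-cong : ∀ xs {g h} → (∀ x → g x ≈ h x) → psum xs g ≈ psum xs h
    psum-cong [] p n = refl
    psum-cong (x ∷ xs) p n = cong₂ ℤ._+_ (p x n) (psum-cong xs p n)

    psum-congᴬ : ∀ {xs g h} → All (λ x → g x ≈ h x) xs → psum xs g ≈ psum xs h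
    psum-congᴬ [] n = refl
    psum-congᴬ (p ∷ ps) n = cong₂ ℤ._+_ (p n) (psum-congᴬ ps n)

    psum-cong[] : ∀ {N} xs {g h} → (∀ x → g x ≈[ N ] h x) → psum xs g ≈[ N ] psum xs h
    psum-cong[] [] p _ = refl
    psum-cong[] (x ∷ xs) p i<N = cong₂ ℤ._+_ (p x i<N) (psum-cong[] xs p i<N)

    psum-++ : ∀ xs ys g → psum (xs ++ ys) g ≈ psum xs g + psum ys g
    psum-++ [] ys g n = sym (trans (cong (λ z → z ℤ.+ psum ys g n) (𝟘-coeff n)) (ℤₚ.+-identityˡ _))
    psum-++ (x ∷ xs) ys g n = trans (cong (λ z → g x n ℤ.+ z) (psum-++ xs ys g n))
      (sym (ℤₚ.+-assoc (g x n) (psum xs g n) (psum ys g n)))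

    *-psum : ∀ c xs g → c * psum xs g ≈ psum xs (λ x → c * g x)
    *-psum c [] g = *𝟘 c (λ _ → refl)
    *-psum c (x ∷ xs) g = ≈-trans (solve 3 (λ a b d → a :* (b :+ d) := a :* b :+ a :* d)
      (λ _ → refl) c (g x) (psum xs g)) (λ n → cong (λ z → (c * g x) n ℤ.+ z) (*-psum c xs g n))

    psum-+ : ∀ xs g h → psum xs (λ x → g x + h x) ≈ psum xs g + psum xs h
    psum-+ [] g h = ≈-sym (+𝟘 {𝟘} {𝟘} (λ _ → refl) (λ _ → refl))
    psum-+ (x ∷ xs) g h = ≈-trans (λ n → cong (λ z → g x n ℤ.+ h x n ℤ.+ z) (psum-+ xs g h n))
      (solve 4 (λ a b c d → a :+ b :+ (c :+ d) := (a :+ c) :+ (b :+ d))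
      (λ _ → refl) (g x) (h x) (psum xs g) (psum xs h))

  psum-map : ∀ {A B : Set} (f : A → B) xs g → psum (map f xs) g ≈ psum xs (g ∘ f)
  psum-map f [] g n = refl
  psum-map f (x ∷ xs) g n = cong (λ z → g (f x) n ℤ.+ z) (psum-map f xs g n)

  psum-concatMap : ∀ {A B : Set} (f : A → List B) xs g → psum (concatMap f xs) g ≈ psum xs (λ x → psum (f x) g)
  psum-concatMap f [] g n = refl
  psum-concatMap f (x ∷ xs) g = ≈-trans (psum-++ (f x) (concatMap f xs) g)
    (λ n → cong (λ z → psum (f x) g n ℤ.+ z) (psum-concatMap f xs g n))

  X^-+ : ∀ a b → X^ (a ℕ.+ b) ≈ X^ a * X^ b
  X^-+ zero b = ≈-sym (*-identityˡ (X^ b))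
  X^-+ (suc a) b = ≈-trans (*-cong {X} {X} (λ _ → refl) (X^-+ a b)) (≈-sym (*-assoc X (X^ a) (X^ b)))

  -- An arbitrary sequence `g` stands in place of the powers of w, since passing an empty block
  -- replaces `g` by `g ∘ suc` and the inductions must cover that.
  wt : (ℕ → PS) → Tree → PS
  wt g T = X^ (size T) * g (act T)

  wtᶠ : (ℕ → PS) → List Tree → PS
  wtᶠ g Bs = X^ (sizes Bs) * g (label Bs)

  wsum : List Tree → (ℕ → PS) → PS
  wsum ts g = psum ts (wt g)

  fsum : ℕ → List Tree → (ℕ → PS) → PS
  fsum m ts g = psum (tuples m ts) (wtᶠ g)

  *-congʳ : ∀ c {f g} → f ≈ g → c * f ≈ c * g
  *-congʳ c = *-cong {c} {c} (λ _ → refl)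

  wsum-cong : ∀ ts {g h} → (∀ a → g a ≈ h a) → wsum ts g ≈ wsum ts h
  wsum-cong ts p = psum-cong ts (λ T → *-congʳ (X^ (size T)) (p (act T)))

  wsum-cong[] : ∀ {N} ts {g h} → (∀ a → g a ≈[ N ] h a) → wsum ts g ≈[ N ] wsum ts h
  wsum-cong[] ts p = psum-cong[] ts (λ T → *-cong[] {X^ (size T)} {X^ (size T)} (λ _ → refl) (p (act T)))

  wsum-+ : ∀ ts g h → wsum ts (λ a → g a + h a) ≈ wsum ts g + wsum ts h
  wsum-+ ts g h = ≈-trans (psum-cong ts (λ T → solve 3 (λ a b d → a :* (b :+ d) := a :* b :+ a :* d)
      (λ _ → refl) (X^ (size T)) (g (act T)) (h (act T)))) (psum-+ ts (wt g) (wt h))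

  wsum-* : ∀ c ts g → wsum ts (λ a → c * g a) ≈ c * wsum ts g
  wsum-* c ts g = ≈-trans (psum-cong ts (λ T → solve 3 (λ a b d → a :* (b :* d) := b :* (a :* d))
      (λ _ → refl) (X^ (size T)) c (g (act T)))) (≈-sym (*-psum c ts (wt g)))

  fsum-* : ∀ c m ts g → fsum m ts (λ a → c * g a) ≈ c * fsum m ts g
  fsum-* c m ts g = ≈-trans (psum-cong (tuples m ts) (λ T → solve 3 (λ a b d → a :* (b :* d) := b :* (a :* d))
      (λ _ → refl) (X^ (sizes T)) c (g (label T)))) (≈-sym (*-psum c (tuples m ts) (wtᶠ g)))

  IsNode : Tree → Set
  IsNode leaf = ⊥
  IsNode (node _ _) = ⊤

  All-nodes : ∀ f → All IsNode (nodes f)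
  All-nodes zero = []
  All-nodes (suc f) = Allₚ.concat⁺ (Allₚ.map⁺ (All.universal (λ L → Allₚ.map⁺ (All.universal (λ _ → tt) (tuples (act L) (trees f)))) (trees f)))

  split-tuple : ∀ m ts T h → psum (map (T ∷_) (tuples m ts)) (λ Bs → X^ (sizes Bs) * h) ≈ X^ (size T) * h * fsum m ts (λ _ → 𝟙)
  split-tuple m ts T h = ≈-trans (psum-map (T ∷_) (tuples m ts) _)
    (≈-trans (psum-cong (tuples m ts) (λ Bs → ≈-trans
        (*-cong {X^ (size T ℕ.+ sizes Bs)} {g = h} {h} (X^-+ (size T) (sizes Bs)) (λ _ → refl))
        (solve 3 (λ a b c → a :* b :* c := a :* c :* (b :* con (+ 1)))
          (λ _ → refl) (X^ (size T)) (X^ (sizes Bs)) h)))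
      (≈-sym (*-psum (X^ (size T) * h) (tuples m ts) (wtᶠ (λ _ → 𝟙)))))

  psum-*ʳ : ∀ {A : Set} c (xs : List A) g → psum xs (λ x → g x * c) ≈ psum xs g * c
  psum-*ʳ c xs g = ≈-trans (psum-cong xs (λ x → *-comm (g x) c))
    (≈-trans (≈-sym (*-psum c xs g)) (*-comm c (psum xs g)))

  -- An empty first block adds one to the label and leaves the rest to the later blocks; a nonempty
  -- one settles the label, so the later blocks are summed with weight 1.
  fsum-suc : ∀ m {ns} g → All IsNode ns → fsum (suc m) (leaf ∷ ns) g ≈
    fsum m (leaf ∷ ns) (g ∘ suc) + wsum ns g * fsum m (leaf ∷ ns) (λ _ → 𝟙)
  fsum-suc m {ns} g all = ≈-trans (psum-++ (map (leaf ∷_) (tuples m ts)) _ (wtᶠ g))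
    (+-cong (psum-map (leaf ∷_) (tuples m ts) (wtᶠ g))
      (≈-trans (psum-concatMap (λ B → map (B ∷_) (tuples m ts)) ns (wtᶠ g))
        (≈-trans (psum-congᴬ (All.map per-node all)) (psum-*ʳ (fsum m ts (λ _ → 𝟙)) ns (wt g)))))
    where
    ts : List Tree
    ts = leaf ∷ ns
    per-node : ∀ {T} → IsNode T → psum (map (T ∷_) (tuples m ts)) (wtᶠ g) ≈ wt g T * fsum m ts (λ _ → 𝟙)
    per-node {node L Cs} _ = ≈-trans (psum-map (node L Cs ∷_) (tuples m ts) (wtᶠ g))
      (≈-trans (≈-sym (psum-map (node L Cs ∷_) (tuples m ts) _)) (split-tuple m ts (node L Cs) (g (suc (label Cs)))))

  𝟙*𝟙+𝟘 : 𝟙 * 𝟙 + 𝟘 ≈ 𝟙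
  𝟙*𝟙+𝟘 = solve 0 (con (+ 1) :* con (+ 1) :+ con (+ 0) := con (+ 1)) (λ _ → refl)

  fsum-𝟙 : ∀ m ts → fsum m ts (λ _ → 𝟙) ≈ pow (wsum ts (λ _ → 𝟙)) m
  fsum-𝟙 zero ts = 𝟙*𝟙+𝟘
  fsum-𝟙 (suc m) ts = ≈-trans (psum-concatMap (λ B → map (B ∷_) (tuples m ts)) ts _)
    (≈-trans (psum-cong ts (λ T → split-tuple m ts T 𝟙))
      (≈-trans (psum-*ʳ (fsum m ts (λ _ → 𝟙)) ts (wt (λ _ → 𝟙)))
        (*-congʳ (wsum ts (λ _ → 𝟙)) (fsum-𝟙 m ts))))

  wsum-nodes : ∀ f g → wsum (nodes (suc f)) g ≈ X * wsum (trees f) (λ a → fsum a (trees f) (g ∘ suc))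
  wsum-nodes f g = ≈-trans (psum-concatMap (λ L → map (node L) (tuples (act L) ts)) ts (wt g))
    (≈-trans (psum-cong ts per) (≈-sym (*-psum X ts _)))
    where
    ts : List Tree
    ts = trees f
    per : ∀ L → psum (map (node L) (tuples (act L) ts)) (wt g) ≈ X * (X^ (size L) * fsum (act L) ts (g ∘ suc))
    per L = ≈-trans (psum-map (node L) (tuples (act L) ts) (wt g))
      (≈-trans (psum-cong (tuples (act L) ts) (λ Bs → ≈-trans
          (*-cong {X^ (suc (size L ℕ.+ sizes Bs))} {g = g (suc (label Bs))} {g (suc (label Bs))}
            (*-congʳ X (X^-+ (size L) (sizes Bs))) (λ _ → refl))
          (solve 4 (λ x a b c → x :* (a :* b) :* c := x :* a :* (b :* c))
            (λ _ → refl) X (X^ (size L)) (X^ (sizes Bs)) (g (suc (label Bs))))))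
        (≈-trans (≈-sym (*-psum (X * X^ (size L)) (tuples (act L) ts) (wtᶠ (g ∘ suc))))
          (*-assoc X (X^ (size L)) _)))

  wsum-leaf : ∀ ns g → wsum (leaf ∷ ns) g ≈ g 1 + wsum ns g
  wsum-leaf ns g = +-cong {u = wsum ns g} (*-identityˡ (g 1)) (λ _ → refl)

  fsum-cong[] : ∀ {N} m {ns ms} → All IsNode ns → All IsNode ms →
    (∀ g → wsum ns g ≈[ N ] wsum ms g) → ∀ g → fsum m (leaf ∷ ns) g ≈[ N ] fsum m (leaf ∷ ms) g
  fsum-cong[] zero all all' p g = λ _ → refl
  fsum-cong[] (suc m) {ns} {ms} all all' p g = ≈[]-trans (≈⇒≈[] (fsum-suc m g all))
    (≈[]-trans (+-cong[] (fsum-cong[] m all all' p (g ∘ suc)) (*-cong[] (p g) (fsum-cong[] m all all' p (λ _ → 𝟙))))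
      (≈⇒≈[] (≈-sym (fsum-suc m g all'))))

  wsum-leaf-cong[] : ∀ {N} ns ms → (∀ g → wsum ns g ≈[ N ] wsum ms g) → ∀ g → wsum (leaf ∷ ns) g ≈[ N ] wsum (leaf ∷ ms) g
  wsum-leaf-cong[] ns ms p g = +-cong[] {X^ 0 * g 1} {X^ 0 * g 1} (λ _ → refl) (p g)

  -- Each level of height brings a factor `X` by `wsum-nodes`, so trees that exceed height `f` have
  -- more than `f` letters.
  wsum-step : ∀ f g → wsum (nodes f) g ≈[ suc f ] wsum (nodes (suc f)) g
  wsum-step zero g {zero} _ = sym (trans (wsum-nodes 0 g 0) (X*-zero (wsum (trees 0) (λ a → fsum a (trees 0) (g ∘ suc)))))
  wsum-step zero g {suc i} (s≤s ())
  wsum-step (suc f) g = ≈[]-trans (≈⇒≈[] (wsum-nodes f g))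
    (≈[]-trans (X*-cong[] (≈[]-trans
      (wsum-cong[] (trees f) (λ a → fsum-cong[] a (All-nodes f) (All-nodes (suc f)) (wsum-step f) (g ∘ suc)))
      (wsum-leaf-cong[] (nodes f) (nodes (suc f)) (wsum-step f) (λ a → fsum a (trees (suc f)) (g ∘ suc)))))
      (≈⇒≈[] (≈-sym (wsum-nodes (suc f) g))))

  Fs : ℕ → PS → PS
  Fs f w = wsum (trees f) (pow w)

  -- A diagonal: coefficient `n` comes from the trees of height at most `n`, and by `F≈Fs` any
  -- larger bound gives the same value.
  F : PS → PS
  F w n = Fs n w n

  F≈Fs : ∀ f w → F w ≈[ suc f ] Fs f w
  F≈Fs f w {i} (s≤s i≤f) = subst (λ k → Fs i w i ≡ Fs k w i) (ℕₚ.m∸n+n≡m i≤f) (go (f ℕ.∸ i))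
    where
    go : ∀ d → Fs i w i ≡ Fs (d ℕ.+ i) w i
    go zero = refl
    go (suc d) = trans (go d) (wsum-leaf-cong[] (nodes (d ℕ.+ i)) (nodes (suc (d ℕ.+ i))) (wsum-step (d ℕ.+ i)) (pow w) (s≤s (ℕₚ.m≤n+m i d)))

  Fs-cong[] : ∀ f {w w' N} → w ≈[ N ] w' → Fs f w ≈[ N ] Fs f w'
  Fs-cong[] f p = wsum-cong[] (trees f) (λ a → pow-cong[] a p)

  F-cong[] : ∀ {w w' N} → w ≈[ N ] w' → F w ≈[ N ] F w'
  F-cong[] p {i} i<N = Fs-cong[] i p i<N

  S : PS
  S = F 𝟙

  Ss : ℕ → PS
  Ss f = Fs f 𝟙

  Ss-eq : ∀ f → Ss f ≈ wsum (trees f) (λ _ → 𝟙)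
  Ss-eq f = wsum-cong (trees f) pow-𝟙

  Φ : ℕ → PS → ℕ → PS
  Φ f w m = fsum m (trees f) (pow w)

  wsum-nodes-pow : ∀ f w → wsum (nodes f) (pow w) ≈ Fs f w - w
  wsum-nodes-pow f w = undiff (≈-trans
    (solve 3 (λ a b c → a :- (b :- c) :=
        (con (+ 0) :- con (+ 1)) :* (b :- (c :* con (+ 1) :+ a))) (λ _ → refl) (wsum (nodes f) (pow w)) (Fs f w) w)
    (*𝟘 (𝟘 - 𝟙) (diff (wsum-leaf (nodes f) (pow w)))))

  -- Nonempty first blocks contribute `Fs f w - w`, as `leaf` has weight w; after such a block each
  -- later one contributes a free factor `Ss f`.
  Φ-suc : ∀ f w m → Φ f w (suc m) ≈ w * Φ f w m + (Fs f w - w) * pow (Ss f) m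
  Φ-suc f w m = ≈-trans (fsum-suc m (pow w) (All-nodes f))
    (+-cong (fsum-* w m (trees f) (pow w))
      (*-cong (wsum-nodes-pow f w) (≈-trans (fsum-𝟙 m (trees f)) (pow-cong m (≈-sym (Ss-eq f))))))
    where
    pow-cong : ∀ m {u v} → u ≈ v → pow u m ≈ pow v m
    pow-cong m p n = pow-cong[] m (λ {i} _ → p i) (ℕₚ.n<1+n n)

  Φ-zero : ∀ f w → Φ f w 0 ≈ 𝟙
  Φ-zero f w = 𝟙*𝟙+𝟘

  -- The sum over the first nonempty block is geometric; multiplying by S − w makes it telescope.
  Φ-closed : ∀ f w m → (Ss f - w) * Φ f w m ≈ (Ss f - w) * pow w m + (Fs f w - w) * (pow (Ss f) m - pow w m)
  Φ-closed f w zero = undiff (≈-trans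
    (solve 4 (λ s w g φ → (s :- w) :* φ :- ((s :- w) :* con (+ 1) :+ (g :- w) :* (con (+ 1) :- con (+ 1)))
       := (s :- w) :* (φ :- con (+ 1))) (λ _ → refl) (Ss f) w (Fs f w) (Φ f w 0))
    (*𝟘 (Ss f - w) (diff (Φ-zero f w))))
  Φ-closed f w (suc m) = undiff (≈-trans
    (solve 7 (λ s w g φ φ' wm sm → 
       (s :- w) :* φ' :- ((s :- w) :* (w :* wm) :+ (g :- w) :* (s :* sm :- w :* wm))
       := (s :- w) :* (φ' :- (w :* φ :+ (g :- w) :* sm)) :+ w :* ((s :- w) :* φ :- ((s :- w) :* wm :+ (g :- w) :* (sm :- wm))))
       (λ _ → refl) (Ss f) w (Fs f w) (Φ f w m) (Φ f w (suc m)) (pow w m) (pow (Ss f) m))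
    (+𝟘 (*𝟘 (Ss f - w) (diff (Φ-suc f w m))) (*𝟘 w (diff (Φ-closed f w m)))))

  Fs-suc : ∀ f w → Fs (suc f) w ≈ w + X * (w * wsum (trees f) (Φ f w))
  Fs-suc f w = ≈-trans (wsum-leaf (nodes (suc f)) (pow w))
    (+-cong (≈-trans (*-comm w 𝟙) (*-identityˡ w)) (≈-trans (wsum-nodes f (pow w))
      (*-congʳ X (≈-trans (wsum-cong (trees f) (λ a → fsum-* w a (trees f) (pow w))) (wsum-* w (trees f) (Φ f w))))))

  -- At w = 1 every block contributes `Ss f`, so the blocks over `L` sum to its power `act L`.
  -- `Φ-closed` would give this only after multiplication by `Ss f - 𝟙`, whose constant term is 0;
  -- hence the separate induction `Φ-𝟙`.
  Ss-suc : ∀ f → Ss (suc f) ≈ 𝟙 + X * Fs f (Ss f)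
  Ss-suc f = ≈-trans (Fs-suc f 𝟙) (+-cong {𝟙} (λ _ → refl) (*-congʳ X
    (≈-trans (*-identityˡ (wsum (trees f) (Φ f 𝟙))) (wsum-cong (trees f) Φ-𝟙))))
    where
    Φ-𝟙 : ∀ m → Φ f 𝟙 m ≈ pow (Ss f) m
    Φ-𝟙 zero = Φ-zero f 𝟙
    Φ-𝟙 (suc m) = undiff (≈-trans
      (solve 4 (λ s φ φ' sm → φ' :- s :* sm
         := (φ' :- (con (+ 1) :* φ :+ (s :- con (+ 1)) :* sm)) :+ (φ :- sm)) (λ _ → refl) (Ss f) (Φ f 𝟙 m) (Φ f 𝟙 (suc m)) (pow (Ss f) m))
      (+𝟘 (diff (Φ-suc f 𝟙 m)) (diff (Φ-𝟙 m))))

  -- Here F(S) enters: `Φ-closed` is summed over `L`, and the powers of `Ss f` with exponent `act L`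
  -- sum to `Fs f (Ss f)`.
  Fs-eq : ∀ f w → (Ss f - w) * Fs (suc f) w ≈
    (Ss f - w) * w + X * w * ((Ss f - w) * Fs f w + (Fs f w - w) * (Fs f (Ss f) - Fs f w))
  Fs-eq f w = undiff (≈-trans
    (solve 7 (λ x s w g g' φ gs → 
       (s :- w) :* g' :- ((s :- w) :* w :+ x :* w :* ((s :- w) :* g :+ (g :- w) :* (gs :- g)))
       := (s :- w) :* (g' :- (w :+ x :* (w :* φ))) :+ x :* w :* ((s :- w) :* φ :- ((s :- w) :* g :+ (g :- w) :* (gs :+ (con (+ 0) :- con (+ 1)) :* g))))
       (λ _ → refl) X (Ss f) w (Fs f w) (Fs (suc f) w) Σφ (Fs f (Ss f)))
    (+𝟘 (*𝟘 (Ss f - w) (diff (Fs-suc f w))) (*𝟘 (X * w) (diff sumΦ))))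
    where
    Σφ : PS
    Σφ = wsum (trees f) (Φ f w)
    a : PS
    a = Ss f - w
    b : PS
    b = Fs f w - w
    sumΦ : a * Σφ ≈ a * Fs f w + b * (Fs f (Ss f) + (𝟘 - 𝟙) * Fs f w)
    sumΦ = ≈-trans (≈-sym (wsum-* a (trees f) (Φ f w))) (≈-trans (wsum-cong (trees f) (λ m → ≈-trans (Φ-closed f w m)
        (solve 4 (λ a b s w → a :* w :+ b :* (s :- w) := a :* w :+ b :* (s :+ (con (+ 0) :- con (+ 1)) :* w)) (λ _ → refl) a b (pow (Ss f) m) (pow w m))))
      (≈-trans (wsum-+ (trees f) (λ m → a * pow w m) (λ m → b * (pow (Ss f) m + (𝟘 - 𝟙) * pow w m)))
        (+-cong (wsum-* a (trees f) (pow w)) (≈-trans (wsum-* b (trees f) (λ m → pow (Ss f) m + (𝟘 - 𝟙) * pow w m)) (*-congʳ b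
          (≈-trans (wsum-+ (trees f) (pow (Ss f)) (λ m → (𝟘 - 𝟙) * pow w m)) (+-cong {Fs f (Ss f)} (λ _ → refl) (wsum-* (𝟘 - 𝟙) (trees f) (pow w)))))))))

  S-eq : S ≈ 𝟙 + X * F S
  S-eq = ≈[]-all λ f → ≈[]-trans (≈[]-weaken (ℕₚ.m≤n⇒m≤1+n (ℕₚ.n≤1+n f)) (F≈Fs (suc f) 𝟙)) (≈[]-trans (≈⇒≈[] (Ss-suc f))
    (≈[]-sym (≈[]-weaken (ℕₚ.n≤1+n f) (+-cong[] {𝟙} {𝟙} (λ _ → refl) (*-cong[] {X} {X} (λ _ → refl)
       (≈[]-trans (F≈Fs f S) (Fs-cong[] f (F≈Fs f 𝟙))))))))

  -- In the limit of `Fs-eq`, the unknown X F(S) is eliminated by `S-eq`, which makes it S - 1.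
  F-eq : ∀ w → (S - w) * F w ≈ w * (S - w) + X * w * ((S - w) * F w) + w * ((F w - w) * (S - 𝟙 - X * F w))
  F-eq w = undiff (≈-trans
    (solve 5 (λ x s w g gs → 
       (s :- w) :* g :- (w :* (s :- w) :+ x :* w :* ((s :- w) :* g) :+ w :* ((g :- w) :* (s :- con (+ 1) :- x :* g)))
       := ((s :- w) :* g :- ((s :- w) :* w :+ x :* w :* ((s :- w) :* g :+ (g :- w) :* (gs :- g))))
          :+ (con (+ 0) :- w :* (g :- w)) :* (s :- (con (+ 1) :+ x :* gs)))
       (λ _ → refl) X S w (F w) (F S))
    (+𝟘 (diff limit) (*𝟘 (𝟘 - w * (F w - w)) (diff S-eq))))
    where
    limit : (S - w) * F w ≈ (S - w) * w + X * w * ((S - w) * F w + (F w - w) * (F S - F w))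
    limit = ≈[]-all λ f →
      let s≈ = F≈Fs f 𝟙
          s-w = +-cong[] {g = neg w} {neg w} s≈ (λ _ → refl)
          g≈ = F≈Fs f w
      in ≈[]-trans (≈[]-weaken (ℕₚ.n≤1+n f) (*-cong[] s-w (≈[]-weaken (ℕₚ.n≤1+n (suc f)) (F≈Fs (suc f) w))))
        (≈[]-trans (≈⇒≈[] (Fs-eq f w)) (≈[]-sym (≈[]-weaken (ℕₚ.n≤1+n f)
          (+-cong[] (*-cong[] {g = w} {w} s-w (λ _ → refl)) (*-cong[] {X * w} {X * w} (λ _ → refl)
            (+-cong[] (*-cong[] s-w g≈) (*-cong[] (+-cong[] {g = neg w} {neg w} g≈ (λ _ → refl))
              (+-cong[] (≈[]-trans (F≈Fs f S) (Fs-cong[] f s≈)) (neg-cong[] g≈)))))))))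

  X^*𝟙 : ∀ k → X^ k ≈ X^ k * 𝟙
  X^*𝟙 k = ≈-trans (≈-sym (*-identityˡ (X^ k))) (*-comm 𝟙 (X^ k))

  X^-diag : ∀ k → X^ k k ≡ + 1
  X^-diag k = trans (X^*𝟙 k k) (trans (cong (X^ k * 𝟙) (sym (ℕₚ.+-identityʳ k))) (X^*-shift k 𝟙 0))

  X^-off : ∀ k n → k ≢ n → X^ k n ≡ + 0
  X^-off k n k≢n with ℕₚ.<-cmp n k
  ... | tri< n<k _ _ = trans (X^*𝟙 k n) (trans (X^*-low k 𝟙 n<k) (𝟘-coeff n))
  ... | tri≈ _ n≡k _ = ⊥-elim (k≢n (sym n≡k))
  ... | tri> _ _ k<n with ℕₚ.m≤n⇒∃[o]m+o≡n k<n
  ...   | i , refl = trans (X^*𝟙 k (suc k ℕ.+ i)) (trans (cong (X^ k * 𝟙) (sym (ℕₚ.+-suc k i))) (X^*-shift k 𝟙 (suc i)))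

  psum-X^-coeff : ∀ {A : Set} (weight : A → ℕ) xs n →
    psum xs (λ x → X^ (weight x)) n ≡ + length (filter (λ x → weight x ℕ.≟ n) xs)
  psum-X^-coeff weight [] n = 𝟘-coeff n
  psum-X^-coeff weight (x ∷ xs) n with weight x ℕ.≟ n
  ... | yes refl = trans (cong₂ ℤ._+_ (X^-diag n) (psum-X^-coeff weight xs n))
    (cong (λ ys → + length ys) (sym (filter-accept (λ y → weight y ℕ.≟ n) {x} {xs} refl)))
  ... | no w≢n = trans (cong₂ ℤ._+_ (X^-off (weight x) n w≢n) (psum-X^-coeff weight xs n))
    (trans (ℤₚ.+-identityˡ _) (cong (λ ys → + length ys) (sym (filter-reject (λ y → weight y ℕ.≟ n) {x} {xs} w≢n))))

  treesOfSize : ℕ → List Tree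
  treesOfSize n = filter (λ T → size T ℕ.≟ n) (trees n)

  S-coeff : ∀ n → S n ≡ + length (treesOfSize n)
  S-coeff n = trans (psum-cong (trees n) (λ T → ≈-trans (*-congʳ (X^ (size T)) (pow-𝟙 (act T))) (≈-sym (X^*𝟙 (size T)))) n)
    (psum-X^-coeff size (trees n) n)

-- Words woven from high letters and blocks of low letters.

module Words where

  open import Data.Nat using (ℕ; zero; suc; _<_; _≤_; _<?_)
  import Data.Nat.Properties as ℕₚ
  open import Data.List using (List; []; _∷_; _++_; map; concat; filter)
  open import Data.List.Properties using (filter-accept; filter-reject; filter-none; filter-all; filter-++; ++-identityʳ; map-++; map-∘; map-id; ∷-injectiveˡ; ∷-injectiveʳ)
  open import Data.List.Relation.Unary.All as All using (All; []; _∷_)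
  import Data.List.Relation.Unary.All.Properties as Allₚ
  open import Data.List.Membership.Propositional using (_∈_)
  open import Data.List.Relation.Binary.Sublist.Propositional using (_⊆_; []; _∷_; _∷ʳ_; ⊆-refl; ⊆-trans; lookup; from∈; to∈)
  open import Data.List.Relation.Binary.Sublist.Propositional.Properties using (All-resp-⊆; filter⁺; filter-⊆; ++⁺; ++⁺ˡ; ++⁺ʳ)
  open import Data.List.Relation.Binary.Pointwise using (Pointwise; []; _∷_)
  open import Data.Product using (∃; ∃₂; _×_; _,_)
  open import Data.Sum using (_⊎_; inj₁; inj₂)
  open import Data.Empty using (⊥-elim)
  open import Data.Unit using (⊤; tt)
  open import Relation.Nullary using (¬_; yes; no)
  open import Relation.Unary using (Decidable)
  open import Relation.Binary.PropositionalEquality using (_≡_; refl; sym; trans; cong; cong₂; subst)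

  ⊆-split : ∀ xs {ys zs : List ℕ} → zs ⊆ xs ++ ys → ∃₂ λ ps qs → zs ≡ ps ++ qs × ps ⊆ xs × qs ⊆ ys
  ⊆-split [] τ = [] , _ , refl , [] , τ
  ⊆-split (x ∷ xs) (.x ∷ʳ τ) with ⊆-split xs τ
  ... | ps , qs , e , p , q = ps , qs , e , x ∷ʳ p , q
  ⊆-split (x ∷ xs) (refl ∷ τ) with ⊆-split xs τ
  ... | ps , qs , e , p , q = x ∷ ps , qs , cong (x ∷_) e , refl ∷ p , q

  ⊆-filter : ∀ {P : ℕ → Set} (P? : Decidable P) {zs xs} → All P zs → zs ⊆ xs → zs ⊆ filter P? xs
  ⊆-filter P? all τ = subst (_⊆ _) (filter-all P? all) (filter⁺ P? P? (λ { refl p → p }) τ)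

  All-⊆ : ∀ {P : ℕ → Set} {xs ys} → xs ⊆ ys → All P ys → All P xs
  All-⊆ = All-resp-⊆

  inserts : ℕ → List ℕ → List (List ℕ)
  inserts e [] = (e ∷ []) ∷ []
  inserts e (x ∷ w) = (e ∷ x ∷ w) ∷ map (x ∷_) (inserts e w)

  -- Blocks alternate with the letters of the first list, with a block at either end. Lists of other
  -- lengths get default values; `Woven` excludes them.
  weave : List ℕ → List (List ℕ) → List ℕ
  weave [] [] = []
  weave [] (B ∷ _) = B
  weave (x ∷ h) [] = x ∷ h
  weave (x ∷ h) (B ∷ Bs) = B ++ x ∷ weave h Bs

  data Woven (k : ℕ) : List ℕ → List (List ℕ) → Set where
    last : ∀ {B} → All (_< k) B → Woven k [] (B ∷ [])
    more : ∀ {B x h Bs} → All (_< k) B → k < x → Woven k h Bs → Woven k (x ∷ h) (B ∷ Bs)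

  infix 4 _≼_
  _≼_ : List ℕ → List ℕ → Set
  xs ≼ ys = All (λ x → All (x ≤_) ys) xs

  Stacked : List (List ℕ) → Set
  Stacked [] = ⊤
  Stacked (B ∷ Bs) = B ≼ concat Bs × Stacked Bs

  -- Turns an occurrence that uses an inserted 0 into one that uses a letter x standing at the same site.
  sub : ℕ → ℕ → ℕ
  sub x zero = x
  sub x (suc n) = suc n

  insertsᴮ : ℕ → List (List ℕ) → List (List (List ℕ))
  insertsᴮ e [] = []
  insertsᴮ e (B ∷ Bs) = map (_∷ Bs) (inserts e B) ++ map (B ∷_) (insertsᴮ e Bs)

  consHead : ℕ → List (List ℕ) → List (List ℕ)
  consHead x [] = (x ∷ []) ∷ []
  consHead x (B ∷ Bs) = (x ∷ B) ∷ Bs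

  -- Recovers the blocks of a woven word, as `filter hi?` recovers its high letters; this yields
  -- both the injectivity and the inversion of the coding.
  cut : ℕ → List ℕ → List (List ℕ)
  cut k [] = [] ∷ []
  cut k (x ∷ w) with x <? k
  ... | yes _ = consHead x (cut k w)
  ... | no _ = [] ∷ cut k w

  module _ {k : ℕ} where

    lo? : Decidable (_< k)
    lo? x = x <? k

    hi? : Decidable (k <_)
    hi? x = k <? x

    lo¬hi : ∀ {x} → x < k → ¬ k < x
    lo¬hi = ℕₚ.<-asym

    woven-hi : ∀ {h Bs} → Woven k h Bs → All (k <_) h
    woven-hi (last _) = []
    woven-hi (more _ k<x v) = k<x ∷ woven-hi v

    woven-lo : ∀ {h Bs} → Woven k h Bs → All (All (_< k)) Bs
    woven-lo (last b) = b ∷ []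
    woven-lo (more b _ v) = b ∷ woven-lo v

    weave-lohi : ∀ {h Bs} → Woven k h Bs → All (λ x → x < k ⊎ k < x) (weave h Bs)
    weave-lohi (last b) = All.map inj₁ b
    weave-lohi (more b k<x v) = Allₚ.++⁺ (All.map inj₁ b) (inj₂ k<x ∷ weave-lohi v)

    filter-hi : ∀ {h Bs} → Woven k h Bs → filter hi? (weave h Bs) ≡ h
    filter-hi (last b) = filter-none hi? (All.map lo¬hi b)
    filter-hi {x ∷ h} {B ∷ Bs} (more b k<x v) = trans (filter-++ hi? B _)
      (cong₂ _++_ (filter-none hi? (All.map lo¬hi b)) (trans (filter-accept hi? k<x) (cong (x ∷_) (filter-hi v))))

    filter-lo : ∀ {h Bs} → Woven k h Bs → filter lo? (weave h Bs) ≡ concat Bs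
    filter-lo {Bs = B ∷ []} (last b) = trans (filter-all lo? b) (sym (++-identityʳ B))
    filter-lo {x ∷ h} {B ∷ Bs} (more b k<x v) = trans (filter-++ lo? B _)
      (cong₂ _++_ (filter-all lo? b) (trans (filter-reject lo? (ℕₚ.<-asym k<x)) (filter-lo v)))

    hi-⊆ : ∀ {h Bs zs} → Woven k h Bs → All (k <_) zs → zs ⊆ weave h Bs → zs ⊆ h
    hi-⊆ {zs = zs} v all τ = subst (zs ⊆_) (filter-hi v) (⊆-filter hi? all τ)

    lo-⊆ : ∀ {h Bs zs} → Woven k h Bs → All (_< k) zs → zs ⊆ weave h Bs → zs ⊆ concat Bs
    lo-⊆ {zs = zs} v all τ = subst (zs ⊆_) (filter-lo v) (⊆-filter lo? all τ)

    h⊆weave : ∀ {h Bs} → Woven k h Bs → h ⊆ weave h Bs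
    h⊆weave {h} {Bs} v = subst (_⊆ weave h Bs) (filter-hi v) (filter-⊆ hi? (weave h Bs))

    concat⊆weave : ∀ {h Bs} → Woven k h Bs → concat Bs ⊆ weave h Bs
    concat⊆weave {h} {Bs} v = subst (_⊆ weave h Bs) (filter-lo v) (filter-⊆ lo? (weave h Bs))

    blocks⊆weave : ∀ {h Bs} → Woven k h Bs → All (_⊆ weave h Bs) Bs
    blocks⊆weave (last _) = ⊆-refl ∷ []
    blocks⊆weave (more {B} {x} _ _ v) = ++⁺ʳ _ ⊆-refl ∷ All.map (λ τ → ++⁺ˡ B (x ∷ʳ τ)) (blocks⊆weave v)

    -- Two low letters with a high one between them lie in different blocks. With `triples-stacked`,
    -- stackedness is thus the absence of low, high, lower low.
    stacked-triple : ∀ {h Bs x d y} → Woven k h Bs → Stacked Bs → x < k → k < d → y < k →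
      (x ∷ d ∷ y ∷ []) ⊆ weave h Bs → x ≤ y
    stacked-triple (last b) _ _ k<d _ τ with All-⊆ τ b
    ... | _ ∷ d<k ∷ _ = ⊥-elim (lo¬hi d<k k<d)
    stacked-triple (more {B} b k<e v) (B≼ , st) x<k k<d y<k τ with ⊆-split B τ
    ... | [] , _ , refl , _ , (_ ∷ʳ τ') = stacked-triple v st x<k k<d y<k τ'
    ... | [] , _ , refl , _ , (refl ∷ _) = ⊥-elim (lo¬hi x<k k<e)
    ... | _ ∷ [] , _ , refl , p , q = All.lookup (All.lookup B≼ (to∈ p)) (to∈ (lo-⊆ v (y<k ∷ []) (y⊆ q)))
      where
      y⊆ : ∀ {e w d y} → (d ∷ y ∷ []) ⊆ e ∷ w → (y ∷ []) ⊆ w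
      y⊆ (_ ∷ʳ τ) = ⊆-trans (_ ∷ʳ ⊆-refl) τ
      y⊆ (_ ∷ τ) = τ
    ... | _ ∷ _ ∷ _ , _ , e , p , _ with All-⊆ p b
    ...   | _ ∷ d<k ∷ _ = ⊥-elim (lo¬hi (subst (_< k) (sym (∷-injectiveˡ (∷-injectiveʳ e))) d<k) k<d)

    triples-stacked : ∀ {h Bs} → Woven k h Bs →
      (∀ {x d y} → x < k → k < d → y < k → (x ∷ d ∷ y ∷ []) ⊆ weave h Bs → x ≤ y) → Stacked Bs
    triples-stacked (last _) _ = All.universal (λ _ → []) _ , tt
    triples-stacked {Bs = B ∷ Bs} (more {x = e} b k<e v) t =
      All.tabulate (λ x∈ → All.tabulate (λ y∈ → t (All.lookup b x∈) k<e
        (All.lookup (Allₚ.concat⁺ (woven-lo v)) y∈)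
        (++⁺ (from∈ x∈) (refl ∷ ⊆-trans (from∈ y∈) (concat⊆weave v)))))
      , triples-stacked v (λ p q r τ → t p q r (++⁺ˡ B (e ∷ʳ τ)))

    Pw-map⁻ : ∀ {A : List ℕ → Set} {x is} {Bs : List (List ℕ)} → Pointwise (λ i B → B ≡ [] ⊎ A i) (map (x ∷_) is) Bs →
      Pointwise (λ i B → B ≡ [] ⊎ A (x ∷ i)) is Bs
    Pw-map⁻ {is = []} [] = []
    Pw-map⁻ {is = _ ∷ _} (p ∷ ps) = p ∷ Pw-map⁻ ps

    -- The single low letter lies in a block, which is therefore nonempty and stands at a site where
    -- `A` holds; all other letters come from `h`, so a 0 at that site can replace it. `A` is
    -- arbitrary because passing a high letter `x` turns it into `λ i → A (x ∷ i)`.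
    find-site : ∀ {A : List ℕ → Set} {h Bs} zs₁ {a zs₂} → Woven k h Bs →
      Pointwise (λ i B → B ≡ [] ⊎ A i) (inserts 0 h) Bs → All (k <_) zs₁ → a < k → All (k <_) zs₂ →
      zs₁ ++ a ∷ zs₂ ⊆ weave h Bs → ∃ λ i → A i × zs₁ ++ 0 ∷ zs₂ ⊆ i
    find-site (z ∷ _) (last b) _ (z>k ∷ _) _ _ τ with All-⊆ τ b
    ... | z<k ∷ _ = ⊥-elim (lo¬hi z<k z>k)
    find-site [] {zs₂ = z ∷ _} (last b) _ _ _ (z>k ∷ _) τ with All-⊆ τ b
    ... | _ ∷ z<k ∷ _ = ⊥-elim (lo¬hi z<k z>k)
    find-site [] {zs₂ = []} (last b) (inj₁ refl ∷ []) _ _ _ ()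
    find-site [] {zs₂ = []} (last b) (inj₂ A[0] ∷ []) _ _ _ τ = _ , A[0] , ⊆-refl
    find-site {A} zs₁ {a} {zs₂} (more {B} {x} {h} b k<x v) (act ∷ acts) hi₁ a<k hi₂ τ with ⊆-split B τ
    find-site {A} [] (more {x = x} b k<x v) (act ∷ acts) hi₁ a<k hi₂ τ | [] , _ , refl , _ , (_ ∷ʳ q)
      with find-site {λ i → A (x ∷ i)} [] v (Pw-map⁻ acts) hi₁ a<k hi₂ q
    ...   | i , Ai , σ = x ∷ i , Ai , x ∷ʳ σ
    find-site {A} (z ∷ zs₁) (more {x = x} b k<x v) (act ∷ acts) hi₁ a<k hi₂ τ | [] , _ , refl , _ , (_ ∷ʳ q)
      with find-site {λ i → A (x ∷ i)} (z ∷ zs₁) v (Pw-map⁻ acts) hi₁ a<k hi₂ q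
    ...   | i , Ai , σ = x ∷ i , Ai , x ∷ʳ σ
    find-site {A} (z ∷ zs₁) (more {x = x} b k<x v) (act ∷ acts) (_ ∷ hi₁) a<k hi₂ τ | [] , _ , refl , _ , (refl ∷ q)
      with find-site {λ i → A (x ∷ i)} zs₁ v (Pw-map⁻ acts) hi₁ a<k hi₂ q
    ...   | i , Ai , σ = x ∷ i , Ai , refl ∷ σ
    find-site [] (more b k<x v) (act ∷ acts) hi₁ a<k hi₂ τ | [] , _ , refl , _ , (refl ∷ q) = ⊥-elim (lo¬hi a<k k<x)
    find-site (z ∷ zs₁) (more b k<x v) _ (z>k ∷ _) _ _ τ | _ ∷ _ , _ , e , p , _ with All-⊆ p b
    ...   | z<k ∷ _ = ⊥-elim (lo¬hi (subst (_< k) (sym (∷-injectiveˡ e)) z<k) z>k)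
    find-site [] (more b k<x v) _ _ _ (z>k ∷ _) τ | _ ∷ _ ∷ _ , _ , e , p , _ with All-⊆ p b
    ...   | _ ∷ z<k ∷ _ = ⊥-elim (lo¬hi (subst (_< k) (sym (∷-injectiveˡ (∷-injectiveʳ e))) z<k) z>k)
    find-site [] {zs₂ = []} (more b k<x v) _ _ _ _ τ | _ ∷ _ ∷ _ , _ , () , _ , _
    find-site [] (more b k<x v) (inj₁ refl ∷ _) _ _ _ τ | _ ∷ [] , _ , refl , () , _
    find-site [] {zs₂ = zs₂} (more {x = x} {h} {Bs} b k<x v) (inj₂ Ai ∷ _) _ _ hi₂ τ | _ ∷ [] , _ , refl , _ , q =
      _ , Ai , refl ∷ hi⊆ q
      where
      hi⊆ : zs₂ ⊆ x ∷ weave h Bs → zs₂ ⊆ x ∷ h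
      hi⊆ q = subst (zs₂ ⊆_) (trans (filter-accept hi? k<x) (cong (x ∷_) (filter-hi v))) (⊆-filter hi? hi₂ q)

    map-sub : ∀ {x h} → All (k <_) h → map (sub x) h ≡ h
    map-sub [] = refl
    map-sub {h = suc y ∷ _} (_ ∷ hi) = cong (suc y ∷_) (map-sub hi)

    -- Serves the converse of `find-site`: an occurrence using a 0 inserted into `h` becomes one in
    -- the woven word as soon as the block at that site has a letter.
    sub-⊆ : ∀ {h Bs} → Woven k h Bs →
      Pointwise (λ i (B : List ℕ) → ∀ {x} → x ∈ B → map (sub x) i ⊆ weave h Bs) (inserts 0 h) Bs
    sub-⊆ (last _) = from∈ ∷ []
    sub-⊆ (more {B} {suc y} {h} b k<y v) =
      (λ {x} x∈ → ++⁺ (from∈ x∈) (refl ∷ subst (_⊆ weave h _) (sym (map-sub {x} (woven-hi v))) (h⊆weave v)))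
      ∷ shiftPw (sub-⊆ v)
      where
      shiftPw : ∀ {is} {Bs : List (List ℕ)} {w} → Pointwise (λ i C → ∀ {x} → x ∈ C → map (sub x) i ⊆ w) is Bs →
        Pointwise (λ i C → ∀ {x} → x ∈ C → map (sub x) i ⊆ B ++ suc y ∷ w) (map (suc y ∷_) is) Bs
      shiftPw [] = []
      shiftPw (p ∷ ps) = (λ x∈ → ++⁺ˡ B (refl ∷ p x∈)) ∷ shiftPw ps

    cut-lo : ∀ {x} w → x < k → cut k (x ∷ w) ≡ consHead x (cut k w)
    cut-lo {x} w x<k with x <? k
    ... | yes _ = refl
    ... | no x≮k = ⊥-elim (x≮k x<k)

    cut-hi : ∀ {x} w → k < x → cut k (x ∷ w) ≡ [] ∷ cut k w
    cut-hi {x} w k<x with x <? k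
    ... | yes x<k = ⊥-elim (lo¬hi x<k k<x)
    ... | no _ = refl

    cut-weave : ∀ {h Bs} → Woven k h Bs → cut k (weave h Bs) ≡ Bs
    cut-weave (last b) = go b
      where
      go : ∀ {B} → All (_< k) B → cut k B ≡ B ∷ []
      go [] = refl
      go {x ∷ B} (x<k ∷ b) = trans (cut-lo B x<k) (cong (consHead x) (go b))
    cut-weave (more {B} {y} {h} {Bs} b k<y v) = go b
      where
      go : ∀ {B} → All (_< k) B → cut k (B ++ y ∷ weave h Bs) ≡ B ∷ Bs
      go [] = trans (cut-hi _ k<y) (cong ([] ∷_) (cut-weave v))
      go {x ∷ B} (x<k ∷ b) = trans (cut-lo _ x<k) (cong (consHead x) (go b))

    woven-cut : ∀ {u} → All (λ x → x < k ⊎ k < x) u → Woven k (filter hi? u) (cut k u) × weave (filter hi? u) (cut k u) ≡ u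
    woven-cut [] = last [] , refl
    woven-cut {x ∷ u} (inj₁ x<k ∷ all)
      rewrite cut-lo u x<k | filter-reject hi? {x} {u} (lo¬hi x<k) with woven-cut all
    ... | v , e = go v e
      where
      go : ∀ {h Bs} → Woven k h Bs → weave h Bs ≡ u → Woven k h (consHead x Bs) × weave h (consHead x Bs) ≡ x ∷ u
      go (last b) e = last (x<k ∷ b) , cong (x ∷_) e
      go (more b k<y v) e = more (x<k ∷ b) k<y v , cong (x ∷_) e
    woven-cut {x ∷ u} (inj₂ k<x ∷ all)
      rewrite cut-hi u k<x | filter-accept hi? {x} {u} k<x with woven-cut all
    ... | v , e = more [] k<x v , cong (x ∷_) e

    inserts-++ : ∀ e B x w → inserts e (B ++ x ∷ w) ≡ map (_++ x ∷ w) (inserts e B) ++ map (λ v → B ++ x ∷ v) (inserts e w)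
    inserts-++ e [] x w = refl
    inserts-++ e (b ∷ B) x w = cong ((e ∷ b ∷ B ++ x ∷ w) ∷_)
      (trans (cong (map (b ∷_)) (inserts-++ e B x w)) (trans (map-++ (b ∷_) (map (_++ x ∷ w) (inserts e B)) _)
        (cong₂ _++_ (trans (sym (map-∘ (inserts e B))) (map-∘ (inserts e B))) (sym (map-∘ (inserts e w))))))

    -- Neighbouring blocks are separated by a high letter, so every gap of the woven word belongs to
    -- exactly one block.
    inserts-weave : ∀ {e h Bs} → Woven k h Bs → inserts e (weave h Bs) ≡ map (weave h) (insertsᴮ e Bs)
    inserts-weave {e} {Bs = B ∷ []} (last _) = sym (trans (map-++ (weave []) (map (_∷ []) (inserts e B)) [])
      (trans (++-identityʳ _) (trans (sym (map-∘ (inserts e B))) (map-id (inserts e B)))))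
    inserts-weave {e} {x ∷ h} {B ∷ Bs} (more _ _ v) = trans (inserts-++ e B x (weave h Bs))
      (sym (trans (map-++ (weave (x ∷ h)) (map (_∷ Bs) (inserts e B)) _)
        (cong₂ _++_ (sym (map-∘ (inserts e B)))
          (trans (sym (map-∘ (insertsᴮ e Bs)))
            (trans (map-∘ (insertsᴮ e Bs)) (cong (map (λ v → B ++ x ∷ v)) (sym (inserts-weave v))))))))

-- Patterns of length four, active sites, and words with one letter set apart.

module Patterns where

  open Words
  open import Defs using (subseqs)
  open import Data.Nat using (ℕ; zero; suc; _+_; _<_; _≤_; z≤n)
  import Data.Nat.Properties as ℕₚ
  open import Data.List using (List; []; _∷_; _++_; map; concat; length; filter)
  open import Data.List.Properties using (filter-accept; filter-reject)
  open import Data.List.Relation.Unary.All as All using (All; []; _∷_)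
  import Data.List.Relation.Unary.All.Properties as Allₚ
  open import Data.List.Relation.Unary.Any using (Any; here; there; any?)
  open import Data.List.Membership.Propositional using (_∈_; find; lose)
  open import Data.List.Membership.Propositional.Properties using (∈-++⁻; ∈-++⁺ˡ; ∈-++⁺ʳ; ∈-map⁺; ∈-map⁻)
  open import Data.List.Relation.Binary.Sublist.Propositional as Sub using (_⊆_; []; _∷_; _∷ʳ_; ⊆-trans; minimum)
  import Data.List.Relation.Binary.Sublist.Propositional.Properties as Subₚ
  open import Data.List.Relation.Binary.Permutation.Propositional using (_↭_)
  open import Data.List.Relation.Binary.Permutation.Propositional.Properties using (filter-↭; ↭-length)
  open import Data.List.Relation.Binary.Pointwise using (Pointwise; []; _∷_)
  open import Data.Product using (∃; ∃₂; _×_; _,_; proj₁; proj₂)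
  open import Data.Sum using (_⊎_; inj₁; inj₂)
  open import Data.Empty using (⊥; ⊥-elim)
  open import Function using (_∘_; _⇔_; mk⇔; Equivalence)
  open import Relation.Nullary using (¬_; Dec; yes; no; ¬?)
  open import Relation.Nullary.Decidable using (map′)
  open import Relation.Unary using (Decidable)
  open import Relation.Binary.PropositionalEquality using (_≡_; refl; sym; trans; cong; subst)

  ∈-subseqs⁺ : ∀ {zs xs : List ℕ} → zs ⊆ xs → zs ∈ subseqs (length zs) xs
  ∈-subseqs⁺ {[]} _ = here refl
  ∈-subseqs⁺ {z ∷ zs} {x ∷ xs} (.x ∷ʳ τ) = ∈-++⁺ʳ (map (x ∷_) (subseqs (length zs) xs)) (∈-subseqs⁺ τ)
  ∈-subseqs⁺ {z ∷ zs} {x ∷ xs} (refl ∷ τ) = ∈-++⁺ˡ (∈-map⁺ (x ∷_) (∈-subseqs⁺ τ))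

  ∈-subseqs⁻ : ∀ k {zs} (xs : List ℕ) → zs ∈ subseqs k xs → zs ⊆ xs × length zs ≡ k
  ∈-subseqs⁻ zero xs (here refl) = minimum xs , refl
  ∈-subseqs⁻ (suc k) (x ∷ xs) zs∈ with ∈-++⁻ (map (x ∷_) (subseqs k xs)) zs∈
  ... | inj₁ p with ∈-map⁻ (x ∷_) p
  ...   | ys , ys∈ , refl with ∈-subseqs⁻ k xs ys∈
  ...     | τ , e = refl ∷ τ , cong suc e
  ∈-subseqs⁻ (suc k) (x ∷ xs) zs∈ | inj₂ q with ∈-subseqs⁻ (suc k) xs q
  ... | τ , e = x ∷ʳ τ , e

  Rel₄ : Set₁
  Rel₄ = ℕ → ℕ → ℕ → ℕ → Set

  record Pattern : Set₁ where
    field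
      R : Rel₄
      R? : ∀ a b c d → Dec (R a b c d)
      -- Monotonicity is asked only on `Ok` letters, because maps such as `_∸ k` and `sub x` are
      -- strictly monotone only on part of ℕ.
      R-map : ∀ (f : ℕ → ℕ) {Ok : ℕ → Set} → (∀ {x y} → Ok x → Ok y → x < y → f x < f y) →
        ∀ {a b c d} → Ok a → Ok b → Ok c → Ok d → R a b c d → R (f a) (f b) (f c) (f d)
      -- An inversion across each of the cuts 1|3, 2|2 and 3|1, so that no occurrence can straddle
      -- the two parts of a direct sum.
      sum-indecomposable : ∀ {a b c d} → R a b c d →
        (b < a ⊎ c < a ⊎ d < a) × (c < a ⊎ d < a ⊎ c < b ⊎ d < b) × (d < a ⊎ d < b ⊎ d < c)

    Match : List ℕ → Set
    Match (a ∷ b ∷ c ∷ d ∷ []) = R a b c d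
    Match _ = ⊥

    match? : Decidable Match
    match? [] = no λ ()
    match? (_ ∷ []) = no λ ()
    match? (_ ∷ _ ∷ []) = no λ ()
    match? (_ ∷ _ ∷ _ ∷ []) = no λ ()
    match? (a ∷ b ∷ c ∷ d ∷ []) = R? a b c d
    match? (_ ∷ _ ∷ _ ∷ _ ∷ _ ∷ _) = no λ ()

    Match-length : ∀ {zs} → Match zs → length zs ≡ 4
    Match-length {_ ∷ _ ∷ _ ∷ _ ∷ []} _ = refl

    Contains Avoid : List ℕ → Set
    Contains w = ∃ λ zs → zs ⊆ w × Match zs
    Avoid w = ¬ Contains w

    contains? : Decidable Contains
    contains? w = map′ to from (any? match? (subseqs 4 w))
      where
      to : Any Match (subseqs 4 w) → Contains w
      to p with find p
      ... | zs , zs∈ , m = zs , proj₁ (∈-subseqs⁻ 4 w zs∈) , m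
      from : Contains w → Any Match (subseqs 4 w)
      from (zs , τ , m) = lose (subst (λ k → zs ∈ subseqs k w) (Match-length {zs} m) (∈-subseqs⁺ τ)) m

    abstract
      avoid? : Decidable Avoid
      avoid? w = ¬? (contains? w)

    avoid-⊆ : ∀ {v w} → v ⊆ w → Avoid w → Avoid v
    avoid-⊆ σ a (zs , τ , m) = a (zs , ⊆-trans τ σ , m)

    avoid-[] : Avoid []
    avoid-[] (_ ∷ _ ∷ _ ∷ _ ∷ [] , () , _)

    Match-map : ∀ (f : ℕ → ℕ) {Ok : ℕ → Set} → (∀ {x y} → Ok x → Ok y → x < y → f x < f y) →
      ∀ {zs} → All Ok zs → Match zs → Match (map f zs)
    Match-map f mono {_ ∷ _ ∷ _ ∷ _ ∷ []} (oa ∷ ob ∷ oc ∷ od ∷ []) m = R-map f mono oa ob oc od m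

    contains-map : ∀ (f : ℕ → ℕ) {Ok : ℕ → Set} → (∀ {x y} → Ok x → Ok y → x < y → f x < f y) →
      ∀ {w} → All Ok w → Contains w → Contains (map f w)
    contains-map f mono ok (zs , τ , m) = map f zs , Subₚ.map⁺ f τ , Match-map f mono (All-⊆ τ ok) m

    avoid-++ : ∀ {xs ys} → xs ≼ ys → Avoid xs → Avoid ys → Avoid (xs ++ ys)
    avoid-++ {xs} {ys} le ax ay (zs , τ , m) with ⊆-split xs τ
    ... | ps , qs , refl , p , q = go ps qs p q m
      where
      ≤-of : ∀ {ps qs x y} → ps ⊆ xs → qs ⊆ ys → x ∈ ps → y ∈ qs → x ≤ y
      ≤-of p q x∈ y∈ = All.lookup (All.lookup le (Sub.lookup p x∈)) (Sub.lookup q y∈)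
      go : ∀ ps qs → ps ⊆ xs → qs ⊆ ys → Match (ps ++ qs) → ⊥
      go [] qs p q m = ay (qs , q , m)
      go (a ∷ []) (b ∷ c ∷ d ∷ []) p q m with proj₁ (sum-indecomposable m)
      ... | inj₁ l = ℕₚ.<⇒≱ l (≤-of p q (here refl) (here refl))
      ... | inj₂ (inj₁ l) = ℕₚ.<⇒≱ l (≤-of p q (here refl) (there (here refl)))
      ... | inj₂ (inj₂ l) = ℕₚ.<⇒≱ l (≤-of p q (here refl) (there (there (here refl))))
      go (a ∷ b ∷ []) (c ∷ d ∷ []) p q m with proj₁ (proj₂ (sum-indecomposable m))
      ... | inj₁ l = ℕₚ.<⇒≱ l (≤-of p q (here refl) (here refl))
      ... | inj₂ (inj₁ l) = ℕₚ.<⇒≱ l (≤-of p q (here refl) (there (here refl)))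
      ... | inj₂ (inj₂ (inj₁ l)) = ℕₚ.<⇒≱ l (≤-of p q (there (here refl)) (here refl))
      ... | inj₂ (inj₂ (inj₂ l)) = ℕₚ.<⇒≱ l (≤-of p q (there (here refl)) (there (here refl)))
      go (a ∷ b ∷ c ∷ []) (d ∷ []) p q m with proj₂ (proj₂ (sum-indecomposable m))
      ... | inj₁ l = ℕₚ.<⇒≱ l (≤-of p q (here refl) (here refl))
      ... | inj₂ (inj₁ l) = ℕₚ.<⇒≱ l (≤-of p q (there (here refl)) (here refl))
      ... | inj₂ (inj₂ l) = ℕₚ.<⇒≱ l (≤-of p q (there (there (here refl))) (here refl))
      go (a ∷ b ∷ c ∷ d ∷ []) [] p q m = ax (_ , p , m)

    avoid-concat : ∀ {Bs} → Stacked Bs → All Avoid Bs → Avoid (concat Bs)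
    avoid-concat {[]} _ _ = avoid-[]
    avoid-concat {B ∷ Bs} (le , st) (a ∷ as) = avoid-++ le a (avoid-concat st as)

    -- A site of w is active if a new minimum can be inserted there; as the letters are positive, 0 serves.
    sites : List ℕ → ℕ
    sites w = length (filter avoid? (inserts 0 w))

    sites-[] : sites [] ≡ 1
    sites-[] = cong length (filter-accept avoid? {0 ∷ []} {[]} λ { (_ ∷ _ ∷ _ ∷ _ ∷ [] , _ ∷ʳ () , _) ; (_ ∷ _ ∷ _ ∷ _ ∷ [] , _ ∷ () , _) })

    Active : List ℕ → List ℕ → Set
    Active i B = B ≡ [] ⊎ Avoid i

    record Admissible (is Bs : List (List ℕ)) : Set where
      constructor admissible
      field
        active : Pointwise Active is Bs
        avoiding : All Avoid Bs
        stacked : Stacked Bs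

  -- A relation instead of the length of a filtered list, since `Admissible` comes without a
  -- decision procedure.
  data Count {A : Set} (P : A → Set) : List A → ℕ → Set where
    [] : Count P [] 0
    hit : ∀ {x xs n} → P x → Count P xs n → Count P (x ∷ xs) (suc n)
    miss : ∀ {x xs n} → ¬ P x → Count P xs n → Count P (x ∷ xs) n

  module _ {A : Set} {P : A → Set} where

    count-filter : ∀ (P? : Decidable P) {xs n} → Count P xs n → length (filter P? xs) ≡ n
    count-filter P? [] = refl
    count-filter P? (hit {x} {xs} p c) = trans (cong length (filter-accept P? {x} {xs} p)) (cong suc (count-filter P? c))
    count-filter P? (miss {x} {xs} ¬p c) = trans (cong length (filter-reject P? {x} {xs} ¬p)) (count-filter P? c)

    filter-count : ∀ (P? : Decidable P) xs → Count P xs (length (filter P? xs))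
    filter-count P? [] = []
    filter-count P? (x ∷ xs) with P? x
    ... | yes p = hit p (filter-count P? xs)
    ... | no ¬p = miss ¬p (filter-count P? xs)

    count-++ : ∀ {xs ys m n} → Count P xs m → Count P ys n → Count P (xs ++ ys) (m + n)
    count-++ [] d = d
    count-++ (hit p c) d = hit p (count-++ c d)
    count-++ (miss ¬p c) d = miss ¬p (count-++ c d)

    count-none : ∀ {xs} → All (λ x → ¬ P x) xs → Count P xs 0
    count-none [] = []
    count-none (¬p ∷ ¬ps) = miss ¬p (count-none ¬ps)

    count-map : ∀ {B : Set} (f : B → A) {Q : B → Set} {xs n} → All (λ x → P (f x) ⇔ Q x) xs → Count Q xs n → Count P (map f xs) n
    count-map f [] [] = []
    count-map f (e ∷ es) (hit q c) = hit (Equivalence.from e q) (count-map f es c)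
    count-map f (e ∷ es) (miss ¬q c) = miss (¬q ∘ Equivalence.to e) (count-map f es c)

  All-inserts : ∀ {P : ℕ → Set} {e w} → P e → All P w → All (All P) (inserts e w)
  All-inserts pe [] = (pe ∷ []) ∷ []
  All-inserts {e = e} {x ∷ w} pe (px ∷ pw) = (pe ∷ px ∷ pw) ∷ Allₚ.map⁺ (All.map (px ∷_) (All-inserts pe pw))

  ∈-inserts : ∀ {e} w → All (e ∈_) (inserts e w)
  ∈-inserts [] = here refl ∷ []
  ∈-inserts (x ∷ w) = here refl ∷ Allₚ.map⁺ (All.map there (∈-inserts w))

  module Labels (p : Pattern) where
    open Pattern p

    if-empty : List ℕ → ℕ → ℕ
    if-empty [] n = n
    if-empty (_ ∷ _) n = 0

    blockSites : (is Bs : List (List ℕ)) → ℕ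
    blockSites (i ∷ is) (B ∷ Bs) with avoid? i
    ... | yes _ = sites B + if-empty B (blockSites is Bs)
    ... | no _ = blockSites is Bs
    blockSites _ _ = 0

    admissible-tail : ∀ {i B is Bs} → Admissible (i ∷ is) (B ∷ Bs) → Admissible is Bs
    admissible-tail (admissible (_ ∷ as) (_ ∷ bs) (_ , st)) = admissible as bs st

    ≼-concat-insertsᴮ : ∀ {Bs : List (List ℕ)} → All (λ Cs → 0 ∈ concat Cs) (insertsᴮ 0 Bs)
    ≼-concat-insertsᴮ {[]} = []
    ≼-concat-insertsᴮ {B ∷ Bs} = Allₚ.++⁺ (Allₚ.map⁺ (All.map ∈-++⁺ˡ (∈-inserts B)))
      (Allₚ.map⁺ (All.map (∈-++⁺ʳ B) (≼-concat-insertsᴮ {Bs})))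

    -- An inactive site takes no letter, and at an active one the block merely has to stay avoiding.
    -- Behind a nonempty block a 0 lies below an earlier block letter, since these are at least 1,
    -- and breaks the stacking; hence `if-empty`.
    count-blockSites : ∀ {is Bs} → All (All (1 ≤_)) Bs → Admissible is Bs →
      Count (Admissible is) (insertsᴮ 0 Bs) (blockSites is Bs)
    count-blockSites [] (admissible [] _ _) = []
    count-blockSites {i ∷ is} {B ∷ Bs} (1≤B ∷ 1≤Bs) adm@(admissible (act ∷ acts) (aB ∷ aBs) (B≼ , st)) with avoid? i
    ... | yes ai = count-++ (count-map (_∷ Bs) (All.tabulate λ {C} C∈ → mk⇔
              (λ { (admissible _ (aC ∷ _) _) → aC })
              (λ aC → admissible (inj₂ ai ∷ acts) (aC ∷ aBs) (All.lookup (All-inserts {P = λ x → All (x ≤_) (concat Bs)} (All.universal (λ _ → z≤n) _) B≼) C∈ , st)))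
            (filter-count avoid? (inserts 0 B)))
          (later B 1≤B aB)
      where
      later : ∀ B → All (1 ≤_) B → Avoid B → Count (Admissible (i ∷ is)) (map (B ∷_) (insertsᴮ 0 Bs)) (if-empty B (blockSites is Bs))
      later [] _ a = count-map ([] ∷_) (All.universal (λ _ → mk⇔ admissible-tail
        (λ { (admissible acts as st) → admissible (inj₁ refl ∷ acts) (a ∷ as) ([] , st) })) _)
        (count-blockSites 1≤Bs (admissible-tail adm))
      later (b ∷ B) (1≤b ∷ _) _ = count-none (Allₚ.map⁺ (All.map (λ 0∈ → λ { (admissible _ _ ((b≤ ∷ _) , _)) →
        ℕₚ.<⇒≱ 1≤b (All.lookup b≤ 0∈) }) (≼-concat-insertsᴮ {Bs})))
    ... | no ¬ai with act
    ...   | inj₂ ai = ⊥-elim (¬ai ai)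
    ...   | inj₁ refl = miss (λ { (admissible (inj₁ () ∷ _) _ _) ; (admissible (inj₂ ai ∷ _) _ _) → ¬ai ai })
      (count-map ([] ∷_) (All.universal (λ _ → mk⇔ admissible-tail
        (λ { (admissible acts as st) → admissible (inj₁ refl ∷ acts) (aB ∷ as) ([] , st) })) _)
        (count-blockSites 1≤Bs (admissible-tail adm)))

  -- The ways in which an occurrence can lie relative to `k`. In `oneLow` the low letter is lowered
  -- to 0, so that the occurrence speaks about a site of the high letters.
  data Shape (Match : List ℕ → Set) (k : ℕ) (u : List ℕ) : Set where
    allHigh : ∀ {zs} → zs ⊆ u → All (k <_) zs → Match zs → Shape Match k u
    allLow : ∀ {zs} → zs ⊆ u → All (_< k) zs → Match zs → Shape Match k u
    descent : ∀ {x d y} → (x ∷ d ∷ y ∷ []) ⊆ u → y < x → x < k → k < d → Shape Match k u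
    oneLow : ∀ zs₁ {a zs₂} → zs₁ ++ a ∷ zs₂ ⊆ u → All (k <_) zs₁ → a < k → All (k <_) zs₂ →
      Match (zs₁ ++ 0 ∷ zs₂) → Shape Match k u

  -- Common to both base cases: `k` stands at one end of the word. `far` puts the new minimum on the
  -- outer side of `k`, the one site not inherited from `u`; by `avoid-far` it is always active,
  -- which is the `suc` in `act`.
  record Placement (p : Pattern) : Set₁ where
    open Pattern p
    field
      place : ℕ → List ℕ → List ℕ
      place-⊆ : ∀ k u → u ⊆ place k u
      place-↭ : ∀ k u → place k u ↭ k ∷ u
      place-injective : ∀ {k k' u u'} → place k u ≡ place k' u' → k ≡ k' × u ≡ u'
      unplace : ∀ x w → ∃₂ λ k u → x ∷ w ≡ place k u
      descent-contains : ∀ {k u x d y} → (x ∷ d ∷ y ∷ []) ⊆ u → y < x → x < k → k < d → Contains (place k u)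
      shape : ∀ {k u} → All (λ x → x < k ⊎ k < x) u → Contains (place k u) → Shape Match k u
      far : ℕ → List ℕ → List ℕ
      inserts-place : ∀ k u → inserts 0 (place k u) ↭ far k u ∷ map (place k) (inserts 0 u)
      avoid-far : ∀ {k u} → Avoid (place k u) → Avoid (far k u)

    open Labels p public

    -- Each shape is refuted by one ingredient: avoidance of `h`, avoidance of the stacked blocks,
    -- stackedness, activity of the site.
    place-avoids : ∀ {k h Bs} → Woven k h Bs → Avoid h → Admissible (inserts 0 h) Bs → Avoid (place k (weave h Bs))
    place-avoids {k} {h} {Bs} v ah (admissible act as st) c with shape (weave-lohi v) c
    ... | allHigh τ hi m = ah (_ , hi-⊆ v hi τ , m)
    ... | allLow τ lo m = avoid-concat st as (_ , lo-⊆ v lo τ , m)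
    ... | descent τ y<x x<k k<d = ℕₚ.<⇒≱ y<x (stacked-triple v st x<k k<d (ℕₚ.<-trans y<x x<k) τ)
    ... | oneLow zs₁ τ hi₁ a<k hi₂ m with find-site zs₁ v act hi₁ a<k hi₂ τ
    ...   | i , ai , σ = ai (_ , σ , m)

    -- If a block has a letter `x`, then `sub x` turns an occurrence through a 0 at its site into
    -- one in the word, so the site is active. A descent between blocks across a high letter would
    -- form the pattern together with `k`.
    place-avoids⁻ : ∀ {k h Bs} → Woven k h Bs → Avoid (place k (weave h Bs)) → Avoid h × Admissible (inserts 0 h) Bs
    place-avoids⁻ {k} {h} {Bs} v a = avoid-⊆ (h⊆weave v) au , admissible
      (act (All.tabulate λ i∈ → i∈) (woven-lo v) (sub-⊆ v))
      (All.map (λ τ → avoid-⊆ τ au) (blocks⊆weave v))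
      (triples-stacked v λ x<k k<d y<k τ → ℕₚ.≮⇒≥ λ y<x → a (descent-contains τ y<x x<k k<d))
      where
      u : List ℕ
      u = weave h Bs
      au : Avoid u
      au = avoid-⊆ (place-⊆ k u) a
      Ok : ℕ → Set
      Ok y = y ≡ 0 ⊎ k < y
      sub-mono : ∀ {x} → x < k → ∀ {y z} → Ok y → Ok z → y < z → sub x y < sub x z
      sub-mono x<k {zero} {suc z} _ (inj₂ k<z) _ = ℕₚ.<-trans x<k k<z
      sub-mono x<k {suc y} {suc z} _ _ y<z = y<z
      ins-ok : ∀ {i} → i ∈ inserts 0 h → All Ok i
      ins-ok = All.lookup (All-inserts (inj₁ refl) (All.map inj₂ (woven-hi v)))
      act : ∀ {is Bs} → All (_∈ inserts 0 h) is → All (All (_< k)) Bs →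
        Pointwise (λ i (B : List ℕ) → ∀ {x} → x ∈ B → map (sub x) i ⊆ u) is Bs → Pointwise Active is Bs
      act [] [] [] = []
      act {Bs = [] ∷ _} (_ ∷ is∈) (_ ∷ los) (_ ∷ ps) = inj₁ refl ∷ act is∈ los ps
      act {Bs = (x ∷ B) ∷ _} (i∈ ∷ is∈) ((x<k ∷ _) ∷ los) (p ∷ ps) =
        inj₂ (λ c → let zs , τ , m = contains-map (sub x) (sub-mono x<k) (ins-ok i∈) c
                    in au (zs , ⊆-trans τ (p (here refl)) , m))
        ∷ act is∈ los ps

    woven-insert : ∀ {k h Bs} → 0 < k → Woven k h Bs → All (Woven k h) (insertsᴮ 0 Bs)
    woven-insert 0<k (last b) = Allₚ.++⁺ (Allₚ.map⁺ (All.map last (All-inserts 0<k b))) []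
    woven-insert 0<k (more b k<x v) = Allₚ.++⁺ (Allₚ.map⁺ (All.map (λ b' → more b' k<x v) (All-inserts 0<k b)))
      (Allₚ.map⁺ (All.map (more b k<x) (woven-insert 0<k v)))

    -- Inserting 0 into a woven word amounts to inserting it into one of the blocks, so
    -- place-avoids and place-avoids⁻ applied to the enlarged word count the active sites.
    sites-place : ∀ {k h Bs} → 0 < k → Woven k h Bs → All (All (1 ≤_)) Bs → Avoid h → Admissible (inserts 0 h) Bs →
      sites (place k (weave h Bs)) ≡ suc (blockSites (inserts 0 h) Bs)
    sites-place {k} {h} {Bs} 0<k v pos ah adm = trans (↭-length (filter-↭ avoid? (inserts-place k (weave h Bs))))
      (count-filter avoid? (hit (avoid-far (place-avoids v ah adm))
        (subst (λ is → Count Avoid (map (place k) is) (blockSites (inserts 0 h) Bs)) (sym (inserts-weave v))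
          (count-map (place k) (All.universal (λ _ → mk⇔ (λ a → a) (λ a → a)) _)
            (count-map (weave h) (All.map (λ v' → mk⇔ (λ a → proj₂ (place-avoids⁻ v' a)) (place-avoids v' ah)) (woven-insert 0<k v))
              (count-blockSites pos adm))))))

-- The two base cases: 3241 with its leading letter, 2413 with its final letter.

module Placements where

  open Words
  open Patterns
  open import Data.Nat using (ℕ; _<_; z≤n; _<?_)
  import Data.Nat.Properties as ℕₚ
  open import Data.List using (List; []; _∷_; _++_; map)
  open import Data.List.Properties using (++-assoc; ∷ʳ-injective; ∷-injectiveˡ; ∷-injectiveʳ)
  open import Data.List.Relation.Unary.All using (All; []; _∷_)
  open import Data.List.Relation.Binary.Sublist.Propositional using (_⊆_; []; _∷_; _∷ʳ_; ⊆-refl; ⊆-trans; minimum)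
  open import Data.List.Relation.Binary.Sublist.Propositional.Properties using (++⁺; ++⁺ʳ)
  open import Data.List.Relation.Binary.Permutation.Propositional using (↭-sym; ↭-refl; ↭-trans; ↭-reflexive)
  open import Data.List.Relation.Binary.Permutation.Propositional.Properties using (∷↭∷ʳ)
  open import Data.Product using (∃₂; _×_; _,_)
  open import Data.Sum using (_⊎_; inj₁; inj₂)
  open import Data.Empty using (⊥)
  open import Relation.Nullary using (Dec; _×-dec_)
  open import Relation.Binary.PropositionalEquality using (_≡_; refl; sym; cong; subst)

  -- Lists the letters of a pattern by increasing value: 3241 is `Chain d b a c`, as its 1, 2, 3, 4
  -- are d, b, a, c.
  Chain : Rel₄
  Chain x y z t = x < y × y < z × z < t

  chain? : ∀ x y z t → Dec (Chain x y z t)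
  chain? x y z t = (x <? y) ×-dec (y <? z) ×-dec (z <? t)

  chain-map : ∀ (f : ℕ → ℕ) {Ok : ℕ → Set} → (∀ {x y} → Ok x → Ok y → x < y → f x < f y) →
    ∀ {x y z t} → Ok x → Ok y → Ok z → Ok t → Chain x y z t → Chain (f x) (f y) (f z) (f t)
  chain-map f m ox oy oz ot (p , q , r) = m ox oy p , m oy oz q , m oz ot r

  p3241 p4132 p4213 p2431 p2413 p3142 : Pattern
  p3241 = record { R = λ a b c d → Chain d b a c ; R? = λ a b c d → chain? d b a c
    ; R-map = λ f m oa ob oc od → chain-map f m od ob oa oc
    ; sum-indecomposable = λ (d<b , b<a , a<c) → inj₁ b<a , inj₂ (inj₂ (inj₂ d<b)) , inj₂ (inj₁ d<b) }
  p4132 = record { R = λ a b c d → Chain b d c a ; R? = λ a b c d → chain? b d c a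
    ; R-map = λ f m oa ob oc od → chain-map f m ob od oc oa
    ; sum-indecomposable = λ (b<d , d<c , c<a) → inj₂ (inj₁ c<a) , inj₁ c<a , inj₂ (inj₂ d<c) }
  p4213 = record { R = λ a b c d → Chain c b d a ; R? = λ a b c d → chain? c b d a
    ; R-map = λ f m oa ob oc od → chain-map f m oc ob od oa
    ; sum-indecomposable = λ (c<b , b<d , d<a) → inj₂ (inj₂ d<a) , inj₂ (inj₁ d<a) , inj₁ d<a }
  p2431 = record { R = λ a b c d → Chain d a c b ; R? = λ a b c d → chain? d a c b
    ; R-map = λ f m oa ob oc od → chain-map f m od oa oc ob
    ; sum-indecomposable = λ (d<a , a<c , c<b) → inj₂ (inj₂ d<a) , inj₂ (inj₁ d<a) , inj₁ d<a }
  p2413 = record { R = λ a b c d → Chain c a d b ; R? = λ a b c d → chain? c a d b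
    ; R-map = λ f m oa ob oc od → chain-map f m oc oa od ob
    ; sum-indecomposable = λ (c<a , a<d , d<b) → inj₂ (inj₁ c<a) , inj₁ c<a , inj₂ (inj₁ d<b) }
  p3142 = record { R = λ a b c d → Chain b d a c ; R? = λ a b c d → chain? b d a c
    ; R-map = λ f m oa ob oc od → chain-map f m ob od oa oc
    ; sum-indecomposable = λ (b<d , d<a , a<c) → inj₁ (ℕₚ.<-trans b<d d<a) , inj₂ (inj₁ d<a) , inj₁ d<a }

  first3241 : Placement p3241
  first3241 = record
    { place = _∷_
    ; place-⊆ = λ k u → k ∷ʳ ⊆-refl
    ; place-↭ = λ k u → ↭-refl
    ; place-injective = λ e → ∷-injectiveˡ e , ∷-injectiveʳ e
    ; unplace = λ x w → x , w , refl
    ; descent-contains = λ τ y<x x<k k<d → _ , refl ∷ τ , (y<x , x<k , k<d)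
    -- A leading `k` is the 3, and the 2 4 1 after it is the descent.
    ; shape = λ { all (_ ∷ _ ∷ _ ∷ _ ∷ [] , refl ∷ τ , d<b , b<a , a<c) → descent τ d<b b<a a<c
                ; all (_ ∷ _ ∷ _ ∷ _ ∷ [] , _ ∷ʳ τ , m) → inside all τ m }
    ; far = λ k u → 0 ∷ k ∷ u
    ; inserts-place = λ k u → ↭-refl
    ; avoid-far = λ { av (_ ∷ _ ∷ _ ∷ _ ∷ [] , _ ∷ʳ τ , m) → av (_ , τ , m)
                    -- A leading 0 would have to be the 3, with the 2 below it.
                    ; av (_ ∷ _ ∷ _ ∷ _ ∷ [] , refl ∷ τ , _ , () , _) }
    }
    where
    open Pattern p3241
    -- If the 4 (`c`) is low or the 1 (`d`) is high, all letters lie on one side of `k`. Otherwise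
    -- the side of the 2 (`b`) decides between `descent` and `oneLow`.
    inside : ∀ {k u a b c d} → All (λ x → x < k ⊎ k < x) u → (a ∷ b ∷ c ∷ d ∷ []) ⊆ u → R a b c d → Shape Match k u
    inside all τ m@(d<b , b<a , a<c) with All-⊆ τ all
    ... | _ ∷ _ ∷ inj₁ c<k ∷ _ ∷ [] =
      let a<k = ℕₚ.<-trans a<c c<k ; b<k = ℕₚ.<-trans b<a a<k in
      allLow τ (a<k ∷ b<k ∷ c<k ∷ ℕₚ.<-trans d<b b<k ∷ []) m
    ... | _ ∷ _ ∷ _ ∷ inj₂ k<d ∷ [] =
      let k<b = ℕₚ.<-trans k<d d<b ; k<a = ℕₚ.<-trans k<b b<a in
      allHigh τ (k<a ∷ k<b ∷ ℕₚ.<-trans k<a a<c ∷ k<d ∷ []) m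
    ... | _ ∷ inj₁ b<k ∷ inj₂ k<c ∷ inj₁ d<k ∷ [] = descent (⊆-trans (_ ∷ʳ ⊆-refl) τ) d<b b<k k<c
    ... | _ ∷ inj₂ k<b ∷ inj₂ k<c ∷ inj₁ d<k ∷ [] =
      oneLow (_ ∷ _ ∷ _ ∷ []) τ (ℕₚ.<-trans k<b b<a ∷ k<b ∷ k<c ∷ []) d<k [] (ℕₚ.≤-<-trans z≤n k<b , b<a , a<c)

  inserts-∷ʳ : ∀ e u k → inserts e (u ++ k ∷ []) ≡ map (_++ k ∷ []) (inserts e u) ++ (u ++ k ∷ e ∷ []) ∷ []
  inserts-∷ʳ e u k = inserts-++ {0} e u k []

  ⊆-snoc : ∀ {a b c d k} u → (a ∷ b ∷ c ∷ d ∷ []) ⊆ u ++ k ∷ [] → (a ∷ b ∷ c ∷ d ∷ []) ⊆ u ⊎ ((a ∷ b ∷ c ∷ []) ⊆ u × d ≡ k)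
  ⊆-snoc {d = d} u τ with ⊆-split u τ
  ... | _ ∷ _ ∷ _ ∷ _ ∷ [] , [] , refl , p , _ = inj₁ p
  ... | _ ∷ _ ∷ _ ∷ [] , _ ∷ [] , refl , p , (refl ∷ []) = inj₂ (p , refl)
  ... | _ ∷ _ ∷ _ ∷ [] , _ ∷ [] , refl , p , (_ ∷ʳ ())
  ... | _ ∷ _ ∷ [] , _ ∷ _ ∷ [] , refl , p , (_ ∷ʳ ())
  ... | _ ∷ _ ∷ [] , _ ∷ _ ∷ [] , refl , p , (refl ∷ ())
  ... | _ ∷ [] , _ ∷ _ ∷ _ ∷ [] , refl , p , (_ ∷ʳ ())
  ... | _ ∷ [] , _ ∷ _ ∷ _ ∷ [] , refl , p , (refl ∷ ())
  ... | [] , _ ∷ _ ∷ _ ∷ _ ∷ [] , refl , p , (_ ∷ʳ ())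
  ... | [] , _ ∷ _ ∷ _ ∷ _ ∷ [] , refl , p , (refl ∷ ())

  last2413 : Placement p2413
  last2413 = record
    { place = snoc
    ; place-⊆ = λ k u → ++⁺ʳ (k ∷ []) ⊆-refl
    ; place-↭ = λ k u → ↭-sym (∷↭∷ʳ k u)
    ; place-injective = λ {k} {k'} {u} {u'} e → let e₁ , e₂ = ∷ʳ-injective u u' e in e₂ , e₁
    ; unplace = unsnoc
    ; descent-contains = λ τ y<x x<k k<d → _ , ++⁺ τ ⊆-refl , (y<x , x<k , k<d)
    ; shape = λ { {k} {u} all (_ ∷ _ ∷ _ ∷ _ ∷ [] , τ , m) → split all (⊆-snoc u τ) m }
    ; far = λ k u → u ++ k ∷ 0 ∷ []
    ; inserts-place = λ k u → ↭-trans (↭-reflexive (inserts-∷ʳ 0 u k)) (↭-sym (∷↭∷ʳ _ (map (snoc k) (inserts 0 u))))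
    ; avoid-far = λ { {k} {u} av (_ ∷ _ ∷ _ ∷ _ ∷ [] , τ , m) → far⁻ {k} {u} av τ m }
    }
    where
    open Pattern p2413
    snoc : ℕ → List ℕ → List ℕ
    snoc k u = u ++ k ∷ []
    unsnoc : ∀ x w → ∃₂ λ k u → x ∷ w ≡ snoc k u
    unsnoc x [] = x , [] , refl
    unsnoc x (y ∷ w) with unsnoc y w
    ... | k , u , e = k , x ∷ u , cong (x ∷_) e
    -- The same division as for 3241; now the 4 is `b`, the 1 is `c` and the deciding 2 is `a`.
    inside : ∀ {k u a b c d} → All (λ x → x < k ⊎ k < x) u → (a ∷ b ∷ c ∷ d ∷ []) ⊆ u → R a b c d → Shape Match k u
    inside all τ m@(c<a , a<d , d<b) with All-⊆ τ all
    ... | _ ∷ inj₁ b<k ∷ _ ∷ _ ∷ [] =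
      let d<k = ℕₚ.<-trans d<b b<k ; a<k = ℕₚ.<-trans a<d d<k in
      allLow τ (a<k ∷ b<k ∷ ℕₚ.<-trans c<a a<k ∷ d<k ∷ []) m
    ... | _ ∷ _ ∷ inj₂ k<c ∷ _ ∷ [] =
      let k<a = ℕₚ.<-trans k<c c<a ; k<d = ℕₚ.<-trans k<a a<d in
      allHigh τ (k<a ∷ ℕₚ.<-trans k<d d<b ∷ k<c ∷ k<d ∷ []) m
    ... | inj₁ a<k ∷ inj₂ k<b ∷ inj₁ c<k ∷ _ ∷ [] =
      descent (⊆-trans (refl ∷ refl ∷ refl ∷ minimum _) τ) c<a a<k k<b
    ... | inj₂ k<a ∷ inj₂ k<b ∷ inj₁ c<k ∷ _ ∷ [] =
      oneLow (_ ∷ _ ∷ []) τ (k<a ∷ k<b ∷ []) c<k (ℕₚ.<-trans k<a a<d ∷ []) (ℕₚ.≤-<-trans z≤n k<a , a<d , d<b)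
    split : ∀ {k u a b c d} → All (λ x → x < k ⊎ k < x) u →
      (a ∷ b ∷ c ∷ d ∷ []) ⊆ u ⊎ ((a ∷ b ∷ c ∷ []) ⊆ u × d ≡ k) → R a b c d → Shape Match k u
    split all (inj₁ τ) m = inside all τ m
    split all (inj₂ (τ , refl)) (c<a , a<k , k<b) = descent τ c<a a<k k<b
    far⁻ : ∀ {k u a b c d} → Avoid (snoc k u) → (a ∷ b ∷ c ∷ d ∷ []) ⊆ u ++ k ∷ 0 ∷ [] → R a b c d → ⊥
    far⁻ {k} {u} {a} {b} {c} {d} av τ m
      with ⊆-snoc {a} {b} {c} {d} {0} (u ++ k ∷ []) (subst ((a ∷ b ∷ c ∷ d ∷ []) ⊆_) (sym (++-assoc u (k ∷ []) (0 ∷ []))) τ)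
    ... | inj₁ τ' = av (_ , τ' , m)
    far⁻ av τ (_ , () , _) | inj₂ (_ , refl)

-- Duplicate-free lists and permutations of intervals.

module Lists where

  open import Data.Nat using (ℕ; zero; suc; _+_; _<_; _≤_; z≤n; s≤s)
  import Data.Nat.Properties as ℕₚ
  open import Data.List using (List; []; _∷_; _++_; map; concatMap; length)
  open import Data.List.Relation.Unary.All as All using (All; []; _∷_)
  import Data.List.Relation.Unary.All.Properties as Allₚ
  open import Data.List.Relation.Unary.AllPairs using ([]; _∷_)
  open import Data.List.Relation.Unary.Any using (here; there)
  open import Data.List.Membership.Propositional using (_∈_; find)
  open import Data.List.Membership.Propositional.Properties using (∈-++⁻; ∈-concatMap⁻; ∈-∃++)
  open import Data.List.Membership.Propositional.Properties.WithK using (unique∧set⇒bag)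
  open import Data.List.Relation.Binary.BagAndSetEquality using (∼bag⇒↭)
  open import Data.List.Relation.Unary.Unique.Propositional using (Unique)
  open import Data.List.Relation.Unary.Unique.Propositional.Properties using (++⁺)
  open import Data.List.Relation.Binary.Permutation.Propositional using (_↭_; ↭-sym; ↭-refl; ↭-trans; ↭-prep)
  open import Data.List.Relation.Binary.Permutation.Propositional.Properties using (↭-length; All-resp-↭; ∈-resp-↭; drop-∷; shift; ↭-empty-inv; ++⁺ʳ)
  open import Data.Product using (∃₂; _×_; _,_)
  open import Data.Sum using (inj₁; inj₂)
  open import Data.Empty using (⊥-elim)
  open import Function using (_⇔_; _∘_)
  open import Relation.Binary.PropositionalEquality using (_≡_; refl; sym; trans; cong; subst)
  open Words using (_≼_)

  module _ {A : Set} where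

    unique-length : ∀ {xs ys : List A} → Unique xs → Unique ys → (∀ {z} → z ∈ xs ⇔ z ∈ ys) → length xs ≡ length ys
    unique-length u v s = ↭-length (∼bag⇒↭ (unique∧set⇒bag u v s))

  module _ {A B : Set} where

    unique-map : ∀ (f : A → B) {xs} → (∀ {x y} → x ∈ xs → y ∈ xs → f x ≡ f y → x ≡ y) → Unique xs → Unique (map f xs)
    unique-map f inj [] = []
    unique-map f inj (x∉ ∷ u) =
      Allₚ.map⁺ (All.tabulate (λ y∈ e → All.lookup x∉ y∈ (inj (here refl) (there y∈) e)))
      ∷ unique-map f (λ x∈ y∈ → inj (there x∈) (there y∈)) u

    unique-concatMap : ∀ (f : A → List B) {xs} → Unique xs → (∀ {x} → x ∈ xs → Unique (f x)) →
      (∀ {x y z} → x ∈ xs → y ∈ xs → z ∈ f x → z ∈ f y → x ≡ y) → Unique (concatMap f xs)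
    unique-concatMap f [] _ _ = []
    unique-concatMap f {x ∷ xs} (x∉ ∷ u) uf disj = ++⁺ (uf (here refl)) (unique-concatMap f u (uf ∘ there) (λ x∈ y∈ → disj (there x∈) (there y∈)))
      λ (z∈ , z∈') → let y , y∈ , z∈fy = find (∈-concatMap⁻ f z∈') in All.lookup x∉ y∈ (disj (here refl) (there y∈) z∈ z∈fy)

  range : ℕ → ℕ → List ℕ
  range o zero = []
  range o (suc n) = o ∷ range (suc o) n

  range-++ : ∀ o a b → range o (a + b) ≡ range o a ++ range (o + a) b
  range-++ o zero b = cong (λ k → range k b) (sym (ℕₚ.+-identityʳ o))
  range-++ o (suc a) b = cong (o ∷_) (trans (range-++ (suc o) a b) (cong (λ k → range (suc o) a ++ range k b) (sym (ℕₚ.+-suc o a))))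

  range-≥ : ∀ o n → All (o ≤_) (range o n)
  range-≥ o zero = []
  range-≥ o (suc n) = ℕₚ.≤-refl ∷ All.map ℕₚ.<⇒≤ (range-≥ (suc o) n)

  range-< : ∀ o n → All (_< o + n) (range o n)
  range-< o zero = []
  range-< o (suc n) = ℕₚ.m<m+n o (s≤s z≤n) ∷ subst (λ k → All (_< k) (range (suc o) n)) (sym (ℕₚ.+-suc o n)) (range-< (suc o) n)

  length-range : ∀ o n → length (range o n) ≡ n
  length-range o zero = refl
  length-range o (suc n) = cong suc (length-range (suc o) n)

  unique-range : ∀ o n → Unique (range o n)
  unique-range o zero = []
  unique-range o (suc n) = All.map (λ o<x → λ { refl → ℕₚ.<-irrefl refl o<x }) (range-≥ (suc o) n) ∷ unique-range (suc o) n

  ∈-range⁻ : ∀ {x} o n → x ∈ range o n → ∃₂ λ a b → x ≡ o + a × n ≡ a + suc b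
  ∈-range⁻ o (suc n) (here refl) = 0 , n , sym (ℕₚ.+-identityʳ o) , refl
  ∈-range⁻ o (suc n) (there x∈) with ∈-range⁻ (suc o) n x∈
  ... | a , b , refl , refl = suc a , b , sym (ℕₚ.+-suc o a) , refl

  ∈-range⁺ : ∀ {x} o n → o ≤ x → x < o + n → x ∈ range o n
  ∈-range⁺ o zero o≤x x<o+0 = ⊥-elim (ℕₚ.<⇒≱ (subst (_ <_) (ℕₚ.+-identityʳ o) x<o+0) o≤x)
  ∈-range⁺ {x} o (suc n) o≤x x< with ℕₚ.m≤n⇒m<n∨m≡n o≤x
  ... | inj₁ o<x = there (∈-range⁺ (suc o) n o<x (subst (x <_) (ℕₚ.+-suc o n) x<))
  ... | inj₂ refl = here refl

  ↭range-length : ∀ {w o n} → w ↭ range o n → length w ≡ n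
  ↭range-length {o = o} {n} p = trans (↭-length p) (length-range o n)

  ↭range-≼ : ∀ {xs ys o a b} → xs ↭ range o a → ys ↭ range (o + a) b → xs ≼ ys
  ↭range-≼ {o = o} {a} {b} p q = All.map (λ x< → All.map (λ y≥ → ℕₚ.≤-trans (ℕₚ.<⇒≤ x<) y≥) (All-resp-↭ (↭-sym q) (range-≥ (o + a) b)))
    (All-resp-↭ (↭-sym p) (range-< o a))

  ≼-↭ˡ : ∀ {xs xs' ys} → xs ↭ xs' → xs ≼ ys → xs' ≼ ys
  ≼-↭ˡ = All-resp-↭

  -- The least letter `o` belongs to a nonempty `xs`: if it occurs in `ys`, then the head of `xs` is
  -- at most `o`, hence equal to it. Removing it leaves the interval that starts at `suc o`.
  ↭range-split : ∀ {xs ys} o n → xs ≼ ys → xs ++ ys ↭ range o n →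
    ∃₂ λ a b → n ≡ a + b × xs ↭ range o a × ys ↭ range (o + a) b
  ↭range-split {[]} o n le p = 0 , n , refl , ↭-refl , subst (λ k → _ ↭ range k n) (sym (ℕₚ.+-identityʳ o)) p
  ↭range-split {x ∷ xs} o zero le p with ↭-empty-inv p
  ... | ()
  ↭range-split {x ∷ xs} {ys} o (suc n) le p with ∈-++⁻ (x ∷ xs) (∈-resp-↭ (↭-sym p) (here refl))
  ... | inj₁ o∈ = go o∈
    where
    go : o ∈ x ∷ xs → ∃₂ λ a b → suc n ≡ a + b × x ∷ xs ↭ range o a × ys ↭ range (o + a) b
    go o∈ with ∈-∃++ o∈
    ... | ps , qs , e with subst (_↭ o ∷ ps ++ qs) (sym e) (shift o ps qs)
    ...   | r with ↭range-split (suc o) n (All.tail (≼-↭ˡ r le)) (drop-∷ (↭-trans (++⁺ʳ ys (↭-sym r)) p))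
    ...     | a , b , e' , p₁ , p₂ = suc a , b , cong suc e' , ↭-trans r (↭-prep o p₁) ,
                subst (λ k → ys ↭ range k b) (sym (ℕₚ.+-suc o a)) p₂
  ... | inj₂ o∈ys = go' (ℕₚ.≤-antisym (All.lookup (All.head le) o∈ys) (All.head (All-resp-↭ (↭-sym p) (range-≥ o (suc n)))))
    where
    go' : x ≡ o → ∃₂ λ a b → suc n ≡ a + b × x ∷ xs ↭ range o a × ys ↭ range (o + a) b
    go' refl with ↭range-split (suc o) n (All.tail le) (drop-∷ p)
    ... | a , b , e' , p₁ , p₂ = suc a , b , cong suc e' , ↭-prep o p₁ ,
                subst (λ k → ys ↭ range k b) (sym (ℕₚ.+-suc o a)) p₂

-- The bijection between trees and avoiders.

module Coding where

  open Words
  open Patterns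
  open Lists
  open Trees using (Tree; leaf; node; size; sizes; act; label; tuples; trees; nodes; treesOfSize)
  open import Data.Nat using (ℕ; zero; suc; _+_; _<_; _≤_; z≤n; s≤s; _≟_)
  import Data.Nat.Properties as ℕₚ
  open import Data.List using (List; []; _∷_; _++_; map; concat; length; filter)
  open import Data.List.Properties using (filter-accept; filter-reject; filter-all; filter-none; filter-++; length-map; ∷-injectiveˡ; ∷-injectiveʳ; ++-identityʳ; ++-assoc)
  open import Data.List.Relation.Unary.All as All using (All; []; _∷_)
  import Data.List.Relation.Unary.All.Properties as Allₚ
  open import Data.List.Relation.Unary.AllPairs using ([]; _∷_)
  open import Data.List.Relation.Unary.Any using (here; there)
  open import Data.List.Membership.Propositional using (_∈_; find; lose)
  open import Data.List.Membership.Propositional.Properties using (∈-map⁺; ∈-map⁻; ∈-concatMap⁺; ∈-concatMap⁻; ∈-filter⁺; ∈-filter⁻)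
  open import Data.List.Relation.Unary.Unique.Propositional using (Unique)
  import Data.List.Relation.Unary.Unique.Propositional.Properties as Uniqueₚ
  open import Data.List.Relation.Binary.Pointwise using (Pointwise; []; _∷_)
  open import Data.List.Relation.Binary.Permutation.Propositional using (_↭_; ↭-sym; ↭-refl; ↭-trans; ↭-reflexive; ↭-prep; module PermutationReasoning)
  open import Data.List.Relation.Binary.Permutation.Propositional.Properties using (All-resp-↭; ∈-resp-↭; drop-mid; shift; filter-↭; ¬x∷xs↭[]; ++⁺; ++⁺ˡ)
  open import Data.Product using (_×_; _,_; proj₁; proj₂)
  open import Data.Sum using (_⊎_; inj₁; inj₂)
  open import Data.Unit using (tt)
  open import Data.Empty using (⊥-elim)
  open import Function using (_⇔_; mk⇔; Equivalence; _∘_)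
  open import Relation.Nullary using (¬_; yes; no)
  open import Relation.Binary.PropositionalEquality using (_≡_; _≢_; refl; sym; trans; cong; cong₂; subst)

  ∈-tuples⁺ : ∀ {ts Bs} → All (_∈ ts) Bs → Bs ∈ tuples (length Bs) ts
  ∈-tuples⁺ [] = here refl
  ∈-tuples⁺ {ts} {B ∷ Bs} (B∈ ∷ Bs∈) = ∈-concatMap⁺ (λ B → map (B ∷_) (tuples (length Bs) ts)) (lose B∈ (∈-map⁺ (B ∷_) (∈-tuples⁺ Bs∈)))

  ∈-tuples⁻ : ∀ m {ts Bs} → Bs ∈ tuples m ts → All (_∈ ts) Bs × length Bs ≡ m
  ∈-tuples⁻ zero (here refl) = [] , refl
  ∈-tuples⁻ (suc m) {ts} Bs∈ with find (∈-concatMap⁻ (λ B → map (B ∷_) (tuples m ts)) {xs = ts} Bs∈)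
  ... | B , B∈ , q with ∈-map⁻ (B ∷_) q
  ...   | Cs , Cs∈ , refl with ∈-tuples⁻ m Cs∈
  ...     | all , e = B∈ ∷ all , cong suc e

  unique-tuples : ∀ m {ts} → Unique ts → Unique (tuples m ts)
  unique-tuples zero u = [] ∷ []
  unique-tuples (suc m) {ts} u = unique-concatMap (λ B → map (B ∷_) (tuples m ts)) u
    (λ {B} _ → Uniqueₚ.map⁺ ∷-injectiveʳ (unique-tuples m u))
    (λ {B} {C} _ _ p q → let _ , _ , e = ∈-map⁻ (B ∷_) p ; _ , _ , e' = ∈-map⁻ (C ∷_) q in ∷-injectiveˡ (trans (sym e) e'))

  ∈-trees⁺ : ∀ {f L Bs} → L ∈ trees f → All (_∈ trees f) Bs → length Bs ≡ act L → node L Bs ∈ trees (suc f)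
  ∈-trees⁺ {f} {L} {Bs} L∈ Bs∈ e = there (∈-concatMap⁺ (λ L → map (node L) (tuples (act L) (trees f)))
    (lose L∈ (∈-map⁺ (node L) (subst (λ m → Bs ∈ tuples m (trees f)) e (∈-tuples⁺ Bs∈)))))

  data WF : Tree → Set where
    wf-leaf : WF leaf
    wf-node : ∀ {L Bs} → WF L → All WF Bs → length Bs ≡ act L → WF (node L Bs)

  trees-WF : ∀ f {T} → T ∈ trees f → WF T
  trees-WF f (here refl) = wf-leaf
  trees-WF (suc f) (there T∈) with find (∈-concatMap⁻ (λ L → map (node L) (tuples (act L) (trees f))) {xs = trees f} T∈)
  ... | L , L∈ , q with ∈-map⁻ (node L) q
  ...   | Bs , Bs∈ , refl with ∈-tuples⁻ (act L) Bs∈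
  ...     | all , e = wf-node (trees-WF f L∈) (All.map (trees-WF f) all) e

  node-injective : ∀ {L L' Bs Bs'} → node L Bs ≡ node L' Bs' → L ≡ L' × Bs ≡ Bs'
  node-injective refl = refl , refl

  unique-trees : ∀ f → Unique (trees f)
  leaf≢ : ∀ f → All (leaf ≢_) (nodes f)
  leaf≢ zero = []
  leaf≢ (suc f) = Allₚ.concat⁺ (Allₚ.map⁺ (All.universal (λ L → Allₚ.map⁺ (All.universal (λ _ ()) (tuples (act L) (trees f)))) (trees f)))
  unique-trees zero = [] ∷ []
  unique-trees (suc f) = leaf≢ (suc f) ∷ unique-concatMap (λ L → map (node L) (tuples (act L) (trees f))) (unique-trees f)
    (λ {L} _ → Uniqueₚ.map⁺ (proj₂ ∘ node-injective) (unique-tuples (act L) (unique-trees f)))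
    (λ {L} {L'} _ _ p q → let _ , _ , e = ∈-map⁻ (node L) p ; _ , _ , e' = ∈-map⁻ (node L') q in proj₁ (node-injective (trans (sym e) e')))

  length-inserts : ∀ e h → length (inserts e h) ≡ suc (length h)
  length-inserts e [] = refl
  length-inserts e (x ∷ h) = cong suc (trans (length-map (x ∷_) (inserts e h)) (length-inserts e h))

  to-woven : ∀ {k h Bs} → length Bs ≡ suc (length h) → All (k <_) h → All (All (_< k)) Bs → Woven k h Bs
  to-woven {Bs = B ∷ []} _ [] (b ∷ []) = last b
  to-woven {Bs = B ∷ Bs} e (k<x ∷ hi) (b ∷ bs) = more b k<x (to-woven (ℕₚ.suc-injective e) hi bs)

  weave-↭ : ∀ {k h Bs} → Woven k h Bs → weave h Bs ↭ concat Bs ++ h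
  weave-↭ {Bs = B ∷ []} (last _) = ↭-reflexive (sym (trans (++-identityʳ (B ++ [])) (++-identityʳ B)))
  weave-↭ {h = x ∷ h} {B ∷ Bs} (more _ _ v) = begin
    B ++ x ∷ weave h Bs ↭⟨ ++⁺ˡ B (↭-prep x (weave-↭ v)) ⟩
    B ++ x ∷ (concat Bs ++ h) ↭⟨ ++⁺ˡ B (↭-sym (shift x (concat Bs) h)) ⟩
    B ++ concat Bs ++ x ∷ h ≡⟨ sym (++-assoc B (concat Bs) (x ∷ h)) ⟩
    (B ++ concat Bs) ++ x ∷ h ∎
    where
    open PermutationReasoning

  module Code {p : Pattern} (pl : Placement p) where
    open Pattern p
    open Placement pl

    actives : List (List ℕ) → ℕ
    actives is = length (filter avoid? is)

    -- Active sites receive the blocks in order and inactive ones stay empty. Running out of blocks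
    -- is a default case, excluded once there are `actives is` blocks.
    spread : List (List ℕ) → List (List ℕ) → List (List ℕ)
    spread [] Bs = []
    spread (i ∷ is) Bs with avoid? i
    spread (i ∷ is) Bs | no _ = [] ∷ spread is Bs
    spread (i ∷ is) [] | yes _ = [] ∷ spread is []
    spread (i ∷ is) (B ∷ Bs) | yes _ = B ∷ spread is Bs

    build : ℕ → List ℕ → List (List ℕ) → List ℕ
    build k h Bs = place k (weave h (spread (inserts 0 h) Bs))

    -- The letters of a tree form the interval that starts at `o`: the blocks in order, then the
    -- removed letter, then `L`. Carrying the offset spares renumbering the subwords.
    word : ℕ → Tree → List ℕ
    words : ℕ → List Tree → List (List ℕ)
    word o leaf = []
    word o (node L Bs) = build (o + sizes Bs) (word (suc (o + sizes Bs)) L) (words o Bs)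
    words o [] = []
    words o (B ∷ Bs) = word o B ∷ words (o + size B) Bs

    length-words : ∀ o Bs → length (words o Bs) ≡ length Bs
    length-words o [] = refl
    length-words o (B ∷ Bs) = cong suc (length-words (o + size B) Bs)

    length-spread : ∀ is Bs → length (spread is Bs) ≡ length is
    length-spread [] Bs = refl
    length-spread (i ∷ is) Bs with avoid? i
    length-spread (i ∷ is) Bs | no _ = cong suc (length-spread is Bs)
    length-spread (i ∷ is) [] | yes _ = cong suc (length-spread is [])
    length-spread (i ∷ is) (B ∷ Bs) | yes _ = cong suc (length-spread is Bs)

    actives-accept : ∀ {i} is → Avoid i → actives (i ∷ is) ≡ suc (actives is)
    actives-accept {i} is a = cong length (filter-accept avoid? {i} {is} a)

    actives-reject : ∀ {i} is → ¬ Avoid i → actives (i ∷ is) ≡ actives is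
    actives-reject {i} is a = cong length (filter-reject avoid? {i} {is} a)

    concat-spread : ∀ is Bs → length Bs ≡ actives is → concat (spread is Bs) ≡ concat Bs
    concat-spread [] [] _ = refl
    concat-spread (i ∷ is) Bs e with avoid? i
    concat-spread (i ∷ is) Bs e | no ¬a = concat-spread is Bs e
    concat-spread (i ∷ is) (B ∷ Bs) e | yes a = cong (B ++_) (concat-spread is Bs (ℕₚ.suc-injective e))

    spread-All : ∀ {P : List ℕ → Set} is Bs → P [] → All P Bs → All P (spread is Bs)
    spread-All [] Bs p[] ps = []
    spread-All (i ∷ is) Bs p[] ps with avoid? i
    spread-All (i ∷ is) Bs p[] ps | no _ = p[] ∷ spread-All is Bs p[] ps
    spread-All (i ∷ is) [] p[] ps | yes _ = p[] ∷ spread-All is [] p[] ps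
    spread-All (i ∷ is) (B ∷ Bs) p[] (q ∷ ps) | yes _ = q ∷ spread-All is Bs p[] ps

    spread-active : ∀ is Bs → Pointwise Active is (spread is Bs)
    spread-active [] Bs = []
    spread-active (i ∷ is) Bs with avoid? i
    spread-active (i ∷ is) Bs | no _ = inj₁ refl ∷ spread-active is Bs
    spread-active (i ∷ is) [] | yes _ = inj₁ refl ∷ spread-active is []
    spread-active (i ∷ is) (B ∷ Bs) | yes a = inj₂ a ∷ spread-active is Bs

    spread-stacked : ∀ is Bs → length Bs ≡ actives is → Stacked Bs → Stacked (spread is Bs)
    spread-stacked [] Bs _ _ = tt
    spread-stacked (i ∷ is) Bs e st with avoid? i
    spread-stacked (i ∷ is) Bs e st | no _ = [] , spread-stacked is Bs e st
    spread-stacked (i ∷ is) (B ∷ Bs) e (le , st) | yes a =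
      subst (B ≼_) (sym (concat-spread is Bs (ℕₚ.suc-injective e))) le , spread-stacked is Bs (ℕₚ.suc-injective e) st

    spread-injective : ∀ is {Bs Cs} → length Bs ≡ actives is → length Cs ≡ actives is → spread is Bs ≡ spread is Cs → Bs ≡ Cs
    spread-injective [] {[]} {[]} _ _ _ = refl
    spread-injective (i ∷ is) {Bs} {Cs} e e' eq with avoid? i
    spread-injective (i ∷ is) {Bs} {Cs} e e' eq | no _ = spread-injective is e e' (∷-injectiveʳ eq)
    spread-injective (i ∷ is) {B ∷ Bs} {C ∷ Cs} e e' eq | yes _ =
      cong₂ _∷_ (∷-injectiveˡ eq) (spread-injective is (ℕₚ.suc-injective e) (ℕₚ.suc-injective e') (∷-injectiveʳ eq))

    -- `siteCount` has to be part of the induction: it makes the `act L` blocks of a node match the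
    -- active sites of the word of `L`.
    record Sound (o : ℕ) (T : Tree) : Set where
      constructor sound
      field
        perm : word o T ↭ range o (size T)
        avoiding : Avoid (word o T)
        siteCount : sites (word o T) ≡ act T

    data Sounds : ℕ → List Tree → Set where
      [] : ∀ {o} → Sounds o []
      _∷_ : ∀ {o B Bs} → Sound o B → Sounds (o + size B) Bs → Sounds o (B ∷ Bs)

    sounds-avoiding : ∀ {o Bs} → Sounds o Bs → All Avoid (words o Bs)
    sounds-avoiding [] = []
    sounds-avoiding (s ∷ ss) = Sound.avoiding s ∷ sounds-avoiding ss

    sounds-perm : ∀ {o Bs} → Sounds o Bs → concat (words o Bs) ↭ range o (sizes Bs)
    sounds-perm [] = ↭-refl
    sounds-perm {o} {B ∷ Bs} (s ∷ ss) = ↭-trans (++⁺ (Sound.perm s) (sounds-perm ss)) (↭-reflexive (sym (range-++ o (size B) (sizes Bs))))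

    sounds-stacked : ∀ {o Bs} → Sounds o Bs → Stacked (words o Bs)
    sounds-stacked [] = tt
    sounds-stacked (s ∷ ss) = ↭range-≼ (Sound.perm s) (sounds-perm ss) , sounds-stacked ss

    word-nonempty : ∀ o L Bs → word o (node L Bs) ≢ []
    word-nonempty o L Bs e = ¬x∷xs↭[] (↭-trans (↭-sym (place-↭ k u)) (↭-reflexive e))
      where
      k : ℕ
      k = o + sizes Bs
      u : List ℕ
      u = weave (word (suc k) L) (spread (inserts 0 (word (suc k) L)) (words o Bs))

    if-empty-≢[] : ∀ {B} n → B ≢ [] → if-empty B n ≡ 0
    if-empty-≢[] {[]} n ne = ⊥-elim (ne refl)
    if-empty-≢[] {_ ∷ _} n ne = refl

    -- Both sides pass over empty blocks, counting one site for each, and stop at the first nonempty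
    -- block with its own number of sites; the inactive sites in between add nothing.
    blockSites-label : ∀ is {o Bs} → Sounds o Bs → length Bs ≡ actives is → blockSites is (spread is (words o Bs)) ≡ label Bs
    blockSites-label [] {Bs = []} [] _ = refl
    blockSites-label (i ∷ is) ss e with avoid? i in eq
    blockSites-label (i ∷ is) ss e | no _ rewrite eq = blockSites-label is ss e
    blockSites-label (i ∷ is) {o} {leaf ∷ Bs} (s ∷ ss) e | yes a rewrite eq =
      cong₂ _+_ sites-[] (blockSites-label is ss (ℕₚ.suc-injective e))
    blockSites-label (i ∷ is) {o} {node L Cs ∷ Bs} (s ∷ ss) e | yes a rewrite eq =
      trans (cong (sites (word o (node L Cs)) +_) (if-empty-≢[] _ (word-nonempty o L Cs)))
        (trans (ℕₚ.+-identityʳ _) (Sound.siteCount s))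

    range-node : ∀ o a b → range o (suc (b + a)) ≡ range o a ++ (o + a) ∷ range (suc (o + a)) b
    range-node o a b = trans (cong (range o) (trans (cong suc (ℕₚ.+-comm b a)) (sym (ℕₚ.+-suc a b)))) (range-++ o a (suc b))

    module _ {o L Bs} (1≤o : 1 ≤ o) (sL : Sound (suc (o + sizes Bs)) L) (sBs : Sounds o Bs) (e : length Bs ≡ act L) where
      private
        k : ℕ
        k = o + sizes Bs
        h : List ℕ
        h = word (suc k) L
        is : List (List ℕ)
        is = inserts 0 h

      node-length : length (words o Bs) ≡ actives is
      node-length = trans (length-words o Bs) (trans e (sym (Sound.siteCount sL)))

      private
        concat-perm : concat (spread is (words o Bs)) ↭ range o (sizes Bs)
        concat-perm = subst (_↭ _) (sym (concat-spread is (words o Bs) node-length)) (sounds-perm sBs)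

      node-woven : Woven k h (spread is (words o Bs))
      node-woven = to-woven (trans (length-spread is (words o Bs)) (length-inserts 0 h))
        (All-resp-↭ (↭-sym (Sound.perm sL)) (range-≥ (suc k) (size L)))
        (Allₚ.concat⁻ (All-resp-↭ (↭-sym concat-perm) (range-< o (sizes Bs))))

      private
        adm : Admissible is (spread is (words o Bs))
        adm = admissible (spread-active is (words o Bs))
          (spread-All is (words o Bs) avoid-[] (sounds-avoiding sBs))
          (spread-stacked is (words o Bs) node-length (sounds-stacked sBs))

      node-sound : Sound o (node L Bs)
      node-sound = sound
        (begin
          build k h (words o Bs) ↭⟨ place-↭ k _ ⟩
          k ∷ weave h (spread is (words o Bs)) ↭⟨ ↭-prep k (weave-↭ node-woven) ⟩
          k ∷ (concat (spread is (words o Bs)) ++ h) ↭⟨ ↭-prep k (++⁺ concat-perm (Sound.perm sL)) ⟩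
          k ∷ (range o (sizes Bs) ++ range (suc k) (size L)) ↭⟨ ↭-sym (shift k (range o (sizes Bs)) _) ⟩
          range o (sizes Bs) ++ k ∷ range (suc k) (size L) ≡⟨ sym (range-node o (sizes Bs) (size L)) ⟩
          range o (size (node L Bs)) ∎)
        (place-avoids node-woven (Sound.avoiding sL) adm)
        -- `1≤o` keeps every letter above the inserted 0.
        (trans (sites-place (ℕₚ.≤-trans 1≤o (ℕₚ.m≤m+n o (sizes Bs))) node-woven
            (Allₚ.concat⁻ (All-resp-↭ (↭-sym concat-perm) (All.map (ℕₚ.≤-trans 1≤o) (range-≥ o (sizes Bs)))))
            (Sound.avoiding sL) adm)
          (cong suc (blockSites-label is sBs (trans (sym (length-words o Bs)) node-length))))
        where open PermutationReasoning

    soundness : ∀ {o T} → 1 ≤ o → WF T → Sound o T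
    soundnesses : ∀ {o Bs} → 1 ≤ o → All WF Bs → Sounds o Bs
    soundness 1≤o wf-leaf = sound ↭-refl avoid-[] sites-[]
    soundness 1≤o (wf-node wL wBs e) = node-sound 1≤o (soundness (s≤s z≤n) wL) (soundnesses 1≤o wBs) e
    soundnesses 1≤o [] = []
    soundnesses 1≤o (w ∷ ws) = soundness 1≤o w ∷ soundnesses (ℕₚ.≤-trans 1≤o (ℕₚ.m≤m+n _ _)) ws

    woven-injective : ∀ {k k' h h' Bs Bs'} → Woven k h Bs → Woven k' h' Bs' → place k (weave h Bs) ≡ place k' (weave h' Bs') →
      k ≡ k' × h ≡ h' × Bs ≡ Bs'
    woven-injective {k} v v' e with place-injective e
    ... | refl , eu = refl , trans (sym (filter-hi v)) (trans (cong (filter (hi? {k})) eu) (filter-hi v'))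
                    , trans (sym (cut-weave v)) (trans (cong (cut k) eu) (cut-weave v'))

    word-injective : ∀ {o T T'} → 1 ≤ o → WF T → WF T' → word o T ≡ word o T' → T ≡ T'
    words-injective : ∀ {o Bs Bs'} → 1 ≤ o → All WF Bs → All WF Bs' → words o Bs ≡ words o Bs' → Bs ≡ Bs'
    word-injective 1≤o wf-leaf wf-leaf _ = refl
    word-injective {o} 1≤o wf-leaf (wf-node {L} {Bs} _ _ _) e = ⊥-elim (word-nonempty o L Bs (sym e))
    word-injective {o} 1≤o (wf-node {L} {Bs} _ _ _) wf-leaf e = ⊥-elim (word-nonempty o L Bs e)
    word-injective {o} 1≤o (wf-node {L} {Bs} wL wBs e) (wf-node {L'} {Bs'} wL' wBs' e') eq
      with woven-injective (node-woven 1≤o (soundness (s≤s z≤n) wL) (soundnesses 1≤o wBs) e)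
                           (node-woven 1≤o (soundness (s≤s z≤n) wL') (soundnesses 1≤o wBs') e') eq
    ... | ek , eh , es = cong₂ node
      (word-injective (s≤s z≤n) wL wL' (trans eh (cong (λ k → word (suc k) L') (sym ek))))
      (words-injective 1≤o wBs wBs' (spread-injective (inserts 0 (word (suc (o + sizes Bs)) L))
        (node-length 1≤o (soundness (s≤s z≤n) wL) (soundnesses 1≤o wBs) e)
        (trans (node-length 1≤o (soundness (s≤s z≤n) wL') (soundnesses 1≤o wBs') e') (cong (actives ∘ inserts 0) (sym eh)))
        (trans es (cong (λ h → spread (inserts 0 h) (words o Bs')) (sym eh)))))
    words-injective 1≤o [] [] _ = refl
    words-injective {o} 1≤o (w ∷ ws) (w' ∷ ws') eq with word-injective 1≤o w w' (∷-injectiveˡ eq)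
    ... | refl = cong (_ ∷_) (words-injective (ℕₚ.≤-trans 1≤o (ℕₚ.m≤m+n _ _)) ws ws' (∷-injectiveʳ eq))

    record Decoded (f o n : ℕ) (w : List ℕ) : Set where
      constructor decoded
      field
        tree : Tree
        tree∈ : tree ∈ trees f
        word≡ : word o tree ≡ w
        size≡ : size tree ≡ n

    record DecodedBlocks (f o n : ℕ) (is Bs : List (List ℕ)) : Set where
      constructor decodedBlocks
      field
        forest : List Tree
        forest∈ : All (_∈ trees f) forest
        length≡ : length forest ≡ actives is
        spread≡ : spread is (words o forest) ≡ Bs
        sizes≡ : sizes forest ≡ n

    -- Inverts `word`: with `k` removed, the letters above `k` form `h` and the runs below it the
    -- blocks, and `place-avoids⁻` hands avoidance and admissibility down. `f` is at once the height
    -- bound and the recursion measure.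
    decode : ∀ f {o n w} → 1 ≤ o → n ≤ f → w ↭ range o n → Avoid w → Decoded f o n w
    decodeBlocks : ∀ f {o n} is {Bs} → 1 ≤ o → n ≤ f → concat Bs ↭ range o n → Admissible is Bs → DecodedBlocks f o n is Bs

    decode f {o} {n} {[]} 1≤o n≤f p a = decoded leaf (here refl) refl (↭range-length {o = o} {n} p)
    decode zero {n = zero} {x ∷ w} 1≤o z≤n p a = ⊥-elim (¬x∷xs↭[] p)
    decode (suc f) {o} {n} {x ∷ w} 1≤o n≤f p a with unplace x w
    ... | k , u , refl' with subst (_↭ range o n) refl' p | subst Avoid refl' a
    ...   | p' | a' with ∈-range⁻ o n (∈-resp-↭ (↭-trans (↭-sym (place-↭ k u)) p') (here refl))
    -- The forest has one tree for each active site of `h`, and `siteCount` of `L` says that there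
    -- are `act L` of them.
    ...     | lo , hi , refl , refl = decoded (node L Bs) (∈-trees⁺ {f} L∈ Bs∈ (trans lenBs (trans (cong sites (sym wL)) (Sound.siteCount (soundness (s≤s z≤n) (trees-WF f L∈))))))
               (trans word-node (sym refl'))
               (trans (cong₂ (λ s t → suc (s + t)) szL szBs) (trans (cong suc (ℕₚ.+-comm hi lo)) (sym (ℕₚ.+-suc lo hi))))
      where
      k₀ : ℕ
      k₀ = o + lo
      u↭ : u ↭ range o lo ++ range (suc k₀) hi
      u↭ = drop-mid [] (range o lo) (↭-trans (↭-sym (place-↭ k₀ u)) (↭-trans p' (↭-reflexive (range-++ o lo (suc hi)))))
      lohi : All (λ x → x < k₀ ⊎ k₀ < x) u
      lohi = All-resp-↭ (↭-sym u↭) (Allₚ.++⁺ (All.map inj₁ (range-< o lo)) (All.map inj₂ (range-≥ (suc k₀) hi)))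
      h : List ℕ
      h = filter (hi? {k₀}) u
      C : List (List ℕ)
      C = cut k₀ u
      v : Woven k₀ h C
      v = proj₁ (woven-cut lohi)
      weave≡u : weave h C ≡ u
      weave≡u = proj₂ (woven-cut lohi)
      h↭ : h ↭ range (suc k₀) hi
      h↭ = ↭-trans (filter-↭ hi? u↭) (↭-reflexive (trans (filter-++ hi? (range o lo) _)
        (cong₂ _++_ (filter-none hi? (All.map ℕₚ.<-asym (range-< o lo))) (filter-all hi? (range-≥ (suc k₀) hi)))))
      C↭ : concat C ↭ range o lo
      C↭ = ↭-trans (↭-reflexive (trans (sym (filter-lo v)) (cong (filter lo?) weave≡u)))
        (↭-trans (filter-↭ lo? u↭) (↭-reflexive (trans (filter-++ lo? (range o lo) _)
          (trans (cong₂ _++_ (filter-all lo? (range-< o lo)) (filter-none lo? (All.map ℕₚ.<-asym (range-≥ (suc k₀) hi)))) (++-identityʳ _)))))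
      split : Avoid h × Admissible (inserts 0 h) C
      split = place-avoids⁻ v (subst (λ u → Avoid (place k₀ u)) (sym weave≡u) a')
      lo≤f : lo ≤ f
      lo≤f = ℕₚ.≤-trans (ℕₚ.m≤m+n lo hi) (ℕₚ.≤-pred (subst (_≤ suc f) (ℕₚ.+-suc lo hi) n≤f))
      hi≤f : hi ≤ f
      hi≤f = ℕₚ.≤-trans (ℕₚ.m≤n+m hi lo) (ℕₚ.≤-pred (subst (_≤ suc f) (ℕₚ.+-suc lo hi) n≤f))
      open Decoded (decode f {suc k₀} {hi} {h} (s≤s z≤n) hi≤f h↭ (proj₁ split)) renaming (tree to L; tree∈ to L∈; word≡ to wL; size≡ to szL)
      open DecodedBlocks (decodeBlocks f {o} {lo} (inserts 0 h) {C} 1≤o lo≤f C↭ (proj₂ split))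
        renaming (forest to Bs; forest∈ to Bs∈; length≡ to lenBs; spread≡ to spBs; sizes≡ to szBs)
      word-node : word o (node L Bs) ≡ place k₀ u
      word-node = trans (cong (λ s → build (o + s) (word (suc (o + s)) L) (words o Bs)) szBs)
        (trans (cong (λ h → build k₀ h (words o Bs)) wL) (cong (place k₀) (trans (cong (weave h) spBs) weave≡u)))

    decodeBlocks f {o} {zero} [] {[]} 1≤o n≤f p _ = decodedBlocks [] [] refl refl refl
    decodeBlocks f {o} {suc n} [] {[]} 1≤o n≤f p _ = ⊥-elim (¬x∷xs↭[] (↭-sym p))
    decodeBlocks f {o} {n} (i ∷ is) {B ∷ Bs} 1≤o n≤f p adm@(admissible (act ∷ _) (aB ∷ _) (le , _)) with avoid? i in eq
    ... | no ¬a with act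
    ...   | inj₂ a = ⊥-elim (¬a a)
    ...   | inj₁ refl with decodeBlocks f is 1≤o n≤f p (admissible-tail adm)
    ...     | decodedBlocks Ts Ts∈ len sp sz = decodedBlocks Ts Ts∈ (trans len (sym (actives-reject is ¬a))) sp' sz
      where
      sp' : spread (i ∷ is) (words o Ts) ≡ [] ∷ Bs
      sp' rewrite eq = cong ([] ∷_) sp
    decodeBlocks f {o} {n} (i ∷ is) {B ∷ Bs} 1≤o n≤f p adm@(admissible (act ∷ _) (aB ∷ _) (le , _)) | yes a
      -- Stacked blocks that together fill an interval fill consecutive intervals; this fixes the
      -- offset and size of each tree.
      with ↭range-split o n le p
    ... | m , m' , refl , pB , pBs with decode f 1≤o (ℕₚ.≤-trans (ℕₚ.m≤m+n m m') n≤f) pB aB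
    ...   | decoded T T∈ wT refl with decodeBlocks f is (ℕₚ.≤-trans 1≤o (ℕₚ.m≤m+n o m)) (ℕₚ.≤-trans (ℕₚ.m≤n+m m' m) n≤f) pBs (admissible-tail adm)
    ...     | decodedBlocks Ts Ts∈ len sp refl = decodedBlocks (T ∷ Ts) (T∈ ∷ Ts∈) (trans (cong suc len) (sym (actives-accept is a))) sp' refl
      where
      sp' : spread (i ∷ is) (words o (T ∷ Ts)) ≡ B ∷ Bs
      sp' rewrite eq = cong₂ _∷_ wT sp

    count-avoiders : ∀ {n ws} → Unique ws → (∀ {w} → w ∈ ws ⇔ (w ↭ range 1 n × Avoid w)) → length ws ≡ length (treesOfSize n)
    count-avoiders {n} {ws} uws spec = sym (trans (sym (length-map (word 1) (treesOfSize n)))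
      (unique-length (unique-map (word 1) (λ T∈ T'∈ → word-injective (s≤s z≤n) (wf T∈) (wf T'∈))
          (Uniqueₚ.filter⁺ (λ T → size T ≟ n) (unique-trees n))) uws
        (mk⇔ to from)))
      where
      mem : ∀ {T} → T ∈ treesOfSize n → T ∈ trees n × size T ≡ n
      mem T∈ = ∈-filter⁻ (λ T → size T ≟ n) T∈
      wf : ∀ {T} → T ∈ treesOfSize n → WF T
      wf T∈ = trees-WF n (proj₁ (mem T∈))
      to : ∀ {w} → w ∈ map (word 1) (treesOfSize n) → w ∈ ws
      to w∈ with ∈-map⁻ (word 1) w∈
      ... | T , T∈ , refl = let s = soundness (s≤s z≤n) (wf T∈) in
        Equivalence.from spec (subst (λ n → word 1 T ↭ range 1 n) (proj₂ (mem T∈)) (Sound.perm s) , Sound.avoiding s)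
      from : ∀ {w} → w ∈ ws → w ∈ map (word 1) (treesOfSize n)
      from w∈ with Equivalence.to spec w∈
      ... | p , a with decode n (s≤s z≤n) ℕₚ.≤-refl p a
      ...   | decoded T T∈ refl sz = ∈-map⁺ (word 1) (∈-filter⁺ (λ T → size T ≟ n) T∈ sz)

-- The enumerated permutations and the Boolean pattern test of the statement.

module Permutations where

  open import Defs
  open import Relation.Binary.PropositionalEquality using (_≡_; _≢_; refl; sym; trans; cong; cong₂; subst; setoid)
  open Words using (All-⊆)
  open Patterns
  open Placements
  open Lists
  open import Data.Bool using (true; false; T; not)
  open import Data.Bool.Properties using (T?; T-∧)
  open import Data.Bool.ListAction using (all)
  open import Data.Nat using (ℕ; zero; suc; _+_; _<_; _≤_; _<ᵇ_; _≡ᵇ_)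
  import Data.Nat.Properties as ℕₚ
  open import Data.List using (List; []; _∷_; _++_; map; length; filter; applyUpTo)
  open import Data.List.Properties using (∷-injectiveˡ; ∷-injectiveʳ; map-applyUpTo)
  open import Data.List.Relation.Unary.All as All using (All; []; _∷_)
  import Data.List.Relation.Unary.All.Properties as Allₚ
  open import Data.List.Relation.Unary.Any as Any using (Any; here; there)
  import Data.List.Relation.Unary.Any.Properties as Anyₚ
  open import Data.List.Relation.Unary.AllPairs using ([]; _∷_)
  open import Data.List.Membership.Propositional using (_∈_; find; lose)
  open import Data.List.Membership.Propositional.Properties using (∈-map⁺; ∈-map⁻; ∈-concatMap⁺; ∈-concatMap⁻; ∈-filter⁺; ∈-filter⁻; ∈-∃++)
  open import Data.List.Relation.Unary.Unique.Propositional using (Unique)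
  import Data.List.Relation.Unary.Unique.Propositional.Properties as Uniqueₚ
  open import Data.List.Relation.Binary.Permutation.Propositional using (_↭_; ↭-sym; ↭-refl; ↭-trans; ↭-prep; ↭⇒↭ₛ)
  open import Data.List.Relation.Binary.Permutation.Propositional.Properties using (↭-length; ∈-resp-↭; shift)
  open import Data.List.Relation.Binary.Permutation.Setoid.Properties (setoid ℕ) using (Unique-resp-↭)
  open import Data.List.Relation.Binary.Sublist.Propositional using (_⊆_; []; _∷_; _∷ʳ_)
  open import Data.Product using (∃; _×_; _,_; proj₁)
  open import Data.Empty using (⊥; ⊥-elim)
  open import Data.Unit using (tt)
  open import Function using (_⇔_; mk⇔; Equivalence; _∘_; id)
  open import Relation.Nullary using (¬_)

  -- Pigeonhole: a word no longer than `xs` has room for the distinct letters of `xs` and for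
  -- nothing else.
  cover-↭ : ∀ {xs w : List ℕ} → Unique xs → All (_∈ w) xs → length w ≤ length xs → w ↭ xs
  cover-↭ {[]} {[]} _ _ _ = ↭-refl
  cover-↭ {x ∷ xs} {w} (x∉ ∷ u) (x∈ ∷ xs∈) len with ∈-∃++ x∈
  ... | ps , qs , refl = ↭-trans (shift x ps qs) (↭-prep x (cover-↭ u (All.tabulate mem)
      (ℕₚ.≤-pred (subst (_≤ suc (length xs)) (↭-length (shift x ps qs)) len))))
    where
    mem : ∀ {y} → y ∈ xs → y ∈ ps ++ qs
    mem {y} y∈ with ∈-resp-↭ (shift x ps qs) (All.lookup xs∈ y∈)
    ... | here refl = ⊥-elim (All.lookup x∉ y∈ refl)
    ... | there p = p

  oneTo≡range : ∀ n → oneTo n ≡ range 1 n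
  oneTo≡range n = trans (map-applyUpTo id suc n) (go suc 1 (λ _ → refl) n)
    where
    go : ∀ (f : ℕ → ℕ) o → (∀ i → f i ≡ o + i) → ∀ n → applyUpTo f n ≡ range o n
    go f o e zero = refl
    go f o e (suc n) = cong₂ _∷_ (trans (e 0) (ℕₚ.+-identityʳ o)) (go (f ∘ suc) (suc o) (λ i → trans (e (suc i)) (ℕₚ.+-suc o i)) n)

  ∈ᵇ⇔∈ : ∀ {x xs} → T (x ∈ᵇ xs) ⇔ x ∈ xs
  ∈ᵇ⇔∈ {x} {xs} = mk⇔ (λ t → Any.map (ℕₚ.≡ᵇ⇒≡ x _) (Anyₚ.any⁻ (x ≡ᵇ_) xs t)) (λ x∈ → Anyₚ.any⁺ (x ≡ᵇ_) (Any.map (ℕₚ.≡⇒≡ᵇ x _) x∈))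

  all∈ᵇ⇔ : ∀ {n w} → T (all (λ i → i ∈ᵇ w) (oneTo n)) ⇔ All (_∈ w) (range 1 n)
  all∈ᵇ⇔ {n} {w} = mk⇔
    (λ t → subst (All (_∈ w)) (oneTo≡range n) (All.map (Equivalence.to ∈ᵇ⇔∈) (Allₚ.all⁺ (_∈ᵇ w) (oneTo n) t)))
    (λ a → Allₚ.all⁻ (_∈ᵇ w) (All.map (Equivalence.from ∈ᵇ⇔∈) (subst (All (_∈ w)) (sym (oneTo≡range n)) a)))

  ∈-words⁻ : ∀ a k {w} → w ∈ words a k → length w ≡ k
  ∈-words⁻ a zero (here refl) = refl
  ∈-words⁻ a (suc k) w∈ with find (∈-concatMap⁻ (λ w → map (λ x → x ∷ w) (oneTo a)) {xs = words a k} w∈)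
  ... | v , v∈ , q with ∈-map⁻ (λ x → x ∷ v) q
  ...   | x , _ , refl = cong suc (∈-words⁻ a k v∈)

  ∈-words⁺ : ∀ a {w} → All (_∈ oneTo a) w → w ∈ words a (length w)
  ∈-words⁺ a [] = here refl
  ∈-words⁺ a {x ∷ w} (x∈ ∷ w∈) = ∈-concatMap⁺ (λ w → map (λ x → x ∷ w) (oneTo a)) (lose (∈-words⁺ a w∈) (∈-map⁺ (_∷ w) x∈))

  unique-words : ∀ a k → Unique (words a k)
  unique-words a zero = [] ∷ []
  unique-words a (suc k) = unique-concatMap (λ w → map (λ x → x ∷ w) (oneTo a)) (unique-words a k)
    (λ {w} _ → Uniqueₚ.map⁺ ∷-injectiveˡ (subst Unique (sym (oneTo≡range a)) (unique-range 1 a)))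
    (λ {v} {w} _ _ p q → let _ , _ , e = ∈-map⁻ (_∷ v) p ; _ , _ , e' = ∈-map⁻ (_∷ w) q in ∷-injectiveʳ (trans (sym e) e'))

  unique-Perms : ∀ n → Unique (Perms n)
  unique-Perms n = Uniqueₚ.filter⁺ (λ w → T? (isPermᵇ n w)) (unique-words n n)

  ∈-Perms : ∀ {n w} → w ∈ Perms n ⇔ (w ↭ range 1 n)
  ∈-Perms {n} {w} = mk⇔ to from
    where
    to : w ∈ Perms n → w ↭ range 1 n
    to w∈ with ∈-filter⁻ (λ w → T? (isPermᵇ n w)) {xs = words n n} w∈
    ... | w∈words , t = cover-↭ (unique-range 1 n) (Equivalence.to all∈ᵇ⇔ t)
            (ℕₚ.≤-reflexive (trans (∈-words⁻ n n w∈words) (sym (length-range 1 n))))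
    from : w ↭ range 1 n → w ∈ Perms n
    from p = ∈-filter⁺ (λ w → T? (isPermᵇ n w))
      (subst (λ k → w ∈ words n k) (↭range-length p)
        (∈-words⁺ n (All.tabulate (λ x∈ → subst (_ ∈_) (sym (oneTo≡range n)) (∈-resp-↭ p x∈)))))
      (Equivalence.from all∈ᵇ⇔ (All.tabulate (∈-resp-↭ (↭-sym p))))

  unique-perm : ∀ {n w} → w ↭ range 1 n → Unique w
  unique-perm {n} p = Unique-resp-↭ (↭⇒↭ₛ (↭-sym p)) (unique-range 1 n)

  unique-⊆ : ∀ {zs w : List ℕ} → zs ⊆ w → Unique w → Unique zs
  unique-⊆ [] [] = []
  unique-⊆ (y ∷ʳ τ) (_ ∷ u) = unique-⊆ τ u
  unique-⊆ (refl ∷ τ) (x∉ ∷ u) = All-⊆ τ x∉ ∷ unique-⊆ τ u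

  -- `orderIsoᵇ` compares by `<` alone, and a failed comparison means the reverse inequality only
  -- between distinct letters; hence `Unique`.
  record Represents (p : Pattern) (σ : List ℕ) : Set where
    open Pattern p
    field
      length≡4 : length σ ≡ 4
      iso : ∀ {zs} → Unique zs → length zs ≡ 4 → T (orderIsoᵇ zs σ) ⇔ Match zs

    avoidsᵇ⇔ : ∀ {w} → Unique w → T (avoidsᵇ w σ) ⇔ Avoid w
    avoidsᵇ⇔ {w} u = mk⇔ to from
      where
      sub-iso : ∀ {zs} → zs ⊆ w → length zs ≡ 4 → T (orderIsoᵇ zs σ) ⇔ Match zs
      sub-iso τ = iso (unique-⊆ τ u)
      T-not⁻ : ∀ {b} → T (not b) → ¬ T b
      T-not⁻ {false} _ ()
      T-not⁺ : ∀ {b} → ¬ T b → T (not b)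
      T-not⁺ {false} _ = tt
      T-not⁺ {true} ¬t = ⊥-elim (¬t tt)
      to : T (avoidsᵇ w σ) → Avoid w
      to t (zs , τ , m) = T-not⁻ t (Anyₚ.any⁺ (λ s → orderIsoᵇ s σ) (lose
        (subst (λ k → zs ∈ subseqs k w) (trans (Match-length {zs} m) (sym length≡4)) (∈-subseqs⁺ τ))
        (Equivalence.from (sub-iso τ (Match-length {zs} m)) m)))
      from : Avoid w → T (avoidsᵇ w σ)
      from a = T-not⁺ λ t → contra (find (Anyₚ.any⁻ (λ s → orderIsoᵇ s σ) (subseqs (length σ) w) t))
        where
        contra : ∃ (λ zs → zs ∈ subseqs (length σ) w × T (orderIsoᵇ zs σ)) → ⊥
        contra (zs , zs∈ , t) with ∈-subseqs⁻ (length σ) w zs∈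
        ... | τ , e = a (zs , τ , Equivalence.to (sub-iso τ (trans e length≡4)) t)

  asc : ∀ {x y} → T ((x <ᵇ y) ⇔ᵇ true) → x < y
  asc {x} {y} t = ℕₚ.<ᵇ⇒< x y (go t)
    where
    go : ∀ {b} → T (b ⇔ᵇ true) → T b
    go {true} t = t

  desc : ∀ {x y} → x ≢ y → T ((x <ᵇ y) ⇔ᵇ false) → y < x
  desc {x} {y} x≢y t = ℕₚ.≤∧≢⇒< (ℕₚ.≮⇒≥ (λ x<y → go t (ℕₚ.<⇒<ᵇ x<y))) (λ e → x≢y (sym e))
    where
    go : ∀ {b} → T (b ⇔ᵇ false) → ¬ T b
    go {false} _ ()

  asc⁻ : ∀ {x y} → x < y → T ((x <ᵇ y) ⇔ᵇ true)
  asc⁻ {x} {y} p = go (ℕₚ.<⇒<ᵇ p)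
    where
    go : ∀ {b} → T b → T (b ⇔ᵇ true)
    go {true} t = t

  desc⁻ : ∀ {x y} → y < x → T ((x <ᵇ y) ⇔ᵇ false)
  desc⁻ {x} {y} p = go (λ t → ℕₚ.<-asym p (ℕₚ.<ᵇ⇒< x y t))
    where
    go : ∀ {b} → ¬ T b → T (b ⇔ᵇ false)
    go {false} _ = tt
    go {true} ¬t = ¬t tt

  Same : ℕ → ℕ → ℕ → ℕ → Set
  Same a b s t = T ((a <ᵇ b) ⇔ᵇ (s <ᵇ t))

  iso₄ : ∀ a b c d s t u v → T (orderIsoᵇ (a ∷ b ∷ c ∷ d ∷ []) (s ∷ t ∷ u ∷ v ∷ [])) ⇔
    (Same a b s t × Same a c s u × Same a d s v × Same b c t u × Same b d t v × Same c d u v)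
  iso₄ a b c d s t u v = mk⇔
    (λ x → let p , q = to T-∧ x ; ab , p' = to T-∧ p ; ac , p'' = to T-∧ p' ; ad , _ = to T-∧ p''
               r , s = to T-∧ q ; bc , r' = to T-∧ r ; bd , _ = to T-∧ r' ; cd , _ = to T-∧ (proj₁ (to T-∧ s))
           in ab , ac , ad , bc , bd , cd)
    (λ (ab , ac , ad , bc , bd , cd) → from T-∧ (from T-∧ (ab , from T-∧ (ac , from T-∧ (ad , tt))) ,
       from T-∧ (from T-∧ (bc , from T-∧ (bd , tt)) , from T-∧ (from T-∧ (cd , tt) , tt))))
    where open Equivalence

  module _ (p : Pattern) (s t u v : ℕ) where
    open Pattern p

    represents : (∀ {a b c d} → a ≢ b → a ≢ c → a ≢ d → b ≢ c → b ≢ d → c ≢ d →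
        (Same a b s t × Same a c s u × Same a d s v × Same b c t u × Same b d t v × Same c d u v) ⇔ R a b c d) →
      Represents p (s ∷ t ∷ u ∷ v ∷ [])
    represents h = record { length≡4 = refl ; iso = λ { {a ∷ b ∷ c ∷ d ∷ []} ((ab ∷ ac ∷ ad ∷ []) ∷ (bc ∷ bd ∷ []) ∷ (cd ∷ []) ∷ [] ∷ []) _ →
      let e = h ab ac ad bc bd cd in mk⇔ (Equivalence.to e ∘ Equivalence.to (iso₄ a b c d s t u v)) (Equivalence.from (iso₄ a b c d s t u v) ∘ Equivalence.from e) } }

  -- Of the six comparisons, here and for the other patterns, only those between letters of
  -- neighbouring value are read; transitivity restores the rest.
  represents3241 : Represents p3241 (3 ∷ 2 ∷ 4 ∷ 1 ∷ [])
  represents3241 = represents p3241 3 2 4 1 λ ab ac ad bc bd cd → mk⇔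
    (λ (x₁ , x₂ , x₃ , x₄ , x₅ , x₆) → desc bd x₅ , desc ab x₁ , asc x₂)
    (λ (d<b , b<a , a<c) → desc⁻ b<a , asc⁻ a<c , desc⁻ (ℕₚ.<-trans d<b b<a) , asc⁻ (ℕₚ.<-trans b<a a<c) ,
       desc⁻ d<b , desc⁻ (ℕₚ.<-trans d<b (ℕₚ.<-trans b<a a<c)))

  represents4132 : Represents p4132 (4 ∷ 1 ∷ 3 ∷ 2 ∷ [])
  represents4132 = represents p4132 4 1 3 2 λ ab ac ad bc bd cd → mk⇔
    (λ (x₁ , x₂ , x₃ , x₄ , x₅ , x₆) → asc x₅ , desc cd x₆ , desc ac x₂)
    (λ (b<d , d<c , c<a) → desc⁻ (ℕₚ.<-trans b<d (ℕₚ.<-trans d<c c<a)) , desc⁻ c<a , desc⁻ (ℕₚ.<-trans d<c c<a) ,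
       asc⁻ (ℕₚ.<-trans b<d d<c) , asc⁻ b<d , desc⁻ d<c)

  represents4213 : Represents p4213 (4 ∷ 2 ∷ 1 ∷ 3 ∷ [])
  represents4213 = represents p4213 4 2 1 3 λ ab ac ad bc bd cd → mk⇔
    (λ (x₁ , x₂ , x₃ , x₄ , x₅ , x₆) → desc bc x₄ , asc x₅ , desc ad x₃)
    (λ (c<b , b<d , d<a) → desc⁻ (ℕₚ.<-trans b<d d<a) , desc⁻ (ℕₚ.<-trans c<b (ℕₚ.<-trans b<d d<a)) , desc⁻ d<a ,
       desc⁻ c<b , asc⁻ b<d , asc⁻ (ℕₚ.<-trans c<b b<d))

  represents2431 : Represents p2431 (2 ∷ 4 ∷ 3 ∷ 1 ∷ [])
  represents2431 = represents p2431 2 4 3 1 λ ab ac ad bc bd cd → mk⇔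
    (λ (x₁ , x₂ , x₃ , x₄ , x₅ , x₆) → desc ad x₃ , asc x₂ , desc bc x₄)
    (λ (d<a , a<c , c<b) → asc⁻ (ℕₚ.<-trans a<c c<b) , asc⁻ a<c , desc⁻ d<a ,
       desc⁻ c<b , desc⁻ (ℕₚ.<-trans d<a (ℕₚ.<-trans a<c c<b)) , desc⁻ (ℕₚ.<-trans d<a a<c))

  represents2413 : Represents p2413 (2 ∷ 4 ∷ 1 ∷ 3 ∷ [])
  represents2413 = represents p2413 2 4 1 3 λ ab ac ad bc bd cd → mk⇔
    (λ (x₁ , x₂ , x₃ , x₄ , x₅ , x₆) → desc ac x₂ , asc x₃ , desc bd x₅)
    (λ (c<a , a<d , d<b) → asc⁻ (ℕₚ.<-trans a<d d<b) , desc⁻ c<a , asc⁻ a<d ,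
       desc⁻ (ℕₚ.<-trans c<a (ℕₚ.<-trans a<d d<b)) , desc⁻ d<b , asc⁻ (ℕₚ.<-trans c<a a<d))

  represents3142 : Represents p3142 (3 ∷ 1 ∷ 4 ∷ 2 ∷ [])
  represents3142 = represents p3142 3 1 4 2 λ ab ac ad bc bd cd → mk⇔
    (λ (x₁ , x₂ , x₃ , x₄ , x₅ , x₆) → asc x₅ , desc ad x₃ , asc x₂)
    (λ (b<d , d<a , a<c) → desc⁻ (ℕₚ.<-trans b<d d<a) , asc⁻ a<c , desc⁻ d<a ,
       asc⁻ (ℕₚ.<-trans b<d (ℕₚ.<-trans d<a a<c)) , asc⁻ b<d , desc⁻ (ℕₚ.<-trans d<a a<c))

  module Avoiders (p : Pattern) where
    open Pattern p

    avoiders : ℕ → List (List ℕ)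
    avoiders n = filter avoid? (Perms n)

    unique-avoiders : ∀ n → Unique (avoiders n)
    unique-avoiders n = Uniqueₚ.filter⁺ avoid? (unique-Perms n)

    ∈-avoiders : ∀ {n w} → w ∈ avoiders n ⇔ (w ↭ range 1 n × Avoid w)
    ∈-avoiders {n} = mk⇔
      (λ w∈ → let q , a = ∈-filter⁻ avoid? {xs = Perms n} w∈ in Equivalence.to ∈-Perms q , a)
      (λ (q , a) → ∈-filter⁺ avoid? (Equivalence.from ∈-Perms q) a)

-- Splitting a permutation after its first component.

module FirstComponent where

  open import Defs hiding (_⊕_; _·_)
  open Patterns
  open Lists
  open Permutations
  open import Data.Bool using (true; false; T; not; _∧_)
  open import Data.Bool.Properties using (T?; T-∧)
  open import Data.Bool.ListAction using (all)
  open import Data.Nat using (ℕ; zero; suc; _+_; _∸_; _<_; _≤_; z≤n; s≤s; _≤ᵇ_)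
  import Data.Nat.Properties as ℕₚ
  open import Data.Integer using (ℤ) renaming (+_ to pos)
  import Data.Integer as ℤ
  import Data.Integer.Properties as ℤₚ
  open import Data.List using (List; []; _∷_; _++_; map; concatMap; length; filter; upTo; take; drop)
  open import Data.List.Properties using (length-++; length-map; length-take; length-drop; take-take; take++drop≡id; take-all; ++-cancelˡ; map-∘; map-id; map-cong; map-injective)
  open import Data.List.Relation.Unary.All as All using (All; []; _∷_)
  import Data.List.Relation.Unary.All.Properties as Allₚ
  import Data.List.Relation.Unary.Any.Properties as Anyₚ
  open import Data.List.Membership.Propositional using (_∈_; find; lose)
  open import Data.List.Membership.Propositional.Properties using (∈-map⁺; ∈-map⁻; ∈-concatMap⁺; ∈-concatMap⁻; ∈-filter⁺; ∈-filter⁻; ∈-++⁻; ∈-upTo⁺; ∈-upTo⁻)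
  open import Data.List.Relation.Unary.Unique.Propositional using (Unique; []; _∷_)
  import Data.List.Relation.Unary.Unique.Propositional.Properties as Uniqueₚ
  open import Data.List.Relation.Binary.Permutation.Propositional using (_↭_; ↭-sym; ↭-trans; ↭-reflexive)
  open import Data.List.Relation.Binary.Permutation.Propositional.Properties as ↭ₚ using (All-resp-↭; ∈-resp-↭; ++⁺)
  open import Data.List.Relation.Binary.Sublist.Propositional.Properties using (take-⊆; drop-⊆)
  open import Data.Product using (∃; _×_; _,_; proj₂)
  open import Data.Sum using (_⊎_; inj₁; inj₂)
  open import Data.Empty using (⊥-elim)
  open import Data.Unit using (tt)
  open import Function using (_⇔_; mk⇔; Equivalence)
  open import Relation.Nullary using (¬_; yes; no; Dec)
  open import Relation.Nullary.Decidable using (map′)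
  open import Relation.Binary.Definitions using (tri<; tri≈; tri>)
  open import Relation.Binary.PropositionalEquality using (_≡_; refl; sym; trans; cong; cong₂; subst)

  CutAt : List ℕ → ℕ → Set
  CutAt w i = take i w ↭ range 1 i

  FirstCut : List ℕ → ℕ → Set
  FirstCut w k = CutAt w k × (∀ i → 1 ≤ i → i < k → ¬ CutAt w i)

  cutAt⇔ : ∀ {w i} → T (prefixIsInitialᵇ w i) ⇔ CutAt w i
  cutAt⇔ {w} {i} = mk⇔
    (λ t → cover-↭ (unique-range 1 i) (Equivalence.to all∈ᵇ⇔ (proj₂ (Equivalence.to (T-∧ {all (_≤ᵇ i) (take i w)}) t)))
      (subst (length (take i w) ≤_) (sym (length-range 1 i)) (subst (_≤ i) (sym (length-take i w)) (ℕₚ.m⊓n≤m i (length w)))))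
    (λ p → Equivalence.from T-∧
      ( Allₚ.all⁻ (_≤ᵇ i) (All.map (λ x< → ℕₚ.≤⇒≤ᵇ (ℕₚ.≤-pred x<)) (All-resp-↭ (↭-sym p) (range-< 1 i)))
      , Equivalence.from all∈ᵇ⇔ (All.tabulate (∈-resp-↭ (↭-sym p)))))

  cutAt? : ∀ w i → Dec (CutAt w i)
  cutAt? w i = map′ (Equivalence.to cutAt⇔) (Equivalence.from cutAt⇔) (T? (prefixIsInitialᵇ w i))

  T-not⇔ : ∀ {b} → T (not b) ⇔ (¬ T b)
  T-not⇔ {false} = mk⇔ (λ _ ()) (λ _ → tt)
  T-not⇔ {true} = mk⇔ (λ ()) (λ ¬t → ¬t tt)

  indecomposable⇔ : ∀ {w n} → w ↭ range 1 (suc n) → T (indecomposableᵇ (suc n) w) ⇔ FirstCut w (suc n)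
  indecomposable⇔ {w} {n} p = mk⇔
    (λ t → subst (_↭ range 1 (suc n)) (sym (take-all (suc n) w (ℕₚ.≤-reflexive (↭range-length p)))) p ,
      λ i 1≤i i< c → Equivalence.to T-not⇔ t (Anyₚ.any⁺ (prefixIsInitialᵇ w)
        (lose (subst (i ∈_) (sym (oneTo≡range n)) (∈-range⁺ 1 n 1≤i i<)) (Equivalence.from cutAt⇔ c))))
    (λ (_ , no-cut) → Equivalence.from T-not⇔ λ t →
      let i , i∈ , c = find (Anyₚ.any⁻ (prefixIsInitialᵇ w) (oneTo n) t)
          i∈' = subst (i ∈_) (oneTo≡range n) i∈
      in no-cut i (All.lookup (range-≥ 1 n) i∈') (All.lookup (range-< 1 n) i∈') (Equivalence.to cutAt⇔ c))

  first-cut : ∀ w m → CutAt w (suc m) → ∃ λ k → k ≤ m × FirstCut w (suc k)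
  first-cut w m c with search m
    where
    search : ∀ m → (∃ λ k → k < m × FirstCut w (suc k)) ⊎ (∀ i → 1 ≤ i → i < suc m → ¬ CutAt w i)
    search zero = inj₂ λ i 1≤i i<1 → ⊥-elim (ℕₚ.<⇒≱ i<1 1≤i)
    search (suc m) with search m
    ... | inj₁ (k , k<m , f) = inj₁ (k , ℕₚ.m≤n⇒m≤1+n k<m , f)
    ... | inj₂ none with cutAt? w (suc m)
    ...   | yes c = inj₁ (m , ℕₚ.≤-refl , c , none)
    ...   | no ¬c = inj₂ λ i 1≤i i< → go i 1≤i (ℕₚ.m≤n⇒m<n∨m≡n (ℕₚ.≤-pred i<))
      where
      go : ∀ i → 1 ≤ i → i < suc m ⊎ i ≡ suc m → ¬ CutAt w i
      go i 1≤i (inj₁ i<) = none i 1≤i i<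
      go i 1≤i (inj₂ refl) = ¬c
  ... | inj₁ (k , k<m , f) = k , ℕₚ.<⇒≤ k<m , f
  ... | inj₂ none = m , ℕₚ.≤-refl , c , none

  FirstCut-unique : ∀ {w k k'} → 1 ≤ k → 1 ≤ k' → FirstCut w k → FirstCut w k' → k ≡ k'
  FirstCut-unique {k = k} {k'} 1≤k 1≤k' (c , f) (c' , f') with ℕₚ.<-cmp k k'
  ... | tri< k<k' _ _ = ⊥-elim (f' k 1≤k k<k' c)
  ... | tri≈ _ e _ = e
  ... | tri> _ _ k'<k = ⊥-elim (f k' 1≤k' k'<k c')

  take-length-++ : ∀ {A : Set} (xs ys : List A) → take (length xs) (xs ++ ys) ≡ xs
  take-length-++ [] ys = refl
  take-length-++ (x ∷ xs) ys = cong (x ∷_) (take-length-++ xs ys)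

  map-+-range : ∀ k o n → map (k +_) (range o n) ≡ range (k + o) n
  map-+-range k o zero = refl
  map-+-range k o (suc n) = cong (k + o ∷_) (trans (map-+-range k (suc o) n) (cong (λ j → range j n) (ℕₚ.+-suc k o)))

  shift-unshift : ∀ {k xs} → All (k ≤_) xs → map (k +_) (map (_∸ k) xs) ≡ xs
  shift-unshift [] = refl
  shift-unshift (k≤x ∷ ps) = cong₂ _∷_ (ℕₚ.m+[n∸m]≡n k≤x) (shift-unshift ps)

  -- Whether `k` is the first cut depends on the first `k` letters only, so the prefix up to the
  -- first cut is itself indecomposable.
  FirstCut-take : ∀ {w k} → FirstCut w k ⇔ FirstCut (take k w) k
  FirstCut-take {w} {k} = mk⇔
    (λ (c , f) → subst (_↭ range 1 k) (sym (eq ℕₚ.≤-refl)) c , λ i 1≤i i<k c' → f i 1≤i i<k (subst (_↭ range 1 i) (eq (ℕₚ.<⇒≤ i<k)) c'))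
    (λ (c , f) → subst (_↭ range 1 k) (eq ℕₚ.≤-refl) c , λ i 1≤i i<k c' → f i 1≤i i<k (subst (_↭ range 1 i) (sym (eq (ℕₚ.<⇒≤ i<k))) c'))
    where
    eq : ∀ {i} → i ≤ k → take i (take k w) ≡ take i w
    eq {i} i≤k = trans (take-take i k w) (cong (λ j → take j w) (ℕₚ.m≤n⇒m⊓n≡m i≤k))

  glue : ℕ → List ℕ → List ℕ → List ℕ
  glue k α β = α ++ map (k +_) β

  module Components {p : Pattern} {σ : List ℕ} (rep : Represents p σ) where
    open Pattern p
    open Avoiders p
    open Represents rep

    indecomposables : ℕ → List (List ℕ)
    indecomposables zero = []
    indecomposables (suc n) = filter (λ π → T? (indecomposableᵇ (suc n) π ∧ avoidsᵇ π σ)) (Perms (suc n))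

    ∈-indecomposables : ∀ {n w} → w ∈ indecomposables n ⇔ (1 ≤ n × w ↭ range 1 n × FirstCut w n × Avoid w)
    ∈-indecomposables {zero} = mk⇔ (λ ()) (λ { (() , _) })
    ∈-indecomposables {suc n} {w} = mk⇔
      (λ w∈ → let w∈P , t = ∈-filter⁻ test {xs = Perms (suc n)} w∈
                  perm = Equivalence.to ∈-Perms w∈P
                  ti , ta = Equivalence.to (T-∧ {indecomposableᵇ (suc n) w}) t
              in s≤s z≤n , perm , Equivalence.to (indecomposable⇔ perm) ti , Equivalence.to (avoidsᵇ⇔ (unique-perm perm)) ta)
      (λ (_ , perm , f , a) → ∈-filter⁺ test (Equivalence.from ∈-Perms perm)
        (Equivalence.from T-∧ (Equivalence.from (indecomposable⇔ perm) f , Equivalence.from (avoidsᵇ⇔ (unique-perm perm)) a)))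
      where
      test : ∀ π → Dec (T (indecomposableᵇ (suc n) π ∧ avoidsᵇ π σ))
      test π = T? (indecomposableᵇ (suc n) π ∧ avoidsᵇ π σ)

    unique-indecomposables : ∀ n → Unique (indecomposables n)
    unique-indecomposables zero = []
    unique-indecomposables (suc n) = Uniqueₚ.filter⁺ _ (unique-Perms (suc n))

    piece : ℕ → ℕ → List (List ℕ)
    piece n k = concatMap (λ α → map (glue k α) (avoiders (n ∸ k))) (indecomposables k)

    avoid-shift : ∀ k {β} → Avoid β → Avoid (map (k +_) β)
    avoid-shift k {β} a c = a (subst Contains (trans (sym (map-∘ β)) (trans (map-cong (ℕₚ.m+n∸m≡n k) β) (map-id β)))
      (contains-map (_∸ k) {k ≤_} (λ k≤x _ x<y → ℕₚ.∸-monoˡ-< x<y k≤x) (Allₚ.map⁺ (All.universal (ℕₚ.m≤m+n k) β)) c))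

    avoid-unshift : ∀ k {β} → All (k ≤_) β → Avoid β → Avoid (map (_∸ k) β)
    avoid-unshift k {β} k≤ a c = a (subst Contains (shift-unshift k≤)
      (contains-map (k +_) {λ _ → ℕ} (λ _ _ → ℕₚ.+-monoʳ-< k) (All.universal (λ _ → 0) _) c))

    -- The direct sum still avoids the pattern because the pattern is sum-indecomposable
    -- (`avoid-++`).
    ∈-piece⁻ : ∀ {n k w} → k ≤ n → w ∈ piece n k → 1 ≤ k × w ↭ range 1 n × FirstCut w k × Avoid w
    ∈-piece⁻ {n} {k} {w} k≤n w∈ with find (∈-concatMap⁻ (λ α → map (glue k α) (avoiders (n ∸ k))) {xs = indecomposables k} w∈)
    ... | α , α∈ , q with ∈-map⁻ (glue k α) q
    ...   | β , β∈ , refl with Equivalence.to (∈-indecomposables {k}) α∈ | Equivalence.to ∈-avoiders β∈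
    ...     | 1≤k , pα , f , aα | pβ , aβ = 1≤k ,
        ↭-trans (++⁺ pα pβ') (↭-reflexive (trans (sym (range-++ 1 k (n ∸ k))) (cong (range 1) (ℕₚ.m+[n∸m]≡n k≤n)))) ,
        Equivalence.from FirstCut-take (subst (λ v → FirstCut v k) (sym take≡) f) ,
        avoid-++ (↭range-≼ pα pβ') aα (avoid-shift k aβ)
      where
      pβ' : map (k +_) β ↭ range (1 + k) (n ∸ k)
      pβ' = ↭-trans (↭ₚ.map⁺ (k +_) pβ) (↭-reflexive (trans (map-+-range k 1 (n ∸ k)) (cong (λ j → range j (n ∸ k)) (ℕₚ.+-comm k 1))))
      take≡ : take k (glue k α β) ≡ α
      take≡ = trans (cong (λ j → take j (glue k α β)) (sym (↭range-length pα))) (take-length-++ α _)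

    ∈-piece⁺ : ∀ {n k w} → k ≤ n → 1 ≤ k → w ↭ range 1 n → FirstCut w k → Avoid w → w ∈ piece n k
    ∈-piece⁺ {n} {k} {w} k≤n 1≤k pw f@(c , _) a =
      ∈-concatMap⁺ (λ α → map (glue k α) (avoiders (n ∸ k))) (lose α∈ (subst (_∈ map (glue k α) (avoiders (n ∸ k))) glue≡ (∈-map⁺ (glue k α) β∈)))
      where
      α δ β : List ℕ
      α = take k w
      δ = drop k w
      β = map (_∸ k) δ
      α∈ : α ∈ indecomposables k
      α∈ = Equivalence.from ∈-indecomposables (1≤k , c , Equivalence.to FirstCut-take f , avoid-⊆ (take-⊆ k w) a)
      -- The prefix `α` uses up the letters 1 to k, which leaves the larger ones for `δ`.
      pδ : δ ↭ range (1 + k) (n ∸ k)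
      pδ = cover-↭ (unique-range (1 + k) (n ∸ k)) (All.tabulate mem)
        (ℕₚ.≤-reflexive (trans (length-drop k w) (trans (cong (_∸ k) (↭range-length pw)) (sym (length-range (1 + k) (n ∸ k))))))
        where
        mem : ∀ {x} → x ∈ range (1 + k) (n ∸ k) → x ∈ δ
        mem {x} x∈ with ∈-++⁻ α (subst (x ∈_) (sym (take++drop≡id k w)) (∈-resp-↭ (↭-sym pw)
          (∈-range⁺ 1 n (ℕₚ.≤-trans (s≤s z≤n) (All.lookup (range-≥ (1 + k) (n ∸ k)) x∈))
            (subst (λ m → x < suc m) (ℕₚ.m+[n∸m]≡n k≤n) (All.lookup (range-< (1 + k) (n ∸ k)) x∈)))))
        ... | inj₁ x∈α = ⊥-elim (ℕₚ.<⇒≱ (All.lookup (range-< 1 k) (∈-resp-↭ c x∈α)) (All.lookup (range-≥ (1 + k) (n ∸ k)) x∈))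
        ... | inj₂ x∈δ = x∈δ
      k≤δ : All (k ≤_) δ
      k≤δ = All-resp-↭ (↭-sym pδ) (All.map ℕₚ.<⇒≤ (range-≥ (1 + k) (n ∸ k)))
      glue≡ : glue k α β ≡ w
      glue≡ = trans (cong (α ++_) (shift-unshift k≤δ)) (take++drop≡id k w)
      β∈ : β ∈ avoiders (n ∸ k)
      β∈ = Equivalence.from ∈-avoiders
        ( ↭-trans (↭ₚ.map⁺ (_∸ k) pδ) (↭-reflexive (trans (cong (map (_∸ k)) (sym (trans (map-+-range k 1 (n ∸ k)) (cong (λ j → range j (n ∸ k)) (ℕₚ.+-comm k 1)))))
            (trans (sym (map-∘ (range 1 (n ∸ k)))) (trans (map-cong (ℕₚ.m+n∸m≡n k) _) (map-id _)))))
        , avoid-unshift k k≤δ (avoid-⊆ (drop-⊆ k w) a))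

    pieces : ℕ → List (List ℕ)
    pieces n = concatMap (piece n) (upTo (suc n))

    unique-pieces : ∀ n → Unique (pieces n)
    unique-pieces n = unique-concatMap (piece n) (Uniqueₚ.upTo⁺ (suc n))
      (λ {k} _ → unique-concatMap (λ α → map (glue k α) (avoiders (n ∸ k))) (unique-indecomposables k)
        (λ {α} _ → unique-map (glue k α) (λ {β} {γ} _ _ e → map-injective (ℕₚ.+-cancelˡ-≡ k _ _) (++-cancelˡ α _ _ e)) (unique-avoiders (n ∸ k)))
        (λ {α} {α'} α∈ α'∈ z∈ z∈' → trans (sym (head k {m = n ∸ k} α∈ z∈)) (head k {m = n ∸ k} α'∈ z∈')))
      (λ k∈ k'∈ z∈ z∈' → let 1≤k , _ , f , _ = ∈-piece⁻ (ℕₚ.≤-pred (∈-upTo⁻ k∈)) z∈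
                             1≤k' , _ , f' , _ = ∈-piece⁻ (ℕₚ.≤-pred (∈-upTo⁻ k'∈)) z∈'
                         in FirstCut-unique 1≤k 1≤k' f f')
      where
      head : ∀ k {α z m} → α ∈ indecomposables k → z ∈ map (glue k α) (avoiders m) → take k z ≡ α
      head k {α} α∈ z∈ with ∈-map⁻ (glue k α) z∈
      ... | β , _ , refl = let _ , pα , _ = Equivalence.to (∈-indecomposables {k}) α∈ in
        trans (cong (λ j → take j (glue k α β)) (sym (↭range-length pα))) (take-length-++ α _)

    length-pieces : ∀ n → length (avoiders (suc n)) ≡ length (pieces (suc n))
    length-pieces n = unique-length (unique-avoiders (suc n)) (unique-pieces (suc n)) (mk⇔ to from)
      where
      to : ∀ {w} → w ∈ avoiders (suc n) → w ∈ pieces (suc n)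
      to {w} w∈ with Equivalence.to ∈-avoiders w∈
      ... | pw , a with first-cut w n (subst (_↭ range 1 (suc n)) (sym (take-all (suc n) w (ℕₚ.≤-reflexive (↭range-length pw)))) pw)
      ...   | k , k≤n , f = ∈-concatMap⁺ (piece (suc n)) (lose (∈-upTo⁺ (s≤s (s≤s k≤n))) (∈-piece⁺ (s≤s k≤n) (s≤s z≤n) pw f a))
      from : ∀ {w} → w ∈ pieces (suc n) → w ∈ avoiders (suc n)
      from w∈ with find (∈-concatMap⁻ (piece (suc n)) {xs = upTo (suc (suc n))} w∈)
      ... | k , k∈ , q with ∈-piece⁻ (ℕₚ.≤-pred (∈-upTo⁻ k∈)) q
      ...   | _ , pw , _ , a = Equivalence.from ∈-avoiders (pw , a)

    length-concatMap : ∀ {A : Set} (F : A → List (List ℕ)) (g : A → ℤ) xs → (∀ x → pos (length (F x)) ≡ g x) →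
      pos (length (concatMap F xs)) ≡ sumℤ (map g xs)
    length-concatMap F g [] e = refl
    length-concatMap F g (x ∷ xs) e = trans (cong pos (length-++ (F x))) (cong₂ ℤ._+_ (e x) (length-concatMap F g xs e))

    length-piece : ∀ n k → pos (length (piece n k)) ≡ Igf σ k ℤ.* pos (length (avoiders (n ∸ k)))
    length-piece n k = trans (go (indecomposables k)) (trans (ℤₚ.pos-* (length (indecomposables k)) _) (cong (ℤ._* pos (length (avoiders (n ∸ k)))) (I≡ k)))
      where
      go : ∀ αs → pos (length (concatMap (λ α → map (glue k α) (avoiders (n ∸ k))) αs)) ≡ pos (length αs Data.Nat.* length (avoiders (n ∸ k)))
      go [] = refl
      go (α ∷ αs) = trans (cong pos (length-++ (map (glue k α) (avoiders (n ∸ k)))))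
        (cong₂ ℤ._+_ (cong pos (length-map (glue k α) (avoiders (n ∸ k)))) (go αs))
      I≡ : ∀ k → pos (length (indecomposables k)) ≡ Igf σ k
      I≡ zero = refl
      I≡ (suc k) = refl

    avoiderSeries : PS
    avoiderSeries n = pos (length (avoiders n))

    -- Only positive lengths: the empty permutation has no first component and accounts for the 1 in
    -- S = 1 + I S.
    first-component : ∀ n → avoiderSeries (suc n) ≡ (Igf σ ⊛ avoiderSeries) (suc n)
    first-component n = trans (cong pos (length-pieces n))
      (length-concatMap (piece (suc n)) (λ k → Igf σ k ℤ.* avoiderSeries (suc n ∸ k)) (upTo (suc (suc n))) (length-piece (suc n)))

-- Reverse-complement and inverse carry the two base patterns to the other four.

module Symmetries where

  open Words using (All-⊆)
  open Patterns
  open Placements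
  open Lists
  open Permutations
  open import Data.Nat using (ℕ; zero; suc; _+_; _∸_; _<_; _≤_; z≤n; s≤s; _≟_)
  import Data.Nat.Properties as ℕₚ
  open import Data.List using (List; []; _∷_; map; length; reverse)
  open import Data.List.Properties using (length-map; reverse-map; reverse-involutive)
  open import Data.List.Relation.Unary.All as All using (All; []; _∷_)
  import Data.List.Relation.Unary.All.Properties as Allₚ
  open import Data.List.Relation.Unary.AllPairs as AllPairs using (AllPairs; []; _∷_)
  import Data.List.Relation.Unary.AllPairs.Properties as AllPairsₚ
  open import Data.List.Relation.Unary.Any using (here; there)
  open import Data.List.Membership.Propositional using (_∈_)
  open import Data.List.Membership.Propositional.Properties using (∈-map⁺; ∈-map⁻)
  open import Data.List.Relation.Unary.Unique.Propositional using (Unique)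
  open import Data.List.Relation.Binary.Pointwise using (Pointwise; []; _∷_)
  open import Data.List.Relation.Binary.Permutation.Propositional using (_↭_; ↭-sym; ↭-trans)
  open import Data.List.Relation.Binary.Permutation.Propositional.Properties using (All-resp-↭; ∈-resp-↭; ↭-reverse; map⁺)
  open import Data.List.Relation.Binary.Sublist.Propositional using (_⊆_; []; _∷_; _∷ʳ_; minimum)
  import Data.List.Relation.Binary.Sublist.Propositional.Properties as Subₚ
  open import Data.Product using (∃; _×_; _,_; proj₁)
  open import Data.Empty using (⊥-elim)
  open import Function using (mk⇔; Equivalence)
  open import Relation.Nullary using (yes; no)
  open import Relation.Binary.PropositionalEquality using (_≡_; refl; sym; trans; cong; cong₂; subst)

  open Pattern using (R; Contains; Avoid)
  open Avoiders

  record Involution (φ : ℕ → List ℕ → List ℕ) : Set where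
    field
      perm : ∀ {n w} → w ↭ range 1 n → φ n w ↭ range 1 n
      involutive : ∀ {n w} → w ↭ range 1 n → φ n (φ n w) ≡ w

  Carries : (ℕ → List ℕ → List ℕ) → Pattern → Pattern → Set
  Carries φ p q = ∀ {n w} → w ↭ range 1 n → Contains p w → Contains q (φ n w)

  -- Containment carried from each pattern to the other makes the involution map avoiders to
  -- avoiders in both directions.
  length-avoiders : ∀ {φ p q} → Involution φ → Carries φ p q → Carries φ q p → ∀ n → length (avoiders p n) ≡ length (avoiders q n)
  length-avoiders {φ} {p} {q} inv pq qp n = trans (sym (length-map (φ n) (avoiders p n)))
    (unique-length (unique-map (φ n) (λ x∈ y∈ e → trans (sym (involutive (permOf p x∈))) (trans (cong (φ n) e) (involutive (permOf p y∈))))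
      (unique-avoiders p n)) (unique-avoiders q n) (mk⇔ to from))
    where
    open Involution inv
    permOf : ∀ p {w} → w ∈ avoiders p n → w ↭ range 1 n
    permOf p w∈ = proj₁ (Equivalence.to (∈-avoiders p) w∈)
    move : ∀ {p q} → Carries φ q p → ∀ {w} → w ∈ avoiders p n → φ n w ∈ avoiders q n
    move {p} {q} qp w∈ = let pw , a = Equivalence.to (∈-avoiders p) w∈ in
      Equivalence.from (∈-avoiders q) (perm pw , λ c → a (subst (Contains p) (involutive pw) (qp (perm pw) c)))
    to : ∀ {w} → w ∈ map (φ n) (avoiders p n) → w ∈ avoiders q n
    to w∈ with ∈-map⁻ (φ n) w∈
    ... | v , v∈ , refl = move {p} {q} qp v∈
    from : ∀ {w} → w ∈ avoiders q n → w ∈ map (φ n) (avoiders p n)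
    from {w} w∈ = subst (_∈ map (φ n) (avoiders p n)) (involutive (permOf q w∈)) (∈-map⁺ (φ n) (move {q} {p} pq w∈))

  reverseComplement : ℕ → List ℕ → List ℕ
  reverseComplement n w = reverse (map (suc n ∸_) w)

  complement-involutive : ∀ n {w} → All (_< suc n) w → map (suc n ∸_) (map (suc n ∸_) w) ≡ w
  complement-involutive n [] = refl
  complement-involutive n (x< ∷ all) = cong₂ _∷_ (ℕₚ.m∸[m∸n]≡n (ℕₚ.<⇒≤ x<)) (complement-involutive n all)

  range-bounded : ∀ {n w} → w ↭ range 1 n → All (_< suc n) w
  range-bounded {n} p = All-resp-↭ (↭-sym p) (range-< 1 n)

  reverseComplement-involution : Involution reverseComplement
  reverseComplement-involution = record
    { perm = λ {n} {w} p → ↭-trans (↭-reverse _) (↭-trans (map⁺ (suc n ∸_) p) (complement-range n))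
    ; involutive = λ {n} {w} p → trans (cong reverse (reverse-map (suc n ∸_) (map (suc n ∸_) w)))
        (trans (reverse-involutive _) (complement-involutive n (range-bounded p))) }
    where
    complement-range : ∀ n → map (suc n ∸_) (range 1 n) ↭ range 1 n
    complement-range n = cover-↭ (unique-range 1 n) (All.tabulate mem) (ℕₚ.≤-reflexive (length-map (suc n ∸_) (range 1 n)))
      where
      mem : ∀ {x} → x ∈ range 1 n → x ∈ map (suc n ∸_) (range 1 n)
      mem {x} x∈ = subst (_∈ map (suc n ∸_) (range 1 n)) (ℕₚ.m∸[m∸n]≡n (ℕₚ.<⇒≤ x<))
        (∈-map⁺ (suc n ∸_) (∈-range⁺ 1 n (ℕₚ.m<n⇒0<n∸m x<) (ℕₚ.∸-monoʳ-< (All.lookup (range-≥ 1 n) x∈) (ℕₚ.<⇒≤ x<))))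
        where
        x< : x < suc n
        x< = All.lookup (range-< 1 n) x∈

  -- Truncated subtraction reverses the order only on letters up to `suc n`, so the hypothesis on
  -- `f` is limited to the letters of the occurrence.
  reverseComplement-carries : ∀ {p q} →
    (∀ (f : ℕ → ℕ) {a b c d} → (∀ {x y} → x ∈ (a ∷ b ∷ c ∷ d ∷ []) → y ∈ (a ∷ b ∷ c ∷ d ∷ []) → x < y → f y < f x) →
      R p a b c d → R q (f d) (f c) (f b) (f a)) →
    Carries reverseComplement p q
  reverseComplement-carries {p} {q} h {n} {w} pw (a ∷ b ∷ c ∷ d ∷ [] , τ , m) =
    _ , Subₚ.reverse⁺ (Subₚ.map⁺ (suc n ∸_) τ) , h (suc n ∸_) anti m
    where
    anti : ∀ {x y} → x ∈ (a ∷ b ∷ c ∷ d ∷ []) → y ∈ (a ∷ b ∷ c ∷ d ∷ []) → x < y → suc n ∸ y < suc n ∸ x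
    anti x∈ y∈ x<y = ℕₚ.∸-monoʳ-< x<y (ℕₚ.<⇒≤ (All.lookup (All-⊆ τ (range-bounded pw)) y∈))

  avoiders-3241-4132 : ∀ n → length (avoiders p3241 n) ≡ length (avoiders p4132 n)
  avoiders-3241-4132 = length-avoiders {p = p3241} {p4132} reverseComplement-involution
    (reverseComplement-carries {p3241} {p4132} λ f m (d<b , b<a , a<c) → m 0# 2# a<c , m 1# 0# b<a , m 3# 1# d<b)
    (reverseComplement-carries {p4132} {p3241} λ f m (b<d , d<c , c<a) → m 2# 0# c<a , m 3# 2# d<c , m 1# 3# b<d)
    where
    0# : ∀ {a : ℕ} {xs} → a ∈ a ∷ xs
    0# = here refl
    1# : ∀ {a b : ℕ} {xs} → b ∈ a ∷ b ∷ xs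
    1# = there (here refl)
    2# : ∀ {a b c : ℕ} {xs} → c ∈ a ∷ b ∷ c ∷ xs
    2# = there (there (here refl))
    3# : ∀ {a b c d : ℕ} {xs} → d ∈ a ∷ b ∷ c ∷ d ∷ xs
    3# = there (there (there (here refl)))

  -- Positions are counted from 1.
  data Pt : List ℕ → ℕ → ℕ → Set where
    here : ∀ {x w} → Pt (x ∷ w) 1 x
    there : ∀ {x w p v} → Pt w p v → Pt (x ∷ w) (suc p) v

  Pt-≥1 : ∀ {w p v} → Pt w p v → 1 ≤ p
  Pt-≥1 here = s≤s z≤n
  Pt-≥1 (there _) = s≤s z≤n

  Pt-∈ : ∀ {w p v} → Pt w p v → v ∈ w
  Pt-∈ here = here refl
  Pt-∈ (there q) = there (Pt-∈ q)

  ∈-Pt : ∀ {w p} → 1 ≤ p → p < suc (length w) → ∃ λ v → Pt w p v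
  ∈-Pt {x ∷ w} {suc zero} _ _ = x , here
  ∈-Pt {x ∷ w} {suc (suc p)} _ (s≤s p<) = let v , q = ∈-Pt (s≤s z≤n) p< in v , there q
  ∈-Pt {[]} {suc p} _ (s≤s ())

  Pt-map : ∀ (f : ℕ → ℕ) {w p v} → Pt w p v → Pt (map f w) p (f v)
  Pt-map f here = here
  Pt-map f (there q) = there (Pt-map f q)

  Pt-range : ∀ o n {i} → i < n → Pt (range o n) (suc i) (o + i)
  Pt-range o (suc n) {zero} _ = subst (Pt (range o (suc n)) 1) (sym (ℕₚ.+-identityʳ o)) here
  Pt-range o (suc n) {suc i} (s≤s i<n) = subst (Pt (range o (suc n)) (suc (suc i))) (sym (ℕₚ.+-suc o i)) (there (Pt-range (suc o) n i<n))

  Pt-ext : ∀ {w w'} → length w ≡ length w' → (∀ {p v} → Pt w p v → Pt w' p v) → w ≡ w'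
  Pt-ext {[]} {[]} _ _ = refl
  Pt-ext {x ∷ w} {y ∷ w'} len h with h here
  ... | here = cong (x ∷_) (Pt-ext (ℕₚ.suc-injective len) λ q → tail q (h (there q)))
    where
    tail : ∀ {p v} → Pt w p v → Pt (x ∷ w') (suc p) v → Pt w' p v
    tail _ (there q) = q
    tail () here
  ... | there ()

  points-∷ : ∀ {ps zs w y} → Pointwise (Pt w) ps zs → Pointwise (Pt (y ∷ w)) (map suc ps) zs
  points-∷ [] = []
  points-∷ (q ∷ qs) = there q ∷ points-∷ qs

  -- With `points⇒⊆`, subsequences become points of the graph with increasing positions, a form in
  -- which inversion just exchanges the coordinates.
  ⊆⇒points : ∀ {zs w} → zs ⊆ w → ∃ λ ps → Pointwise (Pt w) ps zs × AllPairs _<_ ps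
  ⊆⇒points [] = [] , [] , []
  ⊆⇒points (y ∷ʳ τ) with ⊆⇒points τ
  ... | ps , pts , inc = map suc ps , points-∷ pts , AllPairsₚ.map⁺ (AllPairs.map s≤s inc)
  ⊆⇒points (refl ∷ τ) with ⊆⇒points τ
  ... | ps , pts , inc = 1 ∷ map suc ps , here ∷ points-∷ pts , Allₚ.map⁺ (above pts) ∷ AllPairsₚ.map⁺ (AllPairs.map s≤s inc)
    where
    above : ∀ {ps zs w} → Pointwise (Pt w) ps zs → All (λ p → 1 < suc p) ps
    above [] = []
    above (q ∷ qs) = s≤s (Pt-≥1 q) ∷ above qs

  strip : ∀ {ps zs x w} → Pointwise (Pt (x ∷ w)) ps zs → All (1 <_) ps → ∃ λ qs → ps ≡ map suc qs × Pointwise (Pt w) qs zs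
  strip [] [] = [] , refl , []
  strip (here ∷ _) (s≤s () ∷ _)
  strip (there q ∷ pts) (_ ∷ all) with strip pts all
  ... | qs , refl , pts' = _ ∷ qs , refl , q ∷ pts'

  points⇒⊆ : ∀ {ps zs w} → AllPairs _<_ ps → Pointwise (Pt w) ps zs → zs ⊆ w
  points⇒⊆ [] [] = minimum _
  points⇒⊆ {w = []} (_ ∷ _) (() ∷ _)
  points⇒⊆ {w = x ∷ w} (lt ∷ inc) (here ∷ pts) with strip pts lt
  ... | qs , refl , pts' = refl ∷ points⇒⊆ (AllPairs.map ℕₚ.≤-pred (AllPairsₚ.map⁻ inc)) pts'
  points⇒⊆ {w = x ∷ w} inc@(lt ∷ _) pts@(there q ∷ _) with strip pts (s≤s (Pt-≥1 q) ∷ All.map (ℕₚ.<-trans (s≤s (Pt-≥1 q))) lt)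
  ... | qs , e , pts' = x ∷ʳ points⇒⊆ (AllPairs.map ℕₚ.≤-pred (AllPairsₚ.map⁻ (subst (AllPairs _<_) e inc))) pts'

  idx : List ℕ → ℕ → ℕ
  idx [] v = 0
  idx (x ∷ w) v with x ≟ v
  ... | yes _ = 1
  ... | no _ = suc (idx w v)

  Pt-idx : ∀ {w p v} → Unique w → Pt w p v → idx w v ≡ p
  Pt-idx {x ∷ w} {v = v} (x∉ ∷ u) q with x ≟ v
  Pt-idx {x ∷ w} (x∉ ∷ u) here | yes _ = refl
  Pt-idx {x ∷ w} (x∉ ∷ u) (there q) | yes refl = ⊥-elim (All.lookup x∉ (Pt-∈ q) refl)
  Pt-idx {x ∷ w} (x∉ ∷ u) here | no x≢x = ⊥-elim (x≢x refl)
  Pt-idx {x ∷ w} (x∉ ∷ u) (there q) | no _ = cong suc (Pt-idx u q)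

  inverse : ℕ → List ℕ → List ℕ
  inverse n w = map (idx w) (range 1 n)

  inverse-Pt : ∀ {n w p v} → w ↭ range 1 n → Pt w p v → Pt (inverse n w) v p
  inverse-Pt {n} {w} {p} pw q with ∈-range⁻ 1 n (∈-resp-↭ pw (Pt-∈ q))
  ... | i , j , refl , refl = subst (Pt (inverse n w) (suc i)) (Pt-idx (unique-perm pw) q)
    (Pt-map (idx w) (Pt-range 1 n (ℕₚ.m<m+n i (s≤s z≤n))))

  length-inverse : ∀ n w → length (inverse n w) ≡ n
  length-inverse n w = trans (length-map (idx w) (range 1 n)) (length-range 1 n)

  inverse-perm : ∀ {n w} → w ↭ range 1 n → inverse n w ↭ range 1 n
  inverse-perm {n} {w} pw = cover-↭ (unique-range 1 n) (All.tabulate mem)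
    (ℕₚ.≤-reflexive (length-map (idx w) (range 1 n)))
    where
    mem : ∀ {p} → p ∈ range 1 n → p ∈ inverse n w
    mem {p} p∈ = let v , q = ∈-Pt {w} (All.lookup (range-≥ 1 n) p∈) (subst (λ m → p < suc m) (sym (↭range-length pw)) (All.lookup (range-< 1 n) p∈))
                 in Pt-∈ (inverse-Pt pw q)

  inverse-involution : Involution inverse
  inverse-involution = record
    { perm = inverse-perm
    ; involutive = λ {n} {w} pw → sym (Pt-ext (trans (↭range-length pw) (sym (length-inverse n (inverse n w))))
        (λ q → inverse-Pt (inverse-perm pw) (inverse-Pt pw q))) }

  occurrence : ∀ {w a b c d p q r s} → Chain p q r s → Pt w p a → Pt w q b → Pt w r c → Pt w s d → (a ∷ b ∷ c ∷ d ∷ []) ⊆ w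
  occurrence (p<q , q<r , r<s) pa qb rc sd = points⇒⊆
    ((p<q ∷ ℕₚ.<-trans p<q q<r ∷ ℕₚ.<-trans p<q (ℕₚ.<-trans q<r r<s) ∷ []) ∷ (q<r ∷ ℕₚ.<-trans q<r r<s ∷ []) ∷ (r<s ∷ []) ∷ [] ∷ [])
    (pa ∷ qb ∷ rc ∷ sd ∷ [])

  -- Inversion exchanges the two chains: the order of the values becomes the order of the positions,
  -- and conversely.
  inverse-carries : ∀ {p q} →
    (∀ {w i j k l a b c d} → Chain i j k l → Pt w a i → Pt w b j → Pt w c k → Pt w d l → R p a b c d → Contains q w) →
    Carries inverse p q
  inverse-carries h pw (_ ∷ _ ∷ _ ∷ _ ∷ [] , τ , m) with ⊆⇒points τ
  ... | _ , pa ∷ pb ∷ pc ∷ pd ∷ [] , (ij ∷ _) ∷ (jk ∷ _) ∷ (kl ∷ _) ∷ _ =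
    h (ij , jk , kl) (inverse-Pt pw pa) (inverse-Pt pw pb) (inverse-Pt pw pc) (inverse-Pt pw pd) m

  avoiders-3241-4213 : ∀ n → length (avoiders p3241 n) ≡ length (avoiders p4213 n)
  avoiders-3241-4213 = length-avoiders {p = p3241} {p4213} inverse-involution
    -- The value chain `m` of 3241 lists the points by their position in the inverse, as D B A C;
    -- the position chain `ch` is then the relation of 4213.
    (inverse-carries {p3241} {p4213} λ ch A B C D m → _ , occurrence m D B A C , ch)
    (inverse-carries {p4213} {p3241} λ ch A B C D m → _ , occurrence m C B D A , ch)

  avoiders-4132-2431 : ∀ n → length (avoiders p4132 n) ≡ length (avoiders p2431 n)
  avoiders-4132-2431 = length-avoiders {p = p4132} {p2431} inverse-involution
    (inverse-carries {p4132} {p2431} λ ch A B C D m → _ , occurrence m B D C A , ch)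
    (inverse-carries {p2431} {p4132} λ ch A B C D m → _ , occurrence m D A C B , ch)

  avoiders-2413-3142 : ∀ n → length (avoiders p2413 n) ≡ length (avoiders p3142 n)
  avoiders-2413-3142 = length-avoiders {p = p2413} {p3142} inverse-involution
    (inverse-carries {p2413} {p3142} λ ch A B C D m → _ , occurrence m C A D B , ch)
    (inverse-carries {p3142} {p2413} λ ch A B C D m → _ , occurrence m B D A C , ch)

-- The square-root identity from the tree count.

module Main where

  open import Defs using (PS; poly; xTimes; Igf; _⊕_; _·_; IsSqrtOneMinus8xCubed)
  open PowerSeries
  open QuadraticMethod
  open Trees using (treesOfSize; F; F-eq; F-cong[]; S; S-coeff)
  open Patterns
  open Placements
  open Permutations
  open FirstComponent
  open Coding
  open Symmetries
  open import Data.Nat using (ℕ; zero; suc)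
  open import Data.Integer using (ℤ; +_; -_)
  import Data.Integer as ℤ
  import Data.Integer.Properties as ℤₚ
  open import Data.List using (List; []; _∷_; length)
  open import Data.Product using (_,_)
  open import Relation.Binary.PropositionalEquality using (_≡_; refl; sym; trans; cong)
  open Solver using (solve; _:+_; _:*_; _:-_; con; _:=_)

  poly-∷ : ∀ c cs → poly (c ∷ cs) ≈ const c + X * poly cs
  poly-∷ c cs zero = sym (trans (cong (λ z → c ℤ.+ z) (X*-zero (poly cs))) (ℤₚ.+-identityʳ c))
  poly-∷ c cs (suc n) = sym (trans (ℤₚ.+-identityˡ _) (X*-suc (poly cs) n))

  horner₀ : ∀ c → poly (c ∷ []) ≈ const c
  horner₀ c zero = refl
  horner₀ c (suc n) = refl

  horner : ∀ c {cs f} → poly cs ≈ f → poly (c ∷ cs) ≈ const c + X * f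
  horner c {cs} {f} p = ≈-trans (poly-∷ c cs) (+-cong {const c} (λ _ → refl) (*-cong {X} {X} {poly cs} {f} (λ _ → refl) p))

  sqrtSeries : ∀ {p σ} → Represents p σ → (∀ n → length (Avoiders.avoiders p n) ≡ length (treesOfSize n)) →
    IsSqrtOneMinus8xCubed ((+ 32 · xTimes (Igf σ)) ⊕ poly (+ 1 ∷ - (+ 12) ∷ - (+ 8) ∷ []))
  -- `refl` is the constant term 1, which selects one of the two square roots.
  sqrtSeries {p} {σ} rep count = refl , λ n → trans (⊛≈* T T n) (trans (*-cong T≈Y T≈Y n) (trans (Y-square n) (sym (cube n))))
    where
    open Components rep using (avoiderSeries; first-component)
    A≈S : avoiderSeries ≈ S
    A≈S n = trans (cong +_ (count n)) (sym (S-coeff n))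
    S-decomposition : S ≈ 𝟙 + Igf σ * S
    S-decomposition zero = refl
    S-decomposition (suc n) = trans (sym (A≈S (suc n))) (trans (first-component n) (trans (⊛≈* (Igf σ) avoiderSeries (suc n))
      (trans (*-cong {Igf σ} {Igf σ} (λ _ → refl) A≈S (suc n)) (sym (ℤₚ.+-identityˡ _)))))
    S-inverse : S * (𝟙 - Igf σ) ≈ 𝟙
    S-inverse = undiff (≈-trans
      (solve 2 (λ s i → s :* (con (+ 1) :- i) :- con (+ 1) := s :- (con (+ 1) :+ i :* s)) (λ _ → refl) S (Igf σ))
      (diff S-decomposition))
    open Quadratic F S (Igf σ) F-cong[] S-inverse F-eq using (Y; Y-square)
    T : PS
    T = (+ 32 · xTimes (Igf σ)) ⊕ poly (+ 1 ∷ - (+ 12) ∷ - (+ 8) ∷ [])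
    T≈Y : T ≈ Y
    T≈Y = ≈-trans
      (+-cong {+ 32 · xTimes (Igf σ)} {const (+ 32) * (X * Igf σ)}
        (λ n → sym (trans (const-* (+ 32) (X * Igf σ) n) (cong (+ 32 ℤ.*_) (X*≈xTimes (Igf σ) n))))
        (horner (+ 1) (horner (- (+ 12)) (horner₀ (- (+ 8))))))
      (solve 2 (λ x i → con (+ 32) :* (x :* i) :+ (con (+ 1) :+ x :* (con (- (+ 12)) :+ x :* con (- (+ 8))))
          := con (+ 32) :* x :* i :+ con (+ 1) :- con (+ 12) :* x :- con (+ 8) :* x :* x) (λ _ → refl) X (Igf σ))
    cube : poly (+ 1 ∷ - (+ 24) ∷ + 192 ∷ - (+ 512) ∷ []) ≈ (𝟙 - c8 * X) * (𝟙 - c8 * X) * (𝟙 - c8 * X)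
    cube = ≈-trans (horner (+ 1) (horner (- (+ 24)) (horner (+ 192) (horner₀ (- (+ 512))))))
      (solve 1 (λ x → con (+ 1) :+ x :* (con (- (+ 24)) :+ x :* (con (+ 192) :+ x :* con (- (+ 512))))
          := (con (+ 1) :- con (+ 8) :* x) :* (con (+ 1) :- con (+ 8) :* x) :* (con (+ 1) :- con (+ 8) :* x)) (λ _ → refl) X)

  count3241 : ∀ n → length (Avoiders.avoiders p3241 n) ≡ length (treesOfSize n)
  count3241 n = Code.count-avoiders first3241 {n} (Avoiders.unique-avoiders p3241 n) (Avoiders.∈-avoiders p3241)

  count2413 : ∀ n → length (Avoiders.avoiders p2413 n) ≡ length (treesOfSize n)
  count2413 n = Code.count-avoiders last2413 {n} (Avoiders.unique-avoiders p2413 n) (Avoiders.∈-avoiders p2413)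

  count4132 : ∀ n → length (Avoiders.avoiders p4132 n) ≡ length (treesOfSize n)
  count4132 n = trans (sym (avoiders-3241-4132 n)) (count3241 n)

open import Defs
open import Data.Nat using (ℕ)
open import Data.List using (List; []; _∷_)
open import Data.List.Membership.Propositional using (_∈_)
open import Data.List.Relation.Unary.Any using (here; there)
open import Data.Integer using (+_; -_)
open import Relation.Binary.PropositionalEquality using (refl; sym; trans)
open Main
open Permutations
open Symmetries

theorem3p3 : (σ : List ℕ) → σ ∈ ((2 ∷ 4 ∷ 3 ∷ 1 ∷ []) ∷ (4 ∷ 2 ∷ 1 ∷ 3 ∷ []) ∷ (3 ∷ 2 ∷ 4 ∷ 1 ∷ []) ∷ (4 ∷ 1 ∷ 3 ∷ 2 ∷ []) ∷ (2 ∷ 4 ∷ 1 ∷ 3 ∷ []) ∷ (3 ∷ 1 ∷ 4 ∷ 2 ∷ []) ∷ []) →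
    IsSqrtOneMinus8xCubed ((+ 32 · xTimes (Igf σ)) ⊕ poly (+ 1 ∷ - (+ 12) ∷ - (+ 8) ∷ []))
-- 2431 is the inverse of 4132, which is the reverse-complement of 3241.
theorem3p3 _ (here refl) = sqrtSeries represents2431 λ n → trans (sym (avoiders-4132-2431 n)) (count4132 n)
theorem3p3 _ (there (here refl)) = sqrtSeries represents4213 λ n → trans (sym (avoiders-3241-4213 n)) (count3241 n)
theorem3p3 _ (there (there (here refl))) = sqrtSeries represents3241 count3241
theorem3p3 _ (there (there (there (here refl)))) = sqrtSeries represents4132 count4132
theorem3p3 _ (there (there (there (there (here refl))))) = sqrtSeries represents2413 count2413
theorem3p3 _ (there (there (there (there (there (here refl)))))) = sqrtSeries represents3142 λ n → trans (sym (avoiders-2413-3142 n)) (count2413 n)
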